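{- Let $q$ be a prime power and $n\ge 2$ an integer. Let $C=\{\mathcal A_1,\ldots,\mathcal A_n\}$ be a collection of $\mathbb F_q$-affine hyperplanes of $\mathbb F_{q^n}$ in general position, let $\mathcal S_C^*=\bigcap_{i=1}^n\left(\mathbb F_{q^n}\setminus\mathcal A_i\right)$, and let $\mathcal P(\mathcal S_C^*)$ be the number of primitive elements of $\mathbb F_{q^n}$ lying in $\mathcal S_C^*$. Then $$\frac{q^n-1}{\varphi(q^n-1)}\,\mathcal P(\mathcal S_C^*)>(q-1)^n-\delta(q,n)\cdot W(q^n-1),$$ where $\delta(q,n)=\sum_{i=0}^{n-1}\binom{n}{i}q^{\min\{i,\,n/2\}}$.
   Context: $\mathbb F_{q^n}$ is regarded as an $n$-dimensional vector space over $\mathbb F_q$. An $\mathbb F_q$-affine space of dimension $t$ is a set $u+V$ with $u\in\mathbb F_{q^n}$ and $V$ an $\mathbb F_q$-linear subspace of dimension $t$; an $\mathbb F_q$-affine hyperplane has dimension $n-1$. The collection $C$ is in general position if for each $1\le k\le n$ the intersection of any $k$ distinct elements of $C$ is an $\mathbb F_q$-affine space of dimension $n-k$. A primitive element is a generator of $\mathbb F_{q^n}^*$. $\varphi$ is Euler's totient function, and $W(t)$ denotes the number of squarefree positive divisors of $t$. -}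

module Defs where

open import Data.Bool using (Bool; true; false; _∧_; not; if_then_else_)
open import Data.Nat as ℕ using (ℕ; zero; suc; _∸_; _^_; _≤_; _<_; _≤?_; _≟_)
import Data.Nat as Nat
open import Data.Nat.Primality using (Prime)
open import Data.Nat.Divisibility using (_∣_; _∣?_)
open import Data.Nat.GCD using (gcd)
open import Data.Nat.Combinatorics using (_C_)
open import Data.Integer as ℤ using (ℤ; +_; ∣_∣)
open import Data.Fin using (Fin)
open import Data.Vec using (Vec; []; _∷_)
open import Data.Vec.Relation.Unary.All as VAll using ()
open import Data.List using (List; length; map; upTo; filterᵇ; foldr)
open import Data.Bool.ListAction using (all)
open import Data.List.Relation.Unary.Unique.Propositional using (Unique)
open import Data.List.Membership.Propositional using (_∈_)
open import Data.Product using (Σ; ∃; _×_; _,_)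
open import Data.Sum using (_⊎_)
open import Relation.Nullary using (¬_; does)
open import Relation.Binary.PropositionalEquality using (_≡_; _≢_)
open import Algebra.Structures using (IsCommutativeRing)
open import Function.Definitions using (Injective)

IsPrimePower : ℕ → Set
IsPrimePower q = ∃ λ p → ∃ λ k → Prime p × 1 ≤ k × q ≡ p ^ k

range1 : ℕ → List ℕ
range1 m = map suc (upTo m)

φ : ℕ → ℕ
φ m = length (filterᵇ (λ k → does (gcd k m ≟ 1)) (range1 m))

-- squarefree test for d ≥ 1: no e ≥ 2 (e ranging over 2 .. d+1, which
-- suffices since e*e ∣ d ≥ 1 forces e ≤ d) has e*e ∣ d
squarefreeᵇ : ℕ → Bool
squarefreeᵇ d = all (λ e → not (does ((e Nat.* e) ∣? d))) (map (2 Nat.+_) (upTo d))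

W : ℕ → ℕ
W t = length (filterᵇ (λ d → does (d ∣? t) ∧ squarefreeᵇ d) (range1 t))

sumBelow : ℕ → (ℕ → ℕ) → ℕ
sumBelow n f = foldr (λ i acc → f i Nat.+ acc) 0 (upTo n)

-- δ(q,n) = Σ_{i=0}^{n-1} C(n,i) q^{min(i, n/2)}.
-- Terms with 2i ≤ n contribute C(n,i) q^i (an integer); terms with 2i > n
-- contribute C(n,i) q^{n/2} = C(n,i) √(q^n).  Hence
--   δ(q,n) = δRat q n + δIrr n · √(q^n).
δRat : ℕ → ℕ → ℕ
δRat q n = sumBelow n (λ i → if does (2 Nat.* i ≤? n) then (n C i) Nat.* q ^ i else 0)

δIrr : ℕ → ℕ
δIrr n = sumBelow n (λ i → if does (2 Nat.* i ≤? n) then 0 else n C i)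

-- The real inequality  x < c · √Q  (x ∈ ℤ, c, Q ∈ ℕ), decided exactly:
-- it holds iff x < 0, or x ≥ 0 and x² < c² Q.
LtSqrt : ℤ → ℕ → ℕ → Set
LtSqrt x c Q = ℤ._<_ x (+ 0) ⊎ (∣ x ∣ Nat.* ∣ x ∣ < c Nat.* c Nat.* Q)

record Field : Set₁ where
  infixl 7 _*_
  infixl 6 _+_
  field
    Carrier : Set
    _+_ _*_ : Carrier → Carrier → Carrier
    -_ : Carrier → Carrier
    0# 1# : Carrier
    isCommutativeRing : IsCommutativeRing _≡_ _+_ _*_ -_ 0# 1#
    0≢1 : 0# ≢ 1#
    inverse : ∀ x → x ≢ 0# → ∃ λ y → x * y ≡ 1#

module _ (F : Field) where
  open Field F

  HasCardinality : ℕ → Set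
  HasCardinality N = Σ (List Carrier) λ xs → Unique xs × (∀ x → x ∈ xs) × length xs ≡ N

  CountIs : (Carrier → Set) → ℕ → Set
  CountIs P m = Σ (List Carrier) λ xs →
    Unique xs × (∀ x → (x ∈ xs → P x) × (P x → x ∈ xs)) × length xs ≡ m

  pow : Carrier → ℕ → Carrier
  pow x zero = 1#
  pow x (suc k) = x * pow x k

  InFq : ℕ → Carrier → Set
  InFq q x = pow x q ≡ x

  IsPrimitive : Carrier → Set
  IsPrimitive x = x ≢ 0# × (∀ y → y ≢ 0# → ∃ λ k → pow x k ≡ y)

  linComb : ∀ {t} → Vec Carrier t → Vec Carrier t → Carrier
  linComb [] [] = 0#
  linComb (c ∷ cs) (v ∷ vs) = c * v + linComb cs vs

  LinIndep : ℕ → ∀ {t} → Vec Carrier t → Set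
  LinIndep q {t} vs = (cs : Vec Carrier t) → VAll.All (InFq q) cs →
    linComb cs vs ≡ 0# → VAll.All (_≡ 0#) cs

  IsAffineSpace : ℕ → ℕ → (Carrier → Set) → Set
  IsAffineSpace q t S = ∃ λ u → Σ (Vec Carrier t) λ vs → LinIndep q vs ×
    (∀ x → (S x → ∃ λ cs → VAll.All (InFq q) cs × x ≡ u + linComb cs vs)
         × ((∃ λ cs → VAll.All (InFq q) cs × x ≡ u + linComb cs vs) → S x))

  IsAffineHyperplane : ℕ → ℕ → (Carrier → Set) → Set
  IsAffineHyperplane q n S = IsAffineSpace q (n ∸ 1) S

  PairwiseDistinct : ∀ {n} → (Fin n → Carrier → Set) → Set
  PairwiseDistinct A = ∀ i j → i ≢ j →
    ¬ (∀ x → (A i x → A j x) × (A j x → A i x))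

  GeneralPosition : ℕ → ∀ n → (Fin n → Carrier → Set) → Set
  GeneralPosition q n A = ∀ k → 1 ≤ k → k ≤ n → (f : Fin k → Fin n) →
    Injective _≡_ _≡_ f → IsAffineSpace q (n ∸ k) (λ x → ∀ i → A (f i) x)

  InSStar : ∀ {n} → (Fin n → Carrier → Set) → Carrier → Set
  InSStar A x = ∀ i → ¬ A i x

-- The conclusion
--   ((Q-1)/φ(Q-1)) · P > (q-1)^n − (δRat + δIrr·√Q)·W(Q-1),  Q = q^n,
-- multiplied through by φ(Q-1) > 0, i.e.
--   φ·(q-1)^n − φ·δRat·W − (Q-1)·P  <  (φ·δIrr·W) · √Q.
Bound : ℕ → ℕ → ℕ → Set
Bound q n P =
  LtSqrt (ℤ._-_ (+ (f Nat.* (q ∸ 1) ^ n)) (+ (f Nat.* δRat q n Nat.* w Nat.+ (Q ∸ 1) Nat.* P)))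
         (f Nat.* δIrr n Nat.* w) Q
  where
    Q = q ^ n
    f = φ (Q ∸ 1)
    w = W (Q ∸ 1)

{-# OPTIONS --safe #-}

-- Put Q = q^n and N = Q − 1. For a duplicate-free list D of prime divisors of N,
-- let T D be the sum of the multiplicative characters of order ∏ D. It is
-- integer valued, T D x = ∏_{p ∈ D} (p [x^(N/p) = 1] − 1), so no complex numbers
-- are needed; Σ_z T D (x z) T D z = N T D x plays the role of orthogonality.
--
-- Expanding p [x^(N/p) ≠ 1] = (p − 1) − T {p} x over all primes p ∣ N expresses
-- primitivity by the T D and leaves Σ_{x ∈ S*} T D x to be bounded. By
-- inclusion–exclusion this is a signed sum of Σ_{x ∈ B} T D x over affine spaces
-- B = u + V of dimension i < n, bounded trivially by φ(∏ D) q^i and, using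
-- translates, by φ(∏ D) √Q: the second moments of the sums over the translates
-- B + b, summed over all b ∈ F, can be evaluated exactly, every b ∈ V contributes
-- the same as b = 0, and the other terms are nonnegative.

module Submission where

open import Defs
open import Data.Nat using (ℕ; zero; suc; _+_; _*_; _∸_; _^_; _/_; _%_; _≤_; _<_; _≤?_; _<?_; z≤n; s≤s;
  >-nonZero; nonTrivial⇒n>1)
import Data.Nat.Properties as ℕ
open import Data.Integer as ℤ using (ℤ; +_; 0ℤ; 1ℤ; ∣_∣)
  renaming (_+_ to _+ᶻ_; _*_ to _*ᶻ_; _-_ to _-ᶻ_; _≤_ to _≤ᶻ_)
import Data.Integer.Properties as ℤ
open import Data.Integer.Tactic.RingSolver using ()
  renaming (solve-∀ to solveℤ)
open import Data.Bool using (true; false; if_then_else_; T?; _∧_; not)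
  renaming (T to IsTrue)
open import Data.List using (List; []; _∷_; _++_; length; map; filter; filterᵇ; foldr; lookup; upTo; applyUpTo;
  allFin; cartesianProductWith)
open import Data.List.Properties using (length-++; length-map; length-upTo; map-upTo; length-tabulate)
open import Data.List.Membership.Propositional using (_∈_; lose; find)
open import Data.List.Membership.Propositional.Properties
open import Data.List.Membership.Propositional.Properties.WithK using (unique∧set⇒bag)
open import Data.List.Relation.Binary.BagAndSetEquality using (∼bag⇒↭)
open import Data.List.Relation.Binary.Permutation.Propositional as ↭ using (_↭_; ↭⇒↭ₛ)
open import Data.List.Relation.Binary.Permutation.Propositional.Properties using (↭-length)
open import Data.List.Relation.Unary.Any as Any using (here; there; Any)
open import Data.List.Relation.Unary.All as All using (All; []; _∷_)
open import Data.List.Relation.Unary.AllPairs using ([]; _∷_)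
open import Data.List.Relation.Unary.Unique.Propositional using (Unique)
import Data.List.Relation.Unary.Unique.Propositional.Properties as Unique
open import Data.Product using (Σ; ∃; _×_; _,_; proj₁; proj₂)
open import Data.Sum using (inj₁; inj₂)
open import Function using (_∘_; mk⇔; id; Equivalence)
open import Relation.Nullary using (¬_; Dec; yes; no; does; contradiction; ¬?)
open import Relation.Nullary.Decidable using (dec-true; dec-false; _×-dec_; decidable-stable; map′)
open import Relation.Unary using (Decidable)
open import Relation.Binary.Definitions using (DecidableEquality; tri<; tri≈; tri>)
open import Relation.Binary.PropositionalEquality hiding ([_])
open import Level using (0ℓ)
open import Algebra.Bundles using (CommutativeRing; CommutativeMonoid)
import Algebra.Properties.Ring as RingProperties
import Algebra.Properties.Semiring.Mult as SemiringMult
import Algebra.Properties.Semiring.Exp as SemiringExp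
import Algebra.Properties.Semiring.Sum as SemiringSum
import Algebra.Properties.CommutativeSemiring.Exp as CommutativeSemiringExp
import Algebra.Properties.CommutativeSemiring.Binomial as Binomial
import Algebra.Solver.Ring.NaturalCoefficients.Default as SemiringSolver
open import Data.Nat.Tactic.RingSolver using ()
  renaming (solve-∀ to solveℕ)
open import Data.Nat.Divisibility as ∣ using (_∣_; divides; ∣⇒≤; _∣?_)
open import Data.Nat.Primality using (Prime; prime?; euclidsLemma; ¬prime[0]; ¬prime[1]; prime⇒nonZero; prime⇒nonTrivial;
  prime⇒irreducible; productOfPrimes≥1)
open import Data.Nat.Combinatorics using (_C_; nCn≡1; nC1≡n; nCk+nC[k+1]≡[n+1]C[k+1]; k>n⇒nCk≡0)
open import Data.Fin as Fin using (Fin; toℕ; fromℕ; inject₁; zero; suc)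
import Data.Fin.Properties as Fin
open import Data.Vec as Vec using (Vec; []; _∷_; replicate)
open import Algebra.Definitions.RawMonoid using ()
  renaming (_×_ to mult)
open import Algebra.Structures using (IsCommutativeMonoid)
import Data.List.Relation.Unary.Any.Properties as Any
import Data.List.Relation.Binary.Permutation.Setoid.Properties as Permutation
open import Data.Nat.ListAction using (product)
open import Data.Nat.ListAction.Properties using (∈⇒∣product)
open import Data.Nat.DivMod using (m/n*n≡m; m≡m%n+[m/n]*n; m%n<n)
open import Data.Nat.Coprimality using (Coprime; coprime⇒gcd≡1; prime⇒coprime; gcd≡1⇒coprime; coprime-divisor)
open import Data.Nat.GCD using (gcd; gcd-GCD; module Bézout; gcd[m,n]∣m; gcd[m,n]∣n)
open import Data.Nat.Primality.Factorisation using (factorise)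
open import Data.Vec.Properties using (∷-injective)
open import Data.Vec.Relation.Unary.All as VAll using ([]; _∷_)
import Algebra.Properties.CommutativeSemigroup as CommutativeSemigroupProperties
open import Data.Bool.Properties using (T-∧; T-≡)
import Data.List.Relation.Unary.All.Properties as All
open import Data.Unit using (⊤)

-- In terms of characters: let S_χ be the sum over `B` of χ, one of the `Φ D` characters that make
-- up `T D`. The integer function z ↦ Σ_{x ∈ B} T D (x z) equals Σ_χ χ(z) S_χ, so its second moment
-- over z is N Σ |S_χ|². This controls the S_χ although they are not integers: averaging over
-- translates gives Σ |S_χ|² ≤ Φ(D) Q, and Cauchy-Schwarz over the characters gives |Σ S_χ| ≤ Φ(D)
-- √Q, in place of Gauss sums.
--
-- The sieve sees only the primes of N and produces the factor R / ∏ (p - 1), with R the radical of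
-- N, where the theorem has N / φ(N). They agree because φ(N) R = N ∏ (p - 1), which is obtained by
-- counting primitive elements twice: by the sieve over all of F, and as powers of a generator,
-- whose existence the first count provides.
--
-- Strictness comes from a spare error term. With ω prime divisors there are 2^ω - 1 nonempty `D`,
-- but W(N) ≥ 2^ω. The spare δ is at least 2; one unit of it pays for the element 0, which may lie
-- in S* but is invisible to the characters.

private
  module +ᶻ = CommutativeSemigroupProperties ℤ.+-commutativeSemigroup
  module *ᶻ = CommutativeSemigroupProperties ℤ.*-commutativeSemigroup
  module +ℕ = CommutativeSemigroupProperties ℕ.+-commutativeSemigroup

-- Finite sums of integers

unique-set⇒↭ : {A : Set} {xs ys : List A} → Unique xs → Unique ys →
  (∀ {x} → x ∈ xs → x ∈ ys) → (∀ {x} → x ∈ ys → x ∈ xs) → xs ↭ ys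
unique-set⇒↭ ux uy f g = ∼bag⇒↭ (unique∧set⇒bag ux uy (mk⇔ f g))

unique-⊆-length : {A : Set} {xs ys : List A} → Unique xs →
  (∀ {x} → x ∈ xs → x ∈ ys) → length xs ≤ length ys
unique-⊆-length {xs = []} _ _ = z≤n
unique-⊆-length {xs = x ∷ xs} {ys} (x∉ ∷ ux) sub with ∈-∃++ (sub (here refl))
... | as , bs , refl = begin
  suc (length xs)            ≤⟨ s≤s (unique-⊆-length ux sub′) ⟩
  suc (length (as ++ bs))    ≡⟨ cong suc (length-++ as) ⟩
  suc (length as + length bs) ≡⟨ ℕ.+-suc (length as) (length bs) ⟨
  length as + suc (length bs) ≡⟨ length-++ as ⟨
  length (as ++ x ∷ bs)      ∎
  where
  open ℕ.≤-Reasoning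
  sub′ : ∀ {z} → z ∈ xs → z ∈ as ++ bs
  sub′ {z} z∈ with ∈-++⁻ as (sub (there z∈))
  ... | inj₁ p = ∈-++⁺ˡ p
  ... | inj₂ (here z≡x) = contradiction (sym z≡x) (All.lookup x∉ z∈)
  ... | inj₂ (there p) = ∈-++⁺ʳ as p

-- Pigeonhole: a missing y would make `y ∷ xs` a duplicate-free list inside `ys` and longer than it.
-- It serves to show that explicit lists of roots or powers are exhaustive.
unique-full : {A : Set} → DecidableEquality A → {xs ys : List A} → Unique xs →
  (∀ {x} → x ∈ xs → x ∈ ys) → length ys ≤ length xs → ∀ {y} → y ∈ ys → y ∈ xs
unique-full _≟_ {xs} {ys} xs! sub len {y} y∈ with Any.any? (y ≟_) xs
... | yes m = m
... | no y∉ = contradiction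
  (unique-⊆-length (All.tabulate (λ m e → y∉ (subst (_∈ xs) (sym e) m)) ∷ xs!) sub′)
  (ℕ.<⇒≱ (s≤s len))
  where
  sub′ : ∀ {x} → x ∈ y ∷ xs → x ∈ ys
  sub′ (here refl) = y∈
  sub′ (there m)   = sub m

map-unique : {A B : Set} {f : A → B} {xs : List A} → Unique xs →
  (∀ {x y} → x ∈ xs → y ∈ xs → f x ≡ f y → x ≡ y) → Unique (map f xs)
map-unique []         inj = []
map-unique {f = f} {x ∷ xs} (x∉ ∷ xs!) inj =
  All.tabulate (λ m e → let (y , y∈ , e′) = ∈-map⁻ f m in
    All.lookup x∉ y∈ (inj (here refl) (there y∈) (trans e e′))) ∷
  map-unique xs! (λ a b → inj (there a) (there b))

-- Two disjoint duplicate-free lists; the recursions below move elements from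
-- the left list to the right one.
record Split {A : Set} (P : A → Set) (L D : List A) : Set where
  constructor split
  field
    left!    : Unique L
    right!   : Unique D
    left∀    : All P L
    right∀   : All P D
    disjoint : All (λ a → All (a ≢_) D) L

module _ {A : Set} {P : A → Set} {a : A} {L D : List A} where

  dropHead : Split P (a ∷ L) D → Split P L D
  dropHead (split (_ ∷ L!) D! (_ ∷ L∀) D∀ (_ ∷ dis)) = split L! D! L∀ D∀ dis

  moveHead : Split P (a ∷ L) D → Split P L (a ∷ D)
  moveHead (split (a∉L ∷ L!) D! (Pa ∷ L∀) D∀ (a∉D ∷ dis)) =
    split L! (a∉D ∷ D!) L∀ (Pa ∷ D∀) (All.zipWith (λ (a≢b , b∉D) → ≢-sym a≢b ∷ b∉D) (a∉L , dis))

∑ : {A : Set} → List A → (A → ℤ) → ℤ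
∑ []       f = 0ℤ
∑ (x ∷ xs) f = f x +ᶻ ∑ xs f

module _ {A : Set} where

  ∑-cong-∈ : (xs : List A) {f g : A → ℤ} → (∀ {x} → x ∈ xs → f x ≡ g x) → ∑ xs f ≡ ∑ xs g
  ∑-cong-∈ []       e = refl
  ∑-cong-∈ (x ∷ xs) e = cong₂ _+ᶻ_ (e (here refl)) (∑-cong-∈ xs (e ∘ there))

  ∑-cong : (xs : List A) {f g : A → ℤ} → (∀ x → f x ≡ g x) → ∑ xs f ≡ ∑ xs g
  ∑-cong xs e = ∑-cong-∈ xs (λ {x} _ → e x)

  ∑-mono : (xs : List A) {f g : A → ℤ} → (∀ x → f x ≤ᶻ g x) → ∑ xs f ≤ᶻ ∑ xs g
  ∑-mono []       e = ℤ.≤-refl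
  ∑-mono (x ∷ xs) e = ℤ.+-mono-≤ (e x) (∑-mono xs e)

  ∑-+ : (xs : List A) (f g : A → ℤ) → ∑ xs (λ x → f x +ᶻ g x) ≡ ∑ xs f +ᶻ ∑ xs g
  ∑-+ []       f g = refl
  ∑-+ (x ∷ xs) f g = trans (cong (_+ᶻ_ (f x +ᶻ g x)) (∑-+ xs f g)) (+ᶻ.interchange (f x) (g x) _ _)

  ∑-*ˡ : (xs : List A) (c : ℤ) (f : A → ℤ) → ∑ xs (λ x → c *ᶻ f x) ≡ c *ᶻ ∑ xs f
  ∑-*ˡ []       c f = sym (ℤ.*-zeroʳ c)
  ∑-*ˡ (x ∷ xs) c f = trans (cong (_+ᶻ_ (c *ᶻ f x)) (∑-*ˡ xs c f)) (sym (ℤ.*-distribˡ-+ c (f x) _))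

  ∑-*ʳ : (xs : List A) (c : ℤ) (f : A → ℤ) → ∑ xs (λ x → f x *ᶻ c) ≡ ∑ xs f *ᶻ c
  ∑-*ʳ xs c f = trans (∑-cong xs (λ x → ℤ.*-comm (f x) c)) (trans (∑-*ˡ xs c f) (ℤ.*-comm c _))

  ∑-minus : (xs : List A) (f g : A → ℤ) → ∑ xs (λ x → f x -ᶻ g x) ≡ ∑ xs f -ᶻ ∑ xs g
  ∑-minus xs f g = trans (∑-cong xs (λ x → minus (f x) (g x)))
    (trans (∑-+ xs f (λ x → ℤ.-1ℤ *ᶻ g x))
      (trans (cong (_+ᶻ_ (∑ xs f)) (∑-*ˡ xs ℤ.-1ℤ g)) (sym (minus (∑ xs f) (∑ xs g)))))
    where
    minus : ∀ a b → a -ᶻ b ≡ a +ᶻ ℤ.-1ℤ *ᶻ b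
    minus a b = cong (_+ᶻ_ a) (sym (ℤ.-1*i≡-i b))

  ∑-const : (xs : List A) (c : ℤ) → ∑ xs (λ _ → c) ≡ + length xs *ᶻ c
  ∑-const []       c = refl
  ∑-const (x ∷ xs) c = trans (cong (_+ᶻ_ c) (∑-const xs c)) (sym (ℤ.suc-* (+ length xs) c))

  ∑-zero : (xs : List A) → ∑ xs (λ _ → 0ℤ) ≡ 0ℤ
  ∑-zero xs = trans (∑-const xs 0ℤ) (ℤ.*-zeroʳ (+ length xs))

  ∑-↭ : {xs ys : List A} (f : A → ℤ) → xs ↭ ys → ∑ xs f ≡ ∑ ys f
  ∑-↭ f ↭.refl          = refl
  ∑-↭ f (↭.prep x p)    = cong (_+ᶻ_ (f x)) (∑-↭ f p)
  ∑-↭ f (↭.swap x y p)  = trans (cong (λ z → f x +ᶻ (f y +ᶻ z)) (∑-↭ f p)) (+ᶻ.x∙yz≈y∙xz (f x) (f y) _)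
  ∑-↭ f (↭.trans p q)   = trans (∑-↭ f p) (∑-↭ f q)

  ∑-map : {B : Set} (h : B → A) (xs : List B) (f : A → ℤ) → ∑ (map h xs) f ≡ ∑ xs (f ∘ h)
  ∑-map h []       f = refl
  ∑-map h (x ∷ xs) f = cong (_+ᶻ_ (f (h x))) (∑-map h xs f)

∑-swap : {A B : Set} (xs : List A) (ys : List B) (f : A → B → ℤ) →
  ∑ xs (λ x → ∑ ys (f x)) ≡ ∑ ys (λ y → ∑ xs (λ x → f x y))
∑-swap []       ys f = sym (∑-zero ys)
∑-swap (x ∷ xs) ys f = trans (cong (_+ᶻ_ (∑ ys (f x))) (∑-swap xs ys f))
  (sym (∑-+ ys (f x) (λ y → ∑ xs (λ x′ → f x′ y))))

∑-*-∑ : {A B : Set} (xs : List A) (ys : List B) (f : A → ℤ) (g : B → ℤ) →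
  ∑ xs f *ᶻ ∑ ys g ≡ ∑ xs (λ x → ∑ ys (λ y → f x *ᶻ g y))
∑-*-∑ xs ys f g = trans (sym (∑-*ʳ xs (∑ ys g) f)) (∑-cong xs (λ x → sym (∑-*ˡ ys (f x) g)))

⟦_⟧ : {P : Set} → Dec P → ℤ
⟦ d ⟧ = if does d then 1ℤ else 0ℤ

module _ {P : Set} where

  ⟦⟧-yes : (d : Dec P) → P → ⟦ d ⟧ ≡ 1ℤ
  ⟦⟧-yes d p = cong (λ b → if b then 1ℤ else 0ℤ) (dec-true d p)

  ⟦⟧-no : (d : Dec P) → ¬ P → ⟦ d ⟧ ≡ 0ℤ
  ⟦⟧-no d ¬p = cong (λ b → if b then 1ℤ else 0ℤ) (dec-false d ¬p)

  ⟦⟧-idem : (d : Dec P) → ⟦ d ⟧ *ᶻ ⟦ d ⟧ ≡ ⟦ d ⟧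
  ⟦⟧-idem (yes _) = refl
  ⟦⟧-idem (no _)  = refl

  0≤⟦⟧ : (d : Dec P) → 0ℤ ≤ᶻ ⟦ d ⟧
  0≤⟦⟧ (yes _) = ℤ.+≤+ z≤n
  0≤⟦⟧ (no _)  = ℤ.+≤+ z≤n

⟦⟧-⇔ : {P R : Set} (d : Dec P) (e : Dec R) → (P → R) → (R → P) → ⟦ d ⟧ ≡ ⟦ e ⟧
⟦⟧-⇔ (yes p) e f g = sym (⟦⟧-yes e (f p))
⟦⟧-⇔ (no ¬p) e f g = sym (⟦⟧-no e (¬p ∘ g))

⟦⟧-¬ : {P : Set} (d : Dec P) → ⟦ ¬? d ⟧ ≡ 1ℤ -ᶻ ⟦ d ⟧
⟦⟧-¬ (yes _) = refl
⟦⟧-¬ (no _)  = refl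

⟦⟧-× : {P R : Set} (d : Dec P) (e : Dec R) → ⟦ d ×-dec e ⟧ ≡ ⟦ d ⟧ *ᶻ ⟦ e ⟧
⟦⟧-× (yes _) (yes _) = refl
⟦⟧-× (yes _) (no _)  = refl
⟦⟧-× (no _)  _       = refl

module _ {A : Set} {P : A → Set} (P? : Decidable P) where

  ∑-⟦⟧ : (xs : List A) → ∑ xs (⟦_⟧ ∘ P?) ≡ + length (filter P? xs)
  ∑-⟦⟧ []       = refl
  ∑-⟦⟧ (x ∷ xs) with P? x
  ... | yes _ = trans (cong (_+ᶻ_ 1ℤ) (∑-⟦⟧ xs)) refl
  ... | no  _ = trans (ℤ.+-identityˡ _) (∑-⟦⟧ xs)

  count-⟦⟧ : {xs ys : List A} → Unique xs → Unique ys →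
    (∀ {x} → x ∈ ys → x ∈ xs × P x) → (∀ {x} → x ∈ xs → P x → x ∈ ys) →
    ∑ xs (⟦_⟧ ∘ P?) ≡ + length ys
  count-⟦⟧ {xs} {ys} ux uy f g = trans (∑-⟦⟧ xs) (cong +_ (↭-length
    (unique-set⇒↭ (Unique.filter⁺ P? ux) uy
      (λ m → let (a , b) = ∈-filter⁻ P? m in g a b)
      (λ m → let (a , b) = f m in ∈-filter⁺ P? a b))))

module _ {A : Set} (_≟_ : DecidableEquality A) where

  ∑-δ : {xs : List A} → Unique xs → ∀ {a} → a ∈ xs → (f : A → ℤ) →
    ∑ xs (λ x → ⟦ a ≟ x ⟧ *ᶻ f x) ≡ f a
  ∑-δ {x ∷ xs} (x∉ ∷ _) {a} (here refl) f = begin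
    ⟦ a ≟ a ⟧ *ᶻ f a +ᶻ ∑ xs (λ x → ⟦ a ≟ x ⟧ *ᶻ f x)
      ≡⟨ cong₂ _+ᶻ_ (trans (cong (_*ᶻ f a) (⟦⟧-yes (a ≟ a) refl)) (ℤ.*-identityˡ (f a)))
           (trans (∑-cong-∈ xs (λ {x} x∈ → cong (_*ᶻ f x) (⟦⟧-no (a ≟ x) (All.lookup x∉ x∈)))) (∑-zero xs)) ⟩
    f a +ᶻ 0ℤ ≡⟨ ℤ.+-identityʳ (f a) ⟩
    f a ∎
    where open ≡-Reasoning
  ∑-δ {x ∷ xs} (x∉ ∷ ux) {a} (there a∈) f = begin
    ⟦ a ≟ x ⟧ *ᶻ f x +ᶻ ∑ xs (λ x → ⟦ a ≟ x ⟧ *ᶻ f x)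
      ≡⟨ cong₂ _+ᶻ_ (cong (_*ᶻ f x) (⟦⟧-no (a ≟ x) (≢-sym (All.lookup x∉ a∈)))) (∑-δ ux a∈ f) ⟩
    0ℤ +ᶻ f a ≡⟨ ℤ.+-identityˡ (f a) ⟩
    f a ∎
    where open ≡-Reasoning

-- Fields

C-absorb : ∀ n k → suc k * (suc n C suc k) ≡ suc n * (n C k)
C-absorb n       zero    = trans (ℕ.*-identityˡ _) (trans (nC1≡n (suc n)) (sym (ℕ.*-identityʳ (suc n))))
C-absorb zero    (suc k) = trans (cong (suc (suc k) *_) (k>n⇒nCk≡0 {1} {suc (suc k)} (s≤s (s≤s z≤n))))
  (trans (ℕ.*-zeroʳ (suc (suc k))) (sym (cong (1 *_) (k>n⇒nCk≡0 {0} {suc k} (s≤s z≤n)))))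
C-absorb (suc n) (suc k) = begin
  suc (suc k) * (suc (suc n) C suc (suc k))
    ≡⟨ cong (suc (suc k) *_) (nCk+nC[k+1]≡[n+1]C[k+1] (suc n) (suc k)) ⟨
  suc (suc k) * (c + (suc n C suc (suc k)))
    ≡⟨ regroup (suc k) c (suc n C suc (suc k)) ⟩
  suc k * c + (suc (suc k) * (suc n C suc (suc k)) + c)
    ≡⟨ cong₂ (λ a b → a + (b + c)) (C-absorb n k) (C-absorb n (suc k)) ⟩
  suc n * (n C k) + (suc n * (n C suc k) + c)
    ≡⟨ regroup′ (suc n) (n C k) (n C suc k) c ⟩
  suc n * ((n C k) + (n C suc k)) + c
    ≡⟨ cong (λ z → suc n * z + c) (nCk+nC[k+1]≡[n+1]C[k+1] n k) ⟩
  suc n * c + c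
    ≡⟨ ℕ.+-comm (suc n * c) c ⟩
  suc (suc n) * c ∎
  where
  open ≡-Reasoning
  c = suc n C suc k
  regroup : ∀ k c d → suc k * (c + d) ≡ k * c + (suc k * d + c)
  regroup = solveℕ
  regroup′ : ∀ m a b c → m * a + (m * b + c) ≡ m * (a + b) + c
  regroup′ = solveℕ

-- By absorption p divides k (p C k), and Euclid's lemma removes the factor k, which is too small to
-- be divisible by p.
p∣pCk : ∀ {p k} → Prime p → 0 < k → k < p → p ∣ p C k
p∣pCk {suc n} {suc k} pr _ k<p with euclidsLemma (suc k) (suc n C suc k) pr
  (divides (n C k) (trans (C-absorb n k) (ℕ.*-comm (suc n) (n C k))))
... | inj₁ p∣k = contradiction (∣⇒≤ p∣k) (ℕ.<⇒≱ k<p)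
... | inj₂ p∣C = p∣C

module FieldProperties (F : Field) where
  open Field F renaming (_+_ to _⊕_; _*_ to _⊗_; -_ to ⊖_) public

  commutativeRing : CommutativeRing 0ℓ 0ℓ
  commutativeRing = record { isCommutativeRing = isCommutativeRing }

  module R = CommutativeRing commutativeRing
  module RP = RingProperties R.ring
  open SemiringMult R.semiring public using () renaming (_×_ to _·_)
  private
    module M = SemiringMult R.semiring
    module E = SemiringExp R.semiring
    module CE = CommutativeSemiringExp R.commutativeSemiring
    module S = SemiringSum R.semiring
    module B = Binomial R.commutativeSemiring
    module Solver = SemiringSolver R.commutativeSemiring
  open Solver using (_:=_; _:+_; _:*_)

  ⊗-cancelˡ : ∀ {x y z} → x ≢ 0# → x ⊗ y ≡ x ⊗ z → y ≡ z
  ⊗-cancelˡ {x} {y} {z} x≢0 e = trans (sym (unit y)) (trans (cong (x⁻¹ ⊗_) e) (unit z))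
    where
    x⁻¹ = proj₁ (inverse x x≢0)
    unit : ∀ w → x⁻¹ ⊗ (x ⊗ w) ≡ w
    unit w = trans (sym (R.*-assoc x⁻¹ x w))
      (trans (cong (_⊗ w) (trans (R.*-comm x⁻¹ x) (proj₂ (inverse x x≢0)))) (R.*-identityˡ w))

  ⊗-zero-factor : ∀ {x y} → x ≢ 0# → x ⊗ y ≡ 0# → y ≡ 0#
  ⊗-zero-factor x≢0 e = ⊗-cancelˡ x≢0 (trans e (sym (R.zeroʳ _)))

  ⊗-nonzero : ∀ {x y} → x ≢ 0# → y ≢ 0# → x ⊗ y ≢ 0#
  ⊗-nonzero x≢0 y≢0 e = y≢0 (⊗-zero-factor x≢0 e)

  ⊕-⊖-cancel : ∀ x c → (x ⊕ c) ⊕ ⊖ c ≡ x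
  ⊕-⊖-cancel x c = trans (R.+-assoc x c (⊖ c)) (trans (cong (x ⊕_) (R.-‿inverseʳ c)) (R.+-identityʳ x))

  ⊖-⊕-cancel : ∀ x c → (x ⊕ ⊖ c) ⊕ c ≡ x
  ⊖-⊕-cancel x c = trans (R.+-assoc x (⊖ c) c) (trans (cong (x ⊕_) (R.-‿inverseˡ c)) (R.+-identityʳ x))

  ⊕-cancelʳ : ∀ {x y} c → x ⊕ c ≡ y ⊕ c → x ≡ y
  ⊕-cancelʳ {x} {y} c e = trans (sym (⊕-⊖-cancel x c)) (trans (cong (_⊕ ⊖ c) e) (⊕-⊖-cancel y c))

  infixr 8 _↑_
  _↑_ : Carrier → ℕ → Carrier
  _↑_ = pow F

  ↑≡^ : ∀ x k → x ↑ k ≡ x E.^ k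
  ↑≡^ x zero    = refl
  ↑≡^ x (suc k) = cong (x ⊗_) (↑≡^ x k)

  ↑-+ : ∀ x m n → x ↑ (m + n) ≡ x ↑ m ⊗ x ↑ n
  ↑-+ x m n = trans (↑≡^ x (m + n)) (trans (E.^-homo-* x m n)
    (sym (cong₂ _⊗_ (↑≡^ x m) (↑≡^ x n))))

  ↑-* : ∀ x m n → x ↑ (m * n) ≡ (x ↑ m) ↑ n
  ↑-* x m n = trans (↑≡^ x (m * n)) (trans (sym (E.^-assocʳ x m n))
    (sym (trans (↑≡^ (x ↑ m) n) (cong (E._^ n) (↑≡^ x m)))))

  ↑-*′ : ∀ x m n → x ↑ (m * n) ≡ (x ↑ n) ↑ m
  ↑-*′ x m n = trans (cong (x ↑_) (ℕ.*-comm m n)) (↑-* x n m)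

  ⊗-↑ : ∀ x y n → (x ⊗ y) ↑ n ≡ x ↑ n ⊗ y ↑ n
  ⊗-↑ x y n = trans (↑≡^ (x ⊗ y) n) (trans (CE.^-distrib-* x y n)
    (sym (cong₂ _⊗_ (↑≡^ x n) (↑≡^ y n))))

  1↑ : ∀ n → 1# ↑ n ≡ 1#
  1↑ zero    = refl
  1↑ (suc n) = trans (R.*-identityˡ _) (1↑ n)

  0↑ : ∀ n → 0 < n → 0# ↑ n ≡ 0#
  0↑ (suc n) _ = R.zeroˡ _

  ↑-nonzero : ∀ {x} n → x ≢ 0# → x ↑ n ≢ 0#
  ↑-nonzero zero    x≢0 = ≢-sym 0≢1
  ↑-nonzero (suc n) x≢0 = ⊗-nonzero x≢0 (↑-nonzero n x≢0)

  ↑-root : ∀ {x m} → x ↑ m ≡ 1# → ∀ {n} → m ∣ n → x ↑ n ≡ 1#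
  ↑-root {x} {m} e (divides k refl) = trans (↑-*′ x k m) (trans (cong (_↑ k) e) (1↑ k))

  monic : ∀ {d} → Vec Carrier d → Carrier → Carrier
  monic []       x = 1#
  monic (c ∷ cs) x = c ⊕ x ⊗ monic cs x

  -- Division of a monic polynomial by x − r, stated without subtraction.
  divide : ∀ {d} (cs : Vec Carrier (suc d)) r → Σ (Vec Carrier d) λ ds →
    ∀ x → monic cs x ⊕ r ⊗ monic ds x ≡ x ⊗ monic ds x ⊕ monic cs r
  divide (c ∷ []) r = [] , λ x → Solver.solve 4
    (λ c x r o → (c :+ x :* o) :+ r :* o := x :* o :+ (c :+ r :* o)) refl c x r 1#
  divide (c ∷ cs@(_ ∷ _)) r with divide cs r
  ... | ds , e = monic cs r ∷ ds , λ x →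
    let p = monic cs x ; d = monic ds x ; p₀ = monic cs r in begin
    (c ⊕ x ⊗ p) ⊕ r ⊗ (p₀ ⊕ x ⊗ d)
      ≡⟨ Solver.solve 6 (λ c x p r p₀ d → (c :+ x :* p) :+ r :* (p₀ :+ x :* d) :=
           x :* (p :+ r :* d) :+ (c :+ r :* p₀)) refl c x p r p₀ d ⟩
    x ⊗ (p ⊕ r ⊗ d) ⊕ (c ⊕ r ⊗ p₀)
      ≡⟨ cong (λ z → x ⊗ z ⊕ (c ⊕ r ⊗ p₀)) (trans (e x) (R.+-comm (x ⊗ d) p₀)) ⟩
    x ⊗ (p₀ ⊕ x ⊗ d) ⊕ (c ⊕ r ⊗ p₀) ∎
    where open ≡-Reasoning

  -- With d the quotient by x - r, every further root x satisfies (x - r) d(x) = 0 and differs from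
  -- r, so it is a root of a monic polynomial of smaller degree.
  monic-roots : ∀ {d} (cs : Vec Carrier d) {rs} → Unique rs → All (λ r → monic cs r ≡ 0#) rs →
    length rs ≤ d
  monic-roots cs [] [] = z≤n
  monic-roots [] (_ ∷ _) (e ∷ _) = contradiction (sym e) 0≢1
  monic-roots (c ∷ cs) {r ∷ rs} (r∉ ∷ u) (e ∷ es) = s≤s (monic-roots ds u (All.zipWith root (r∉ , es)))
    where
    ds = proj₁ (divide (c ∷ cs) r)
    root : ∀ {x} → r ≢ x × monic (c ∷ cs) x ≡ 0# → monic ds x ≡ 0#
    root {x} (r≢x , ex) = ⊗-zero-factor {x ⊕ ⊖ r} x-r≢0
      (trans (RP.[y-z]x≈yx-zx d x r) (trans (cong (_⊕ ⊖ (r ⊗ d)) (sym eq)) (R.-‿inverseʳ (r ⊗ d))))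
      where
      d = monic ds x
      x-r≢0 : x ⊕ ⊖ r ≢ 0#
      x-r≢0 z = r≢x (sym (RP.x∙y⁻¹≈ε⇒x≈y x r z))
      eq : r ⊗ d ≡ x ⊗ d
      eq = trans (sym (R.+-identityˡ _)) (trans (cong (_⊕ r ⊗ d) (sym ex))
        (trans (proj₂ (divide (c ∷ cs) r) x) (trans (cong (x ⊗ d ⊕_) e) (R.+-identityʳ _))))

  roots-of-unity : ∀ {d} → 0 < d → ∀ {rs} → Unique rs → All (λ r → r ↑ d ≡ 1#) rs → length rs ≤ d
  roots-of-unity {suc d} _ u es = monic-roots (⊖ 1# ∷ replicate d 0#) u (All.map root es)
    where
    power : ∀ d x → monic (replicate d 0#) x ≡ x ↑ d
    power zero    x = refl
    power (suc d) x = trans (R.+-identityˡ _) (cong (x ⊗_) (power d x))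
    root : ∀ {x} → x ↑ suc d ≡ 1# → monic (⊖ 1# ∷ replicate d 0#) x ≡ 0#
    root {x} e = trans (cong (λ z → ⊖ 1# ⊕ x ⊗ z) (power d x)) (trans (cong (⊖ 1# ⊕_) e) (R.-‿inverseˡ 1#))

  ·1-nonzero : ∀ p m → p · 1# ≢ 0# → (p ^ m) · 1# ≢ 0#
  ·1-nonzero p zero    h e = 0≢1 (sym (trans (sym (M.×-homo-1 1#)) e))
  ·1-nonzero p (suc m) h e = ⊗-nonzero h (·1-nonzero p m h) (trans (sym (M.×1-homo-* p (p ^ m))) e)

  module _ {p} (pr : Prime p) (char : p · 1# ≡ 0#) where

    p∣n⇒n·x≡0 : ∀ {n} → p ∣ n → ∀ x → n · x ≡ 0#
    p∣n⇒n·x≡0 (divides k refl) x = begin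
      (k * p) · x ≡⟨ cong (λ z → (k * p) · z) (R.*-identityˡ x) ⟨
      (k * p) · (1# ⊗ x) ≡⟨ M.×-assoc-* (k * p) 1# x ⟨
      ((k * p) · 1#) ⊗ x ≡⟨ cong (_⊗ x) (M.×1-homo-* k p) ⟩
      ((k · 1#) ⊗ (p · 1#)) ⊗ x ≡⟨ cong (λ z → ((k · 1#) ⊗ z) ⊗ x) char ⟩
      ((k · 1#) ⊗ 0#) ⊗ x ≡⟨ cong (_⊗ x) (R.zeroʳ (k · 1#)) ⟩
      0# ⊗ x ≡⟨ R.zeroˡ x ⟩
      0# ∎
      where open ≡-Reasoning

    -- Of the binomial expansion only the two end terms survive, since p divides every coefficient
    -- in between.
    frobenius : ∀ x y → (x ⊕ y) ↑ p ≡ x ↑ p ⊕ y ↑ p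
    frobenius = go p refl
      where
      open ≡-Reasoning
      go : ∀ m → m ≡ p → ∀ x y → (x ⊕ y) ↑ m ≡ x ↑ m ⊕ y ↑ m
      go zero    refl x y = contradiction pr ¬prime[0]
      go (suc n) refl x y = begin
        (x ⊕ y) ↑ suc n ≡⟨ ↑≡^ (x ⊕ y) (suc n) ⟩
        (x ⊕ y) E.^ suc n ≡⟨ B.theorem (suc n) x y ⟩
        t Fin.zero ⊕ S.sum (t ∘ Fin.suc) ≡⟨ cong (t Fin.zero ⊕_) (S.sum-init-last (t ∘ Fin.suc)) ⟩
        t Fin.zero ⊕ (S.sum mid ⊕ t (Fin.suc (fromℕ n)))
          ≡⟨ cong₂ (λ a b → a ⊕ (S.sum mid ⊕ b)) first last ⟩
        y ↑ suc n ⊕ (S.sum mid ⊕ x ↑ suc n)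
          ≡⟨ cong (λ z → y ↑ suc n ⊕ (z ⊕ x ↑ suc n)) (trans (S.sum-cong-≗ mid≡0) (S.sum-replicate-zero n)) ⟩
        y ↑ suc n ⊕ (0# ⊕ x ↑ suc n) ≡⟨ cong (y ↑ suc n ⊕_) (R.+-identityˡ _) ⟩
        y ↑ suc n ⊕ x ↑ suc n ≡⟨ R.+-comm _ _ ⟩
        x ↑ suc n ⊕ y ↑ suc n ∎
        where
        t = B.binomialTerm x y (suc n)
        mid : Fin n → Carrier
        mid i = t (Fin.suc (inject₁ i))
        first : t Fin.zero ≡ y ↑ suc n
        first = trans (M.×-homo-1 _) (trans (R.*-identityˡ _) (sym (↑≡^ y (suc n))))
        last : t (Fin.suc (fromℕ n)) ≡ x ↑ suc n
        last = begin
          (suc n C suc (toℕ (fromℕ n))) · (x E.^ suc (toℕ (fromℕ n)) ⊗ y E.^ (n ∸ toℕ (fromℕ n)))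
            ≡⟨ cong (λ k → (suc n C suc k) · (x E.^ suc k ⊗ y E.^ (n ∸ k))) (Fin.toℕ-fromℕ n) ⟩
          (suc n C suc n) · (x E.^ suc n ⊗ y E.^ (n ∸ n))
            ≡⟨ cong₂ (λ c k → c · (x E.^ suc n ⊗ y E.^ k)) (nCn≡1 (suc n)) (ℕ.n∸n≡0 n) ⟩
          1 · (x E.^ suc n ⊗ 1#) ≡⟨ M.×-homo-1 _ ⟩
          x E.^ suc n ⊗ 1# ≡⟨ R.*-identityʳ _ ⟩
          x E.^ suc n ≡⟨ ↑≡^ x (suc n) ⟨
          x ↑ suc n ∎
        mid≡0 : ∀ i → mid i ≡ 0#
        mid≡0 i = p∣n⇒n·x≡0 (p∣pCk pr (s≤s z≤n) (s≤s (subst (_< n) (sym (Fin.toℕ-inject₁ i)) (Fin.toℕ<n i)))) _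

    frobenius-^ : ∀ m x y → (x ⊕ y) ↑ (p ^ m) ≡ x ↑ (p ^ m) ⊕ y ↑ (p ^ m)
    frobenius-^ zero    x y = trans (R.*-identityʳ _) (sym (cong₂ _⊕_ (R.*-identityʳ x) (R.*-identityʳ y)))
    frobenius-^ (suc m) x y = begin
      (x ⊕ y) ↑ (p * p ^ m) ≡⟨ ↑-* (x ⊕ y) p (p ^ m) ⟩
      ((x ⊕ y) ↑ p) ↑ (p ^ m) ≡⟨ cong (_↑ (p ^ m)) (frobenius x y) ⟩
      (x ↑ p ⊕ y ↑ p) ↑ (p ^ m) ≡⟨ frobenius-^ m (x ↑ p) (y ↑ p) ⟩
      (x ↑ p) ↑ (p ^ m) ⊕ (y ↑ p) ↑ (p ^ m) ≡⟨ cong₂ _⊕_ (↑-* x p (p ^ m)) (↑-* y p (p ^ m)) ⟨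
      x ↑ (p * p ^ m) ⊕ y ↑ (p * p ^ m) ∎
      where open ≡-Reasoning

-- Elementary number theory

prime>1 : ∀ {p} → Prime p → 1 < p
prime>1 pr = nonTrivial⇒n>1 _ ⦃ prime⇒nonTrivial pr ⦄

primes-∣⇒≡ : ∀ {p r} → Prime p → Prime r → p ∣ r → p ≡ r
primes-∣⇒≡ pp pr p∣r with prime⇒irreducible pr p∣r
... | inj₁ refl = contradiction pp ¬prime[1]
... | inj₂ e    = e

prime∤product : ∀ {p D} → Prime p → All Prime D → All (p ≢_) D → ¬ p ∣ product D
prime∤product pp [] [] p∣1 = contradiction (∣⇒≤ p∣1) (ℕ.<⇒≱ (prime>1 pp))
prime∤product {p} {r ∷ D} pp (pr ∷ prs) (p≢r ∷ p∉) h with euclidsLemma r (product D) pp h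
... | inj₁ p∣r = p≢r (primes-∣⇒≡ pp pr p∣r)
... | inj₂ p∣D = prime∤product pp prs p∉ p∣D

prime∤⇒coprime : ∀ {p m} → Prime p → ¬ p ∣ m → Coprime p m
prime∤⇒coprime pp p∤m (d∣p , d∣m) with prime⇒irreducible pp d∣p
... | inj₁ d≡1  = d≡1
... | inj₂ refl = contradiction d∣m p∤m

-- On a duplicate-free list of primes this is Euler's function of the product; if the primes divide
-- N, it is the number of characters of order ∏ D.
Φ : List ℕ → ℕ
Φ []      = 1
Φ (p ∷ D) = (p ∸ 1) * Φ D

∃-prime-divisor : ∀ {n} → 1 < n → ∃ λ p → Prime p × p ∣ n
∃-prime-divisor {n} 1<n with factorise n ⦃ >-nonZero (ℕ.<-trans (s≤s z≤n) 1<n) ⦄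
... | record { factors = [] ; isFactorisation = e } = contradiction 1<n (ℕ.≤⇒≯ (ℕ.≤-reflexive e))
... | record { factors = p ∷ ps ; isFactorisation = e ; factorsPrime = pr ∷ _ } =
  p , pr , divides (product ps) (trans e (ℕ.*-comm p (product ps)))

∈-range1⁺ : ∀ {k n} → 0 < k → k ≤ n → k ∈ range1 n
∈-range1⁺ {suc k} _ k<n = ∈-map⁺ suc (∈-upTo⁺ k<n)

∈-range1⁻ : ∀ {k n} → k ∈ range1 n → 0 < k × k ≤ n
∈-range1⁻ m with ∈-map⁻ suc m
... | j , j∈ , refl = s≤s z≤n , ∈-upTo⁻ j∈

range1! : ∀ n → Unique (range1 n)
range1! n = Unique.map⁺ ℕ.suc-injective (Unique.upTo⁺ n)

length-range1 : ∀ n → length (range1 n) ≡ n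
length-range1 n = trans (length-map suc (upTo n)) (length-upTo n)

primeDivisors : ℕ → List ℕ
primeDivisors n = filter (λ p → prime? p ×-dec p ∣? n) (range1 n)

primeDivisors! : ∀ n → Unique (primeDivisors n)
primeDivisors! n = Unique.filter⁺ _ (range1! n)

∈-primeDivisors⁻ : ∀ {n p} → p ∈ primeDivisors n → Prime p × p ∣ n
∈-primeDivisors⁻ {n} m = proj₂ (∈-filter⁻ (λ p → prime? p ×-dec p ∣? n) {xs = range1 n} m)

∈-primeDivisors⁺ : ∀ {n p} → 0 < n → Prime p → p ∣ n → p ∈ primeDivisors n
∈-primeDivisors⁺ {n} {zero}  n>0 pr d = contradiction pr ¬prime[0]
∈-primeDivisors⁺ {n} {suc p} n>0 pr d = ∈-filter⁺ (λ p → prime? p ×-dec p ∣? n)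
  (∈-range1⁺ (s≤s z≤n) (∣⇒≤ ⦃ >-nonZero n>0 ⦄ d)) (pr , d)

Φ>0 : ∀ {D} → All Prime D → 0 < Φ D
Φ>0 []         = s≤s z≤n
Φ>0 (pr ∷ prs) = ℕ.*-mono-≤ (ℕ.∸-monoˡ-≤ 1 (prime>1 pr)) (Φ>0 prs)

abstract
  -- The witness is the geometric sum 1 + (r + 1) + ... + (r + 1)^(n - 1). For r = q - 1 it becomes
  -- the index of the multiplicative group of the subfield; `abstract` keeps it from unfolding.
  geometric : ∀ r n → ∃ λ m → suc (m * r) ≡ suc r ^ n
  geometric r zero    = 0 , refl
  geometric r (suc n) = let (m , e) = geometric r n in
    1 + suc r * m , trans (expand r m) (cong (suc r *_) e)
    where
    expand : ∀ r m → suc ((1 + suc r * m) * r) ≡ suc r * suc (m * r)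
    expand = solveℕ

length-cartesianProductWith : {A B C : Set} (f : A → B → C) (xs : List A) (ys : List B) →
  length (cartesianProductWith f xs ys) ≡ length xs * length ys
length-cartesianProductWith f []       ys = refl
length-cartesianProductWith f (x ∷ xs) ys = trans (length-++ (map (f x) ys))
  (cong₂ _+_ (length-map (f x) ys) (length-cartesianProductWith f xs ys))

∣∑∣≤ : {A : Set} {P : A → Set} (P? : Decidable P) (xs : List A) {f : A → ℤ} {c : ℕ} →
  (∀ x → ∣ f x ∣ ≤ c) → + ∣ ∑ xs (λ x → ⟦ P? x ⟧ *ᶻ f x) ∣ ≤ᶻ ∑ xs (⟦_⟧ ∘ P?) *ᶻ + c
∣∑∣≤ P? []       h = ℤ.+≤+ z≤n
∣∑∣≤ P? (x ∷ xs) {f} {c} h = begin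
  + ∣ ⟦ P? x ⟧ *ᶻ f x +ᶻ s ∣ ≤⟨ ℤ.+≤+ (ℤ.∣i+j∣≤∣i∣+∣j∣ (⟦ P? x ⟧ *ᶻ f x) s) ⟩
  + ∣ ⟦ P? x ⟧ *ᶻ f x ∣ +ᶻ + ∣ s ∣ ≤⟨ ℤ.+-mono-≤ first (∣∑∣≤ P? xs h) ⟩
  ⟦ P? x ⟧ *ᶻ + c +ᶻ ∑ xs (⟦_⟧ ∘ P?) *ᶻ + c ≡⟨ ℤ.*-distribʳ-+ (+ c) ⟦ P? x ⟧ _ ⟨
  (⟦ P? x ⟧ +ᶻ ∑ xs (⟦_⟧ ∘ P?)) *ᶻ + c ∎
  where
  open ℤ.≤-Reasoning
  s = ∑ xs (λ x → ⟦ P? x ⟧ *ᶻ f x)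
  first : + ∣ ⟦ P? x ⟧ *ᶻ f x ∣ ≤ᶻ ⟦ P? x ⟧ *ᶻ + c
  first with P? x
  ... | yes _ = subst₂ _≤ᶻ_ (cong (+_ ∘ ∣_∣) (sym (ℤ.*-identityˡ (f x)))) (sym (ℤ.*-identityˡ (+ c))) (ℤ.+≤+ (h x))
  ... | no _  = subst₂ _≤ᶻ_ (cong (+_ ∘ ∣_∣) (sym (ℤ.*-zeroˡ (f x)))) (sym (ℤ.*-zeroˡ (+ c))) ℤ.≤-refl

-- Finite fields

module _ {A : Set} {_∙_ : A → A → A} {ε : A} (isCM : IsCommutativeMonoid _≡_ _∙_ ε) where
  private
    M : CommutativeMonoid _ _
    M = record { isCommutativeMonoid = isCM }
    module M = CommutativeMonoid M

  foldr-translate : ∀ c xs → foldr _∙_ ε (map (c ∙_) xs) ≡ mult M.rawMonoid (length xs) c ∙ foldr _∙_ ε xs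
  foldr-translate c []       = sym (M.identityˡ ε)
  foldr-translate c (x ∷ xs) = begin
    (c ∙ x) ∙ foldr _∙_ ε (map (c ∙_) xs) ≡⟨ cong ((c ∙ x) ∙_) (foldr-translate c xs) ⟩
    (c ∙ x) ∙ (k ∙ f) ≡⟨ M.assoc c x _ ⟩
    c ∙ (x ∙ (k ∙ f)) ≡⟨ cong (c ∙_) (M.assoc x k f) ⟨
    c ∙ ((x ∙ k) ∙ f) ≡⟨ cong (λ z → c ∙ (z ∙ f)) (M.comm x k) ⟩
    c ∙ ((k ∙ x) ∙ f) ≡⟨ cong (c ∙_) (M.assoc k x f) ⟩
    c ∙ (k ∙ (x ∙ f)) ≡⟨ M.assoc c k _ ⟨
    (c ∙ k) ∙ (x ∙ f) ∎
    where
    open ≡-Reasoning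
    f = foldr _∙_ ε xs
    k = mult M.rawMonoid (length xs) c

  -- One permutation argument for both operations: with addition and c = 1 it makes |F| · 1 vanish,
  -- with multiplication on the nonzero elements it gives c^N = 1.
  foldr-translate-↭ : ∀ c xs → map (c ∙_) xs ↭ xs →
    mult M.rawMonoid (length xs) c ∙ foldr _∙_ ε xs ≡ foldr _∙_ ε xs
  foldr-translate-↭ c xs p = trans (sym (foldr-translate c xs))
    (Permutation.foldr-commMonoid (setoid A) isCM (↭⇒↭ₛ p))

0≤i*i : ∀ i → 0ℤ ≤ᶻ i *ᶻ i
0≤i*i (+ n)         = subst (0ℤ ≤ᶻ_) (ℤ.pos-* n n) (ℤ.+≤+ z≤n)
0≤i*i (ℤ.-[1+ n ]) = ℤ.+≤+ z≤n

∑-nonneg : {A : Set} (xs : List A) {f : A → ℤ} → (∀ x → 0ℤ ≤ᶻ f x) → 0ℤ ≤ᶻ ∑ xs f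
∑-nonneg xs {f} h = subst (_≤ᶻ ∑ xs f) (∑-zero xs) (∑-mono xs h)

module FiniteField (F : Field) (els : List (Field.Carrier F)) (els! : Unique els)
  (complete : ∀ x → x ∈ els) where
  open FieldProperties F public

  infix 4 _≟_
  -- The carrier comes without a decision procedure; elements are compared through the positions
  -- that `complete` assigns to them in the enumeration.
  _≟_ : DecidableEquality Carrier
  x ≟ y with Any.index (complete x) Fin.≟ Any.index (complete y)
  ... | yes e = yes (trans (Any.lookup-index (complete x))
    (trans (cong (lookup els) e) (sym (Any.lookup-index (complete y)))))
  ... | no ¬e = no λ { refl → ¬e refl }

  ∑F : (Carrier → ℤ) → ℤ
  ∑F = ∑ els

  image-↭ : {σ : Carrier → Carrier} → (∀ {x y} → σ x ≡ σ y → x ≡ y) → (∀ x → ∃ λ y → σ y ≡ x) → map σ els ↭ els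
  image-↭ {σ} inj surj = unique-set⇒↭ (Unique.map⁺ inj els!) els! (λ _ → complete _)
    (λ {x} _ → subst (_∈ map σ els) (proj₂ (surj x)) (∈-map⁺ σ (complete _)))

  ∑F-bijection : {σ : Carrier → Carrier} → (∀ {x y} → σ x ≡ σ y → x ≡ y) → (∀ x → ∃ λ y → σ y ≡ x) →
    (f : Carrier → ℤ) → ∑F (f ∘ σ) ≡ ∑F f
  ∑F-bijection {σ} inj surj f = trans (sym (∑-map σ els f)) (∑-↭ f (image-↭ inj surj))

  ∑F-shift : ∀ c (f : Carrier → ℤ) → ∑F (λ x → f (x ⊕ c)) ≡ ∑F f
  ∑F-shift c = ∑F-bijection (⊕-cancelʳ c) (λ x → x ⊕ ⊖ c , ⊖-⊕-cancel x c)

  scale-surjective : ∀ {c} → c ≢ 0# → ∀ x → ∃ λ y → c ⊗ y ≡ x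
  scale-surjective {c} c≢0 x = let (d , e) = inverse c c≢0 in
    d ⊗ x , trans (sym (R.*-assoc c d x)) (trans (cong (_⊗ x) e) (R.*-identityˡ x))

  ∑F-scale : ∀ {c} → c ≢ 0# → (f : Carrier → ℤ) → ∑F (λ x → f (c ⊗ x)) ≡ ∑F f
  ∑F-scale c≢0 = ∑F-bijection (⊗-cancelˡ c≢0) (scale-surjective c≢0)

  ∑F-δ : ∀ a (f : Carrier → ℤ) → ∑F (λ x → ⟦ a ≟ x ⟧ *ᶻ f x) ≡ f a
  ∑F-δ a = ∑-δ _≟_ els! (complete a)

  length·1≡0 : length els · 1# ≡ 0#
  length·1≡0 = ⊕-cancelʳ (foldr _⊕_ 0# els) (trans
    (foldr-translate-↭ R.+-isCommutativeMonoid 1# els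
      (image-↭ (λ {x} {y} e → ⊕-cancelʳ 1# (trans (R.+-comm x 1#) (trans e (R.+-comm 1# y))))
        (λ x → x ⊕ ⊖ 1# , trans (R.+-comm 1# _) (⊖-⊕-cancel x 1#))))
    (sym (R.+-identityˡ _)))

  -- Since p^m · 1 = |F| · 1 vanishes and is a product of m factors p · 1, these factors cannot be
  -- nonzero.
  characteristic : ∀ {p m} → length els ≡ p ^ m → p · 1# ≡ 0#
  characteristic {p} {m} e = decidable-stable (p · 1# ≟ 0#)
    (λ h → ·1-nonzero p m h (subst (λ k → k · 1# ≡ 0#) e length·1≡0))

  els* : List Carrier
  els* = filter (λ x → ¬? (x ≟ 0#)) els

  N : ℕ
  N = length els*

  els*! : Unique els*
  els*! = Unique.filter⁺ _ els!

  ∈els*⇒≢0 : ∀ {x} → x ∈ els* → x ≢ 0#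
  ∈els*⇒≢0 m = proj₂ (∈-filter⁻ (λ x → ¬? (x ≟ 0#)) {xs = els} m)

  ≢0⇒∈els* : ∀ {x} → x ≢ 0# → x ∈ els*
  ≢0⇒∈els* = ∈-filter⁺ (λ x → ¬? (x ≟ 0#)) (complete _)

  length≡1+N : length els ≡ suc N
  length≡1+N = ℤ.+-injective (begin
    + length els ≡⟨ ℤ.*-identityʳ _ ⟨
    + length els *ᶻ 1ℤ ≡⟨ ∑-const els 1ℤ ⟨
    ∑F (λ _ → 1ℤ) ≡⟨ ∑-cong els partition-unity ⟩
    ∑F (λ x → ⟦ 0# ≟ x ⟧ *ᶻ 1ℤ +ᶻ ⟦ ¬? (x ≟ 0#) ⟧) ≡⟨ ∑-+ els _ _ ⟩
    ∑F (λ x → ⟦ 0# ≟ x ⟧ *ᶻ 1ℤ) +ᶻ ∑F (λ x → ⟦ ¬? (x ≟ 0#) ⟧)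
      ≡⟨ cong₂ _+ᶻ_ (∑F-δ 0# (λ _ → 1ℤ)) (∑-⟦⟧ (λ x → ¬? (x ≟ 0#)) els) ⟩
    1ℤ +ᶻ + N ∎)
    where
    open ≡-Reasoning
    partition-unity : ∀ x → 1ℤ ≡ ⟦ 0# ≟ x ⟧ *ᶻ 1ℤ +ᶻ ⟦ ¬? (x ≟ 0#) ⟧
    partition-unity x with x ≟ 0#
    ... | yes e = sym (trans (ℤ.+-identityʳ _) (trans (ℤ.*-identityʳ _) (⟦⟧-yes (0# ≟ x) (sym e))))
    ... | no ¬e = sym (cong (λ z → z *ᶻ 1ℤ +ᶻ 1ℤ) (⟦⟧-no (0# ≟ x) (¬e ∘ sym)))

  lagrange : ∀ {c} → c ≢ 0# → c ↑ N ≡ 1#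
  lagrange {c} c≢0 = ⊗-cancelˡ (∏≢0 els* ∈els*⇒≢0) (begin
    ∏ ⊗ c ↑ N ≡⟨ R.*-comm _ _ ⟩
    c ↑ N ⊗ ∏ ≡⟨ cong (_⊗ ∏) (↑≡^ c N) ⟩
    mult R.*-rawMonoid N c ⊗ ∏ ≡⟨ foldr-translate-↭ R.*-isCommutativeMonoid c els* perm ⟩
    ∏ ≡⟨ R.*-identityʳ ∏ ⟨
    ∏ ⊗ 1# ∎)
    where
    open ≡-Reasoning
    ∏ = foldr _⊗_ 1# els*
    ∏≢0 : ∀ xs → (∀ {x} → x ∈ xs → x ≢ 0#) → foldr _⊗_ 1# xs ≢ 0#
    ∏≢0 []       _ = ≢-sym 0≢1
    ∏≢0 (x ∷ xs) h = ⊗-nonzero (h (here refl)) (∏≢0 xs (h ∘ there))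
    perm : map (c ⊗_) els* ↭ els*
    perm = unique-set⇒↭ (Unique.map⁺ (⊗-cancelˡ c≢0) els*!) els*!
      (λ m → let (y , y∈ , e) = ∈-map⁻ (c ⊗_) m in
        ≢0⇒∈els* (λ x≡0 → ⊗-nonzero c≢0 (∈els*⇒≢0 y∈) (trans (sym e) x≡0)))
      (λ {x} x∈ → let (y , e) = scale-surjective c≢0 x in
        subst (_∈ map (c ⊗_) els*) e (∈-map⁺ (c ⊗_) (≢0⇒∈els*
          (λ y≡0 → ∈els*⇒≢0 x∈ (trans (sym e) (trans (cong (c ⊗_) y≡0) (R.zeroʳ c)))))))

  N>0 : 0 < N
  N>0 = ∈-length (≢0⇒∈els* {1#} (≢-sym 0≢1))

  -- X^m - 1 has at most m roots.
  non-root-of-unity : ∀ {m} → 0 < m → m < N → ∃ λ y → y ≢ 0# × y ↑ m ≢ 1#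
  non-root-of-unity {m} m>0 m<N with Any.any? (λ y → ¬? (y ↑ m ≟ 1#)) els*
  ... | yes h = let (y , y∈ , ne) = find h in y , ∈els*⇒≢0 y∈ , ne
  ... | no h = contradiction (roots-of-unity m>0 els*!
    (All.tabulate λ {y} y∈ → decidable-stable (y ↑ m ≟ 1#) (λ ne → h (lose y∈ ne))))
    (ℕ.<⇒≱ m<N)

  -- Character kernels

  ↑-+-root : ∀ ω d y b → ω ↑ b ≡ 1# → ω ↑ (d + y * b) ≡ ω ↑ d
  ↑-+-root ω d y b e = trans (↑-+ ω d (y * b))
    (trans (cong (ω ↑ d ⊗_) (↑-root {ω} {b} e (divides y refl))) (R.*-identityʳ (ω ↑ d)))

  ↑-gcd : ∀ ω a b → ω ↑ a ≡ 1# → ω ↑ b ≡ 1# → ω ↑ gcd a b ≡ 1#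
  ↑-gcd ω a b ea eb with Bézout.identity (gcd-GCD a b)
  ... | Bézout.+- x y e = trans (sym (↑-+-root ω (gcd a b) y b eb))
    (trans (cong (ω ↑_) e) (↑-+-root ω 0 x a ea))
  ... | Bézout.-+ x y e = trans (sym (↑-+-root ω (gcd a b) x a ea))
    (trans (cong (ω ↑_) e) (↑-+-root ω 0 y b eb))

  coprime-orders : ∀ {ω a b} → Coprime a b → ω ↑ a ≡ 1# → ω ↑ b ≡ 1# → ω ≡ 1#
  coprime-orders {ω} {a} {b} c ea eb = trans (sym (R.*-identityʳ ω))
    (subst (λ k → ω ↑ k ≡ 1#) (coprime⇒gcd≡1 c) (↑-gcd ω a b ea eb))

  PrimeFactor : ℕ → Set
  PrimeFactor p = Prime p × p ∣ N

  -- The clause for 0 makes the function total, so that `t` and `T` need no nonzero instances.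
  cofactor : ℕ → ℕ
  cofactor zero      = 0
  cofactor p@(suc _) = N / p

  cofactor-* : ∀ {p} → PrimeFactor p → cofactor p * p ≡ N
  cofactor-* {zero}  (pr , _) = contradiction pr ¬prime[0]
  cofactor-* {suc p} (_ , d)  = m/n*n≡m d

  cofactor>0 : ∀ {p} → PrimeFactor p → 0 < cofactor p
  cofactor>0 {p} pf with cofactor p | cofactor-* pf
  ... | zero  | e = contradiction (subst (0 <_) (sym e) N>0) (ℕ.<-irrefl refl)
  ... | suc _ | _ = s≤s z≤n

  cofactor<N : ∀ {p} → PrimeFactor p → cofactor p < N
  cofactor<N {p} pf = subst (cofactor p <_) (cofactor-* pf)
    (ℕ.m<m*n (cofactor p) p ⦃ >-nonZero (cofactor>0 pf) ⦄ (prime>1 (proj₁ pf)))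

  cofactor-root : ∀ {p x} → PrimeFactor p → x ≢ 0# → (x ↑ cofactor p) ↑ p ≡ 1#
  cofactor-root {p} {x} pf x≢0 = trans (sym (↑-* x (cofactor p) p)) (trans (cong (x ↑_) (cofactor-* pf)) (lagrange x≢0))

  -- For x ≠ 0 and p a prime factor of N, x^(N/p) is a p-th root of unity, equal to 1 exactly when x
  -- is a p-th power. So this is the sum of the p - 1 characters of order p: p - 1 at p-th powers,
  -- -1 elsewhere.
  t : ℕ → Carrier → ℤ
  t p x = + p *ᶻ ⟦ x ↑ cofactor p ≟ 1# ⟧ -ᶻ 1ℤ

  -- On nonzero elements T D is the sum of the multiplicative characters whose
  -- order is the product of the list of primes D.
  T : List ℕ → Carrier → ℤ
  T []      x = ⟦ ¬? (x ≟ 0#) ⟧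
  T (p ∷ D) x = t p x *ᶻ T D x

  T-0 : ∀ D → T D 0# ≡ 0ℤ
  T-0 []      = ⟦⟧-no (¬? (0# ≟ 0#)) (λ h → h refl)
  T-0 (p ∷ D) = trans (cong (t p 0# *ᶻ_) (T-0 D)) (ℤ.*-zeroʳ (t p 0#))

  p·1-1 : ∀ {p} → Prime p → + p *ᶻ 1ℤ -ᶻ 1ℤ ≡ + (p ∸ 1)
  p·1-1 {zero}  pr = contradiction pr ¬prime[0]
  p·1-1 {suc p} _  = trans (cong (_-ᶻ 1ℤ) (ℤ.*-identityʳ (+ suc p))) refl

  T-1 : ∀ {D} → All PrimeFactor D → T D 1# ≡ + Φ D
  T-1 []                   = ⟦⟧-yes (¬? (1# ≟ 0#)) (≢-sym 0≢1)
  T-1 {p ∷ D} (pf ∷ pfs) = trans (cong₂ _*ᶻ_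
      (trans (cong (λ z → + p *ᶻ z -ᶻ 1ℤ) (⟦⟧-yes (1# ↑ cofactor p ≟ 1#) (1↑ (cofactor p)))) (p·1-1 (proj₁ pf)))
      (T-1 pfs)) (sym (ℤ.pos-* (p ∸ 1) (Φ D)))

  ∣t∣≤ : ∀ {p} → Prime p → ∀ x → ∣ t p x ∣ ≤ p ∸ 1
  ∣t∣≤ {p} pr x with x ↑ cofactor p ≟ 1#
  ... | yes _ = ℕ.≤-reflexive (cong ∣_∣ (p·1-1 pr))
  ... | no _  = subst (_≤ p ∸ 1) (sym (cong (λ z → ∣ z -ᶻ 1ℤ ∣) (ℤ.*-zeroʳ (+ p)))) (ℕ.∸-monoˡ-≤ 1 (prime>1 pr))

  ∣T∣≤ : ∀ {D} → All PrimeFactor D → ∀ x → ∣ T D x ∣ ≤ Φ D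
  ∣T∣≤ [] x with x ≟ 0#
  ... | yes _ = z≤n
  ... | no _  = s≤s z≤n
  ∣T∣≤ {p ∷ D} (pf ∷ pfs) x = subst (_≤ Φ (p ∷ D)) (sym (ℤ.abs-* (t p x) (T D x)))
    (ℕ.*-mono-≤ (∣t∣≤ (proj₁ pf) x) (∣T∣≤ pfs x))

  -- Take y with ω = y^(N/p) ≠ 1 and put h = y^(∏ D). For r in D the exponent ∏ D · N/r is a
  -- multiple of N, so h^(N/r) = 1. As ω has order p and p does not divide ∏ D, h^(N/p) = ω^(∏ D)
  -- stays different from 1. Multiplication by h thus affects `t p` alone.
  separator : ∀ {p D} → PrimeFactor p → All PrimeFactor D → All (p ≢_) D →
    ∃ λ h → h ≢ 0# × h ↑ cofactor p ≢ 1# × All (λ r → h ↑ cofactor r ≡ 1#) D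
  separator {p} {D} pf pfs p∉ with non-root-of-unity (cofactor>0 pf) (cofactor<N pf)
  ... | y , y≢0 , ω≢1 = y ↑ product D , ↑-nonzero (product D) y≢0 ,
    (λ e → ω≢1 (coprime-orders (prime∤⇒coprime (proj₁ pf) (prime∤product (proj₁ pf) (All.map proj₁ pfs) p∉))
      (cofactor-root pf y≢0) (trans (sym (↑-* y (cofactor p) (product D))) (trans (↑-*′ y (cofactor p) (product D)) e)))) ,
    All.tabulate (λ {r} r∈ → trans (sym (↑-* y (product D) (cofactor r)))
      (↑-root (lagrange y≢0) (subst (_∣ product D * cofactor r)
        (trans (ℕ.*-comm r (cofactor r)) (cofactor-* (All.lookup pfs r∈)))
        (∣.*-monoˡ-∣ (cofactor r) (∈⇒∣product r∈)))))

  module _ {p} (pr : Prime p) {ω} (ω^p : ω ↑ p ≡ 1#) (ω≢1 : ω ≢ 1#) where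

    ω≢0 : ω ≢ 0#
    ω≢0 e = 0≢1 (trans (sym (0↑ p (ℕ.<-trans (s≤s z≤n) (prime>1 pr)))) (trans (cong (_↑ p) (sym e)) ω^p))

    ω-powers-≢ : ∀ {i j} → i < j → j < p → ω ↑ i ≢ ω ↑ j
    ω-powers-≢ {i} {j} i<j j<p e = ω≢1 (coprime-orders
      (prime⇒coprime pr ⦃ >-nonZero (ℕ.m<n⇒0<n∸m i<j) ⦄ (ℕ.≤-<-trans (ℕ.m∸n≤m j i) j<p)) ω^p
      (sym (⊗-cancelˡ (↑-nonzero i ω≢0) (trans (R.*-identityʳ _) (trans e
        (trans (cong (ω ↑_) (sym (ℕ.m+[n∸m]≡n (ℕ.<⇒≤ i<j)))) (↑-+ ω i (j ∸ i))))))))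

    orbit : Carrier → List Carrier
    orbit γ = map (λ j → ω ↑ j ⊗ γ) (upTo p)

    module _ {γ} (γ^p : γ ↑ p ≡ 1#) where

      orbit! : Unique (orbit γ)
      orbit! = subst Unique (sym (map-upTo _ p)) (Unique.applyUpTo⁺₁ _ p
        (λ i<j j<p e → ω-powers-≢ i<j j<p (⊗-cancelˡ γ≢0
          (trans (R.*-comm _ _) (trans e (R.*-comm _ _))))))
        where
        γ≢0 : γ ≢ 0#
        γ≢0 e = 0≢1 (trans (sym (0↑ p (ℕ.<-trans (s≤s z≤n) (prime>1 pr)))) (trans (cong (_↑ p) (sym e)) γ^p))

      -- The orbit consists of p distinct p-th roots of unity, and there are no more than p of them;
      -- so it contains every one.
      1∈orbit : 1# ∈ orbit γ
      1∈orbit = unique-full _≟_ orbit! orbit⊆roots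
        (ℕ.≤-trans (roots-of-unity 0<p (Unique.filter⁺ root? els!) (All.tabulate (λ m → proj₂ (∈-filter⁻ root? {xs = els} m))))
          (ℕ.≤-reflexive (sym (trans (length-map _ (upTo p)) (length-upTo p)))))
        (∈-filter⁺ root? (complete 1#) (1↑ p))
        where
        0<p = ℕ.<-trans (s≤s z≤n) (prime>1 pr)
        root? = λ x → x ↑ p ≟ 1#
        orbit⊆roots : ∀ {x} → x ∈ orbit γ → x ∈ filter root? els
        orbit⊆roots m with ∈-map⁻ _ m
        ... | j , _ , refl = ∈-filter⁺ root? (complete _) (trans (⊗-↑ (ω ↑ j) γ p)
          (trans (cong₂ _⊗_ (trans (sym (↑-* ω j p)) (↑-root ω^p (divides j refl))) γ^p) (R.*-identityˡ 1#)))

      ∑-orbit : (f : Carrier → ℤ) → ∑ (upTo p) (λ j → ⟦ ω ↑ j ⊗ γ ≟ 1# ⟧ *ᶻ f (ω ↑ j ⊗ γ)) ≡ f 1#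
      ∑-orbit f = begin
        ∑ (upTo p) (λ j → ⟦ ω ↑ j ⊗ γ ≟ 1# ⟧ *ᶻ f (ω ↑ j ⊗ γ)) ≡⟨ ∑-map _ (upTo p) (λ x → ⟦ x ≟ 1# ⟧ *ᶻ f x) ⟨
        ∑ (orbit γ) (λ x → ⟦ x ≟ 1# ⟧ *ᶻ f x) ≡⟨ ∑-cong (orbit γ) (λ x → cong (_*ᶻ f x) (⟦⟧-⇔ (x ≟ 1#) (1# ≟ x) sym sym)) ⟩
        ∑ (orbit γ) (λ x → ⟦ 1# ≟ x ⟧ *ᶻ f x) ≡⟨ ∑-δ _≟_ orbit! 1∈orbit f ⟩
        f 1# ∎
        where open ≡-Reasoning

      ∑-orbit-1 : ∑ (upTo p) (λ j → ⟦ ω ↑ j ⊗ γ ≟ 1# ⟧) ≡ 1ℤ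
      ∑-orbit-1 = trans (∑-cong (upTo p) (λ j → sym (ℤ.*-identityʳ _))) (∑-orbit (λ _ → 1ℤ))

  -- The substitution z ↦ h^j z preserves sums over F. Summing it over j < p leaves `B` untouched
  -- and replaces `f` by its constant orbit sum; then p is cancelled. At z = 0, where no orbit sum
  -- is assumed, the vanishing of `B` takes over.
  average : ∀ {p} → 0 < p → ∀ {h} → h ≢ 0# → (f B : Carrier → ℤ) (c : ℤ) →
    (∀ z → B (h ⊗ z) ≡ B z) → B 0# ≡ 0ℤ →
    (∀ z → z ≢ 0# → ∑ (upTo p) (λ j → f (h ↑ j ⊗ z)) ≡ + p *ᶻ c) →
    ∑F (λ z → f z *ᶻ B z) ≡ c *ᶻ ∑F B
  average {p} p>0 {h} h≢0 f B c invariant B0 local =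
    ℤ.*-cancelˡ-≡ (+ p) _ _ ⦃ >-nonZero p>0 ⦄ (begin
    + p *ᶻ ∑F (λ z → f z *ᶻ B z) ≡⟨ cong (λ k → + k *ᶻ _) (length-upTo p) ⟨
    + length (upTo p) *ᶻ ∑F (λ z → f z *ᶻ B z) ≡⟨ ∑-const (upTo p) _ ⟨
    ∑ (upTo p) (λ j → ∑F (λ z → f z *ᶻ B z))
      ≡⟨ ∑-cong (upTo p) (λ j → sym (∑F-scale (↑-nonzero j h≢0) (λ z → f z *ᶻ B z))) ⟩
    ∑ (upTo p) (λ j → ∑F (λ z → f (h ↑ j ⊗ z) *ᶻ B (h ↑ j ⊗ z)))
      ≡⟨ ∑-cong (upTo p) (λ j → ∑-cong els (λ z → cong (f (h ↑ j ⊗ z) *ᶻ_) (invariant^ j z))) ⟩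
    ∑ (upTo p) (λ j → ∑F (λ z → f (h ↑ j ⊗ z) *ᶻ B z)) ≡⟨ ∑-swap (upTo p) els _ ⟩
    ∑F (λ z → ∑ (upTo p) (λ j → f (h ↑ j ⊗ z) *ᶻ B z)) ≡⟨ ∑-cong els (λ z → ∑-*ʳ (upTo p) (B z) _) ⟩
    ∑F (λ z → ∑ (upTo p) (λ j → f (h ↑ j ⊗ z)) *ᶻ B z) ≡⟨ ∑-cong els pointwise ⟩
    ∑F (λ z → (+ p *ᶻ c) *ᶻ B z) ≡⟨ ∑-*ˡ els (+ p *ᶻ c) B ⟩
    (+ p *ᶻ c) *ᶻ ∑F B ≡⟨ ℤ.*-assoc (+ p) c _ ⟩
    + p *ᶻ (c *ᶻ ∑F B) ∎)
    where
    open ≡-Reasoning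
    invariant^ : ∀ j z → B (h ↑ j ⊗ z) ≡ B z
    invariant^ zero    z = cong B (R.*-identityˡ z)
    invariant^ (suc j) z = trans (cong B (R.*-assoc h (h ↑ j) z)) (trans (invariant _) (invariant^ j z))
    pointwise : ∀ z → ∑ (upTo p) (λ j → f (h ↑ j ⊗ z)) *ᶻ B z ≡ (+ p *ᶻ c) *ᶻ B z
    pointwise z with z ≟ 0#
    ... | no z≢0  = cong (_*ᶻ B z) (local z z≢0)
    ... | yes refl = trans (cong (s *ᶻ_) B0) (trans (ℤ.*-zeroʳ s)
      (sym (trans (cong (+ p *ᶻ c *ᶻ_) B0) (ℤ.*-zeroʳ (+ p *ᶻ c)))))
      where s = ∑ (upTo p) (λ j → f (h ↑ j ⊗ 0#))

  T-invariant : ∀ {h D} → h ≢ 0# → All (λ r → h ↑ cofactor r ≡ 1#) D → ∀ z → T D (h ⊗ z) ≡ T D z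
  T-invariant h≢0 [] z = ⟦⟧-⇔ (¬? (_ ≟ 0#)) (¬? (z ≟ 0#))
    (λ hz≢0 z≡0 → hz≢0 (trans (cong (_ ⊗_) z≡0) (R.zeroʳ _))) (⊗-nonzero h≢0)
  T-invariant {h} {r ∷ D} h≢0 (e ∷ es) z = cong₂ _*ᶻ_
    (cong (λ w → + r *ᶻ ⟦ w ≟ 1# ⟧ -ᶻ 1ℤ)
      (trans (⊗-↑ h z (cofactor r)) (trans (cong (_⊗ z ↑ cofactor r) e) (R.*-identityˡ _))))
    (T-invariant h≢0 es z)

  orbit-power : ∀ h j z k → (h ↑ j ⊗ z) ↑ k ≡ (h ↑ k) ↑ j ⊗ z ↑ k
  orbit-power h j z k = trans (⊗-↑ (h ↑ j) z k)
    (cong (_⊗ z ↑ k) (trans (sym (↑-* h j k)) (↑-*′ h j k)))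

  -- The separator of p fixes `T D`, while `t p` runs through a full orbit with exactly one value p
  -- - 1, so its orbit sum is p - p = 0.
  ∑T≡0 : ∀ {p D} → All PrimeFactor (p ∷ D) → Unique (p ∷ D) → ∑F (T (p ∷ D)) ≡ 0ℤ
  ∑T≡0 {p} {D} (pf@(pr , _) ∷ pfs) (p∉ ∷ _) with separator pf pfs p∉
  ... | h , h≢0 , ω≢1 , hs = average p>0 h≢0 (t p) (T D) 0ℤ (T-invariant h≢0 hs) (T-0 D) local
    where
    open ≡-Reasoning
    p>0 = ℕ.<-trans (s≤s z≤n) (prime>1 pr)
    ω = h ↑ cofactor p
    local : ∀ z → z ≢ 0# → ∑ (upTo p) (λ j → t p (h ↑ j ⊗ z)) ≡ + p *ᶻ 0ℤ
    local z z≢0 = begin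
      ∑ (upTo p) (λ j → t p (h ↑ j ⊗ z))
        ≡⟨ ∑-cong (upTo p) (λ j → cong (λ w → + p *ᶻ ⟦ w ≟ 1# ⟧ -ᶻ 1ℤ) (orbit-power h j z (cofactor p))) ⟩
      ∑ (upTo p) (λ j → + p *ᶻ ⟦ ω ↑ j ⊗ β ≟ 1# ⟧ -ᶻ 1ℤ) ≡⟨ ∑-minus (upTo p) _ _ ⟩
      ∑ (upTo p) (λ j → + p *ᶻ ⟦ ω ↑ j ⊗ β ≟ 1# ⟧) -ᶻ ∑ (upTo p) (λ _ → 1ℤ)
        ≡⟨ cong₂ _-ᶻ_ (∑-*ˡ (upTo p) (+ p) _) (trans (∑-const (upTo p) 1ℤ) (cong (λ k → + k *ᶻ 1ℤ) (length-upTo p))) ⟩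
      + p *ᶻ ∑ (upTo p) (λ j → ⟦ ω ↑ j ⊗ β ≟ 1# ⟧) -ᶻ + p *ᶻ 1ℤ
        ≡⟨ cong (λ s → + p *ᶻ s -ᶻ + p *ᶻ 1ℤ) (∑-orbit-1 pr (cofactor-root pf h≢0) ω≢1 (cofactor-root pf z≢0)) ⟩
      + p *ᶻ 1ℤ -ᶻ + p *ᶻ 1ℤ ≡⟨ ℤ.+-inverseʳ (+ p *ᶻ 1ℤ) ⟩
      0ℤ ≡⟨ ℤ.*-zeroʳ (+ p) ⟨
      + p *ᶻ 0ℤ ∎
      where β = z ↑ cofactor p

  -- One prime is removed at a time by `average`. On an orbit of the separator the product of the
  -- two `t p` factors is (p a - 1)(p b - 1), where each of the brackets a and b equals 1 exactly
  -- once. They do so at the same j precisely when x^(N/p) = 1, so the orbit sum is p · `t p x`.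
  T-convolution : ∀ {D} → All PrimeFactor D → Unique D → ∀ x →
    ∑F (λ z → T D (x ⊗ z) *ᶻ T D z) ≡ + N *ᶻ T D x
  T-convolution {D} pfs D! x with x ≟ 0#
  T-convolution {D} pfs D! x | yes refl = trans
    (∑-cong els (λ z → trans (cong (_*ᶻ T D z) (trans (cong (T D) (R.zeroˡ z)) (T-0 D))) (ℤ.*-zeroˡ (T D z))))
    (trans (∑-zero els) (sym (trans (cong (+ N *ᶻ_) (T-0 D)) (ℤ.*-zeroʳ (+ N)))))
  T-convolution {[]} pfs D! x | no x≢0 = begin
    ∑F (λ z → T [] (x ⊗ z) *ᶻ T [] z)
      ≡⟨ ∑-cong els (λ z → trans (cong (_*ᶻ T [] z) (T-invariant x≢0 [] z)) (⟦⟧-idem (¬? (z ≟ 0#)))) ⟩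
    ∑F (T []) ≡⟨ ∑-⟦⟧ (λ x → ¬? (x ≟ 0#)) els ⟩
    + N ≡⟨ ℤ.*-identityʳ (+ N) ⟨
    + N *ᶻ 1ℤ ≡⟨ cong (+ N *ᶻ_) (⟦⟧-yes (¬? (x ≟ 0#)) x≢0) ⟨
    + N *ᶻ T [] x ∎
    where open ≡-Reasoning
  T-convolution {p ∷ D} (pf@(pr , _) ∷ pfs) (p∉ ∷ D!) x | no x≢0 with separator pf pfs p∉
  ... | h , h≢0 , ω≢1 , hs = begin
    ∑F (λ z → T (p ∷ D) (x ⊗ z) *ᶻ T (p ∷ D) z) ≡⟨ ∑-cong els (λ z → *ᶻ.interchange (t p (x ⊗ z)) (T D (x ⊗ z)) (t p z) (T D z)) ⟩
    ∑F (λ z → (t p (x ⊗ z) *ᶻ t p z) *ᶻ (T D (x ⊗ z) *ᶻ T D z))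
      ≡⟨ average p>0 h≢0 (λ z → t p (x ⊗ z) *ᶻ t p z) (λ z → T D (x ⊗ z) *ᶻ T D z) (t p x)
           (λ z → cong₂ _*ᶻ_ (trans (cong (T D) (⊗-left-comm x h z)) (T-invariant h≢0 hs (x ⊗ z))) (T-invariant h≢0 hs z))
           (trans (cong (T D (x ⊗ 0#) *ᶻ_) (T-0 D)) (ℤ.*-zeroʳ (T D (x ⊗ 0#)))) local ⟩
    t p x *ᶻ ∑F (λ z → T D (x ⊗ z) *ᶻ T D z) ≡⟨ cong (t p x *ᶻ_) (T-convolution pfs D! x) ⟩
    t p x *ᶻ (+ N *ᶻ T D x) ≡⟨ *ᶻ.x∙yz≈y∙xz (t p x) (+ N) (T D x) ⟩
    + N *ᶻ (t p x *ᶻ T D x) ∎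
    where
    open ≡-Reasoning
    p>0 = ℕ.<-trans (s≤s z≤n) (prime>1 pr)
    ω = h ↑ cofactor p
    α = x ↑ cofactor p
    ⊗-left-comm : ∀ a b c → a ⊗ (b ⊗ c) ≡ b ⊗ (a ⊗ c)
    ⊗-left-comm a b c = trans (sym (R.*-assoc a b c)) (trans (cong (_⊗ c) (R.*-comm a b)) (R.*-assoc b a c))
    local : ∀ z → z ≢ 0# → ∑ (upTo p) (λ j → t p (x ⊗ (h ↑ j ⊗ z)) *ᶻ t p (h ↑ j ⊗ z)) ≡ + p *ᶻ t p x
    local z z≢0 = begin
      ∑ (upTo p) (λ j → t p (x ⊗ (h ↑ j ⊗ z)) *ᶻ t p (h ↑ j ⊗ z))
        ≡⟨ ∑-cong (upTo p) (λ j → cong₂ (λ v w → (+ p *ᶻ ⟦ v ≟ 1# ⟧ -ᶻ 1ℤ) *ᶻ (+ p *ᶻ ⟦ w ≟ 1# ⟧ -ᶻ 1ℤ))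
             (trans (⊗-↑ x _ (cofactor p)) (cong (α ⊗_) (orbit-power h j z (cofactor p)))) (orbit-power h j z (cofactor p))) ⟩
      ∑ (upTo p) (λ j → (+ p *ᶻ a j -ᶻ 1ℤ) *ᶻ (+ p *ᶻ b j -ᶻ 1ℤ))
        ≡⟨ ∑-cong (upTo p) (λ j → expand (+ p) (a j) (b j)) ⟩
      ∑ (upTo p) (λ j → + p *ᶻ (+ p *ᶻ (b j *ᶻ a j) -ᶻ a j -ᶻ b j) +ᶻ 1ℤ)
        ≡⟨ ∑-+ (upTo p) _ _ ⟩
      ∑ (upTo p) (λ j → + p *ᶻ (+ p *ᶻ (b j *ᶻ a j) -ᶻ a j -ᶻ b j)) +ᶻ ∑ (upTo p) (λ _ → 1ℤ)
        ≡⟨ cong₂ _+ᶻ_ (∑-*ˡ (upTo p) (+ p) _) (trans (∑-const (upTo p) 1ℤ) (cong (λ k → + k *ᶻ 1ℤ) (length-upTo p))) ⟩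
      + p *ᶻ ∑ (upTo p) (λ j → + p *ᶻ (b j *ᶻ a j) -ᶻ a j -ᶻ b j) +ᶻ + p *ᶻ 1ℤ
        ≡⟨ cong (λ s → + p *ᶻ s +ᶻ + p *ᶻ 1ℤ) (trans (∑-minus (upTo p) _ b) (cong (_-ᶻ ∑ (upTo p) b) (∑-minus (upTo p) _ a))) ⟩
      + p *ᶻ (∑ (upTo p) (λ j → + p *ᶻ (b j *ᶻ a j)) -ᶻ ∑ (upTo p) a -ᶻ ∑ (upTo p) b) +ᶻ + p *ᶻ 1ℤ
        ≡⟨ cong (λ s → + p *ᶻ (s -ᶻ ∑ (upTo p) a -ᶻ ∑ (upTo p) b) +ᶻ + p *ᶻ 1ℤ)
             (trans (∑-*ˡ (upTo p) (+ p) _) (cong (+ p *ᶻ_) (∑-orbit pr ω^p ω≢1 β^p (λ w → ⟦ α ⊗ w ≟ 1# ⟧)))) ⟩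
      + p *ᶻ (+ p *ᶻ ⟦ α ⊗ 1# ≟ 1# ⟧ -ᶻ ∑ (upTo p) a -ᶻ ∑ (upTo p) b) +ᶻ + p *ᶻ 1ℤ
        ≡⟨ cong₂ (λ v w → + p *ᶻ (+ p *ᶻ ⟦ α ⊗ 1# ≟ 1# ⟧ -ᶻ v -ᶻ w) +ᶻ + p *ᶻ 1ℤ) ∑a (∑-orbit-1 pr ω^p ω≢1 β^p) ⟩
      + p *ᶻ (+ p *ᶻ ⟦ α ⊗ 1# ≟ 1# ⟧ -ᶻ 1ℤ -ᶻ 1ℤ) +ᶻ + p *ᶻ 1ℤ
        ≡⟨ collect (+ p) _ ⟩
      + p *ᶻ (+ p *ᶻ ⟦ α ⊗ 1# ≟ 1# ⟧ -ᶻ 1ℤ)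
        ≡⟨ cong (λ w → + p *ᶻ (+ p *ᶻ ⟦ w ≟ 1# ⟧ -ᶻ 1ℤ)) (R.*-identityʳ α) ⟩
      + p *ᶻ t p x ∎
      where
      β = z ↑ cofactor p
      β^p = cofactor-root pf z≢0
      ω^p = cofactor-root pf h≢0
      a b : ℕ → ℤ
      a j = ⟦ α ⊗ (ω ↑ j ⊗ β) ≟ 1# ⟧
      b j = ⟦ ω ↑ j ⊗ β ≟ 1# ⟧
      ∑a : ∑ (upTo p) a ≡ 1ℤ
      ∑a = trans (∑-cong (upTo p) (λ j → cong (λ w → ⟦ w ≟ 1# ⟧) (⊗-left-comm α (ω ↑ j) β)))
        (∑-orbit-1 pr ω^p ω≢1 (trans (⊗-↑ α β p) (trans (cong₂ _⊗_ (cofactor-root pf x≢0) β^p) (R.*-identityˡ 1#))))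
      expand : ∀ p a b → (p *ᶻ a -ᶻ 1ℤ) *ᶻ (p *ᶻ b -ᶻ 1ℤ) ≡ p *ᶻ (p *ᶻ (b *ᶻ a) -ᶻ a -ᶻ b) +ᶻ 1ℤ
      expand = solveℤ
      collect : ∀ p e → p *ᶻ (p *ᶻ e -ᶻ 1ℤ -ᶻ 1ℤ) +ᶻ p *ᶻ 1ℤ ≡ p *ᶻ (p *ᶻ e -ᶻ 1ℤ)
      collect = solveℤ

  ∑T² : ∀ {D} → All PrimeFactor D → Unique D → ∑F (λ z → T D z *ᶻ T D z) ≡ + N *ᶻ + Φ D
  ∑T² {D} pfs D! = trans (∑-cong els (λ z → cong (λ w → T D w *ᶻ T D z) (sym (R.*-identityˡ z))))
    (trans (T-convolution pfs D! 1#) (cong (+ N *ᶻ_) (T-1 pfs)))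

  -- The square-root bound

  ∑F-reflect : ∀ c (f : Carrier → ℤ) → ∑F (λ x → f (c ⊕ ⊖ x)) ≡ ∑F f
  ∑F-reflect c = ∑F-bijection
    (λ {x} {y} e → RP.-‿injective (⊕-cancelʳ c (trans (R.+-comm _ c) (trans e (R.+-comm c _)))))
    (λ x → c ⊕ ⊖ x , reflect x)
    where
    open ≡-Reasoning
    reflect : ∀ x → c ⊕ ⊖ (c ⊕ ⊖ x) ≡ x
    reflect x = begin
      c ⊕ ⊖ (c ⊕ ⊖ x) ≡⟨ cong (c ⊕_) (RP.⁻¹-anti-homo‿- c x) ⟩
      c ⊕ (x ⊕ ⊖ c) ≡⟨ R.+-comm c _ ⟩
      (x ⊕ ⊖ c) ⊕ c ≡⟨ ⊖-⊕-cancel x c ⟩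
      x ∎

  Q : ℕ
  Q = length els

  -- `K` is going to be `T D` with D nonempty. The number `φ`, which shadows Euler's function here,
  -- is then `Φ D`, the number of characters in `K`.
  module _ (K : Carrier → ℤ) (φ : ℕ) (φ>0 : 0 < φ) (K-0 : K 0# ≡ 0ℤ) (∑K : ∑F K ≡ 0ℤ)
    (convolution : ∀ x → ∑F (λ z → K (x ⊗ z) *ᶻ K z) ≡ + N *ᶻ K x)
    (∑K² : ∑F (λ z → K z *ᶻ K z) ≡ + N *ᶻ + φ) where

    private
      energy : ℤ
      energy = + N *ᶻ + φ

    correlation : Carrier → Carrier → ℤ
    correlation x y = ∑F λ b → ∑F λ z → K ((x ⊕ ⊖ b) ⊗ z) *ᶻ K ((y ⊕ ⊖ b) ⊗ z)

    -- For z ≠ 0 the substitution w = (y − b) z turns the sum over b into one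
    -- over w, after which the sum over z is a complete sum of K.
    correlation-value : ∀ x y → correlation x y ≡ energy *ᶻ (+ Q *ᶻ ⟦ x ≟ y ⟧ -ᶻ 1ℤ)
    correlation-value x y = begin
      correlation x y ≡⟨ ∑-swap els els _ ⟩
      ∑F (λ z → ∑F λ b → K ((x ⊕ ⊖ b) ⊗ z) *ᶻ K ((y ⊕ ⊖ b) ⊗ z)) ≡⟨ ∑-cong els fixed-z ⟩
      -- `s z` is the inner sum after the substitution, valid for z ≠ 0. At z = 0 the inner sum is
      -- 0, so `s 0#`, which equals `energy`, is taken off again; this is the -1 in the result.
      ∑F (λ z → s z -ᶻ ⟦ 0# ≟ z ⟧ *ᶻ s z) ≡⟨ ∑-minus els s _ ⟩
      ∑F s -ᶻ ∑F (λ z → ⟦ 0# ≟ z ⟧ *ᶻ s z) ≡⟨ cong₂ _-ᶻ_ (∑-swap els els _) (∑F-δ 0# s) ⟩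
      ∑F (λ w → ∑F λ z → K (d ⊗ z ⊕ w) *ᶻ K w) -ᶻ s 0#
        ≡⟨ cong₂ _-ᶻ_ (∑-cong els (λ w → ∑-*ʳ els (K w) _))
             (trans (∑-cong els (λ w → cong (λ v → K v *ᶻ K w)
               (trans (cong (_⊕ w) (R.zeroʳ d)) (R.+-identityˡ w)))) ∑K²) ⟩
      ∑F (λ w → ∑F (λ z → K (d ⊗ z ⊕ w)) *ᶻ K w) -ᶻ energy ≡⟨ cong (_-ᶻ energy) total ⟩
      + Q *ᶻ ⟦ x ≟ y ⟧ *ᶻ energy -ᶻ energy ≡⟨ factor (+ Q *ᶻ ⟦ x ≟ y ⟧) energy ⟩
      energy *ᶻ (+ Q *ᶻ ⟦ x ≟ y ⟧ -ᶻ 1ℤ) ∎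
      where
      open ≡-Reasoning
      d = x ⊕ ⊖ y
      s : Carrier → ℤ
      s z = ∑F λ w → K (d ⊗ z ⊕ w) *ᶻ K w
      factor : ∀ a e → a *ᶻ e -ᶻ e ≡ e *ᶻ (a -ᶻ 1ℤ)
      factor = solveℤ
      telescope : ∀ b z → d ⊗ z ⊕ (y ⊕ ⊖ b) ⊗ z ≡ (x ⊕ ⊖ b) ⊗ z
      telescope b z = trans (sym (R.distribʳ z d (y ⊕ ⊖ b)))
        (cong (_⊗ z) (trans (sym (R.+-assoc d y (⊖ b))) (cong (_⊕ ⊖ b) (⊖-⊕-cancel x y))))
      fixed-z : ∀ z → ∑F (λ b → K ((x ⊕ ⊖ b) ⊗ z) *ᶻ K ((y ⊕ ⊖ b) ⊗ z)) ≡ s z -ᶻ ⟦ 0# ≟ z ⟧ *ᶻ s z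
      fixed-z z with 0# ≟ z
      ... | yes refl = begin
        ∑F (λ b → K ((x ⊕ ⊖ b) ⊗ 0#) *ᶻ K ((y ⊕ ⊖ b) ⊗ 0#))
          ≡⟨ ∑-cong els (λ b → trans (cong (_*ᶻ K ((y ⊕ ⊖ b) ⊗ 0#)) (trans (cong K (R.zeroʳ _)) K-0))
               (ℤ.*-zeroˡ (K ((y ⊕ ⊖ b) ⊗ 0#)))) ⟩
        ∑F (λ _ → 0ℤ) ≡⟨ ∑-zero els ⟩
        0ℤ ≡⟨ ℤ.+-inverseʳ (s 0#) ⟨
        s 0# -ᶻ s 0# ≡⟨ cong (s 0# -ᶻ_) (ℤ.*-identityˡ (s 0#)) ⟨
        s 0# -ᶻ 1ℤ *ᶻ s 0# ∎
      ... | no 0≢z = begin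
        ∑F (λ b → K ((x ⊕ ⊖ b) ⊗ z) *ᶻ K ((y ⊕ ⊖ b) ⊗ z))
          ≡⟨ ∑-cong els (λ b → cong₂ (λ v w → K v *ᶻ K w)
               (trans (sym (telescope b z)) (cong (d ⊗ z ⊕_) (R.*-comm _ z))) (R.*-comm _ z)) ⟩
        ∑F (λ b → K (d ⊗ z ⊕ z ⊗ (y ⊕ ⊖ b)) *ᶻ K (z ⊗ (y ⊕ ⊖ b)))
          ≡⟨ ∑F-reflect y (λ v → K (d ⊗ z ⊕ z ⊗ v) *ᶻ K (z ⊗ v)) ⟩
        ∑F (λ v → K (d ⊗ z ⊕ z ⊗ v) *ᶻ K (z ⊗ v))
          ≡⟨ ∑F-scale (0≢z ∘ sym) (λ w → K (d ⊗ z ⊕ w) *ᶻ K w) ⟩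
        s z ≡⟨ ℤ.+-identityʳ (s z) ⟨
        s z -ᶻ 0ℤ ≡⟨ cong (s z -ᶻ_) (ℤ.*-zeroˡ (s z)) ⟨
        s z -ᶻ 0ℤ *ᶻ s z ∎
      total : ∑F (λ w → ∑F (λ z → K (d ⊗ z ⊕ w)) *ᶻ K w) ≡ + Q *ᶻ ⟦ x ≟ y ⟧ *ᶻ energy
      total with x ≟ y
      ... | yes refl = begin
        ∑F (λ w → ∑F (λ z → K (d ⊗ z ⊕ w)) *ᶻ K w)
          ≡⟨ ∑-cong els (λ w → cong (_*ᶻ K w) (trans
               (∑-cong els (λ z → cong K (trans (cong (λ v → v ⊗ z ⊕ w) (R.-‿inverseʳ x))
                 (trans (cong (_⊕ w) (R.zeroˡ z)) (R.+-identityˡ w)))))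
               (∑-const els (K w)))) ⟩
        ∑F (λ w → + Q *ᶻ K w *ᶻ K w) ≡⟨ ∑-cong els (λ w → ℤ.*-assoc (+ Q) (K w) (K w)) ⟩
        ∑F (λ w → + Q *ᶻ (K w *ᶻ K w)) ≡⟨ ∑-*ˡ els (+ Q) _ ⟩
        + Q *ᶻ ∑F (λ w → K w *ᶻ K w) ≡⟨ cong₂ _*ᶻ_ (sym (ℤ.*-identityʳ (+ Q))) ∑K² ⟩
        + Q *ᶻ 1ℤ *ᶻ energy ∎
      ... | no x≢y = begin
        ∑F (λ w → ∑F (λ z → K (d ⊗ z ⊕ w)) *ᶻ K w)
          ≡⟨ ∑-cong els (λ w → trans (cong (_*ᶻ K w) (trans
               (∑F-scale (x≢y ∘ RP.x∙y⁻¹≈ε⇒x≈y x y) (λ v → K (v ⊕ w)))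
               (trans (∑F-shift w K) ∑K))) (ℤ.*-zeroˡ (K w))) ⟩
        ∑F (λ _ → 0ℤ) ≡⟨ ∑-zero els ⟩
        0ℤ ≡⟨ ℤ.*-zeroˡ energy ⟨
        0ℤ *ᶻ energy ≡⟨ cong (_*ᶻ energy) (ℤ.*-zeroʳ (+ Q)) ⟨
        + Q *ᶻ 0ℤ *ᶻ energy ∎

    module _ (a : Carrier → ℤ) where

      -- In terms of characters this is Σ χ(z) S_χ, where S_χ sums χ against a translate of `a`;
      -- accordingly `moment b` is N Σ |S_χ|².
      transform : Carrier → Carrier → ℤ
      transform b z = ∑F λ x → a (x ⊕ b) *ᶻ K (x ⊗ z)

      moment : Carrier → ℤ
      moment b = ∑F λ z → transform b z *ᶻ transform b z

      transform-shift : ∀ b z → transform b z ≡ ∑F λ x → a x *ᶻ K ((x ⊕ ⊖ b) ⊗ z)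
      transform-shift b z = trans
        (∑-cong els (λ x → cong (λ v → a (x ⊕ b) *ᶻ K (v ⊗ z)) (sym (⊕-⊖-cancel x b))))
        (∑F-shift b (λ x → a x *ᶻ K ((x ⊕ ⊖ b) ⊗ z)))

      -- Opening the square gives the quadratic form Σ a(x) a(y) `correlation x y`. The correlation
      -- is a multiple of Q on the diagonal minus 1 everywhere, hence the two terms.
      ∑-moment : ∑F moment ≡ energy *ᶻ (+ Q *ᶻ ∑F (λ x → a x *ᶻ a x) -ᶻ ∑F a *ᶻ ∑F a)
      ∑-moment = begin
        ∑F moment
          ≡⟨ ∑-cong els (λ b → ∑-cong els (λ z → trans (cong₂ _*ᶻ_ (transform-shift b z) (transform-shift b z))
               (∑-*-∑ els els _ _))) ⟩
        (∑F λ b → ∑F λ z → ∑F λ x → ∑F λ y → (a x *ᶻ k x b z) *ᶻ (a y *ᶻ k y b z))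
          ≡⟨ ∑-cong els (λ b → ∑-swap els els _) ⟩
        (∑F λ b → ∑F λ x → ∑F λ z → ∑F λ y → (a x *ᶻ k x b z) *ᶻ (a y *ᶻ k y b z))
          ≡⟨ ∑-swap els els _ ⟩
        (∑F λ x → ∑F λ b → ∑F λ z → ∑F λ y → (a x *ᶻ k x b z) *ᶻ (a y *ᶻ k y b z))
          ≡⟨ ∑-cong els (λ x → trans (∑-cong els (λ b → ∑-swap els els _)) (∑-swap els els _)) ⟩
        (∑F λ x → ∑F λ y → ∑F λ b → ∑F λ z → (a x *ᶻ k x b z) *ᶻ (a y *ᶻ k y b z))
          ≡⟨ ∑-cong els (λ x → ∑-cong els (λ y → pair x y)) ⟩
        (∑F λ x → ∑F λ y → energy *ᶻ (+ Q *ᶻ (a x *ᶻ (⟦ x ≟ y ⟧ *ᶻ a y)) -ᶻ a x *ᶻ a y))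
          ≡⟨ ∑-cong els (λ x → ∑-*ˡ els energy _) ⟩
        (∑F λ x → energy *ᶻ ∑F λ y → + Q *ᶻ (a x *ᶻ (⟦ x ≟ y ⟧ *ᶻ a y)) -ᶻ a x *ᶻ a y)
          ≡⟨ ∑-*ˡ els energy _ ⟩
        energy *ᶻ (∑F λ x → ∑F λ y → + Q *ᶻ (a x *ᶻ (⟦ x ≟ y ⟧ *ᶻ a y)) -ᶻ a x *ᶻ a y)
          ≡⟨ cong (energy *ᶻ_) (∑-cong els row) ⟩
        energy *ᶻ ∑F (λ x → + Q *ᶻ (a x *ᶻ a x) -ᶻ a x *ᶻ ∑F a)
          ≡⟨ cong (energy *ᶻ_) (trans (∑-minus els _ _) (cong₂ _-ᶻ_ (∑-*ˡ els (+ Q) _) (∑-*ʳ els (∑F a) a))) ⟩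
        energy *ᶻ (+ Q *ᶻ ∑F (λ x → a x *ᶻ a x) -ᶻ ∑F a *ᶻ ∑F a) ∎
        where
        open ≡-Reasoning
        k : Carrier → Carrier → Carrier → ℤ
        k x b z = K ((x ⊕ ⊖ b) ⊗ z)
        spread : ∀ u v e q i → (u *ᶻ v) *ᶻ (e *ᶻ (q *ᶻ i -ᶻ 1ℤ)) ≡ e *ᶻ (q *ᶻ (u *ᶻ (i *ᶻ v)) -ᶻ u *ᶻ v)
        spread = solveℤ
        pair : ∀ x y → (∑F λ b → ∑F λ z → (a x *ᶻ k x b z) *ᶻ (a y *ᶻ k y b z)) ≡
          energy *ᶻ (+ Q *ᶻ (a x *ᶻ (⟦ x ≟ y ⟧ *ᶻ a y)) -ᶻ a x *ᶻ a y)
        pair x y = begin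
          (∑F λ b → ∑F λ z → (a x *ᶻ k x b z) *ᶻ (a y *ᶻ k y b z))
            ≡⟨ ∑-cong els (λ b → trans (∑-cong els (λ z → *ᶻ.interchange (a x) (k x b z) (a y) (k y b z)))
                 (∑-*ˡ els (a x *ᶻ a y) _)) ⟩
          (∑F λ b → (a x *ᶻ a y) *ᶻ ∑F λ z → k x b z *ᶻ k y b z) ≡⟨ ∑-*ˡ els (a x *ᶻ a y) _ ⟩
          (a x *ᶻ a y) *ᶻ correlation x y ≡⟨ cong ((a x *ᶻ a y) *ᶻ_) (correlation-value x y) ⟩
          (a x *ᶻ a y) *ᶻ (energy *ᶻ (+ Q *ᶻ ⟦ x ≟ y ⟧ -ᶻ 1ℤ)) ≡⟨ spread (a x) (a y) energy (+ Q) ⟦ x ≟ y ⟧ ⟩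
          energy *ᶻ (+ Q *ᶻ (a x *ᶻ (⟦ x ≟ y ⟧ *ᶻ a y)) -ᶻ a x *ᶻ a y) ∎
        row : ∀ x → (∑F λ y → + Q *ᶻ (a x *ᶻ (⟦ x ≟ y ⟧ *ᶻ a y)) -ᶻ a x *ᶻ a y) ≡
          + Q *ᶻ (a x *ᶻ a x) -ᶻ a x *ᶻ ∑F a
        row x = trans (∑-minus els _ _) (cong₂ _-ᶻ_
          (trans (∑-*ˡ els (+ Q) _) (cong (+ Q *ᶻ_) (trans (∑-*ˡ els (a x) _) (cong (a x *ᶻ_) (∑F-δ x a)))))
          (∑-*ˡ els (a x) a))

      total : ℤ
      total = ∑F λ x → a x *ᶻ K x

      -- Expand 0 ≤ Σ_z (φ ĝ(z) − S K(z))², where ĝ = transform 0 and S = total.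
      total²≤moment : + N *ᶻ (total *ᶻ total) ≤ᶻ + φ *ᶻ moment 0#
      total²≤moment = ℤ.*-cancelˡ-≤-pos _ _ (+ φ) ⦃ ℤ.positive (ℤ.+<+ φ>0) ⦄
        (ℤ.0≤i-j⇒j≤i (subst (0ℤ ≤ᶻ_) expansion
          (∑-nonneg els (λ z → 0≤i*i (+ φ *ᶻ g z -ᶻ total *ᶻ K z)))))
        where
        open ≡-Reasoning
        g = transform 0#
        N*total : ∑F (λ z → g z *ᶻ K z) ≡ + N *ᶻ total
        N*total = begin
          ∑F (λ z → g z *ᶻ K z) ≡⟨ ∑-cong els (λ z → sym (∑-*ʳ els (K z) _)) ⟩
          (∑F λ z → ∑F λ x → (a (x ⊕ 0#) *ᶻ K (x ⊗ z)) *ᶻ K z) ≡⟨ ∑-swap els els _ ⟩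
          (∑F λ x → ∑F λ z → (a (x ⊕ 0#) *ᶻ K (x ⊗ z)) *ᶻ K z)
            ≡⟨ ∑-cong els (λ x → trans (∑-cong els (λ z → ℤ.*-assoc (a (x ⊕ 0#)) _ _)) (∑-*ˡ els (a (x ⊕ 0#)) _)) ⟩
          (∑F λ x → a (x ⊕ 0#) *ᶻ ∑F λ z → K (x ⊗ z) *ᶻ K z)
            ≡⟨ ∑-cong els (λ x → trans (cong₂ _*ᶻ_ (cong a (R.+-identityʳ x)) (convolution x)) (*ᶻ.x∙yz≈y∙xz (a x) (+ N) (K x))) ⟩
          (∑F λ x → + N *ᶻ (a x *ᶻ K x)) ≡⟨ ∑-*ˡ els (+ N) _ ⟩
          + N *ᶻ total ∎
        square : ∀ f s g k → (f *ᶻ g -ᶻ s *ᶻ k) *ᶻ (f *ᶻ g -ᶻ s *ᶻ k) ≡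
          (f *ᶻ f) *ᶻ (g *ᶻ g) -ᶻ ((+ 2 *ᶻ f *ᶻ s) *ᶻ (g *ᶻ k) -ᶻ (s *ᶻ s) *ᶻ (k *ᶻ k))
        square = solveℤ
        collect : ∀ f s m n → (f *ᶻ f) *ᶻ m -ᶻ ((+ 2 *ᶻ f *ᶻ s) *ᶻ (n *ᶻ s) -ᶻ (s *ᶻ s) *ᶻ (n *ᶻ f)) ≡
          f *ᶻ (f *ᶻ m) -ᶻ f *ᶻ (n *ᶻ (s *ᶻ s))
        collect = solveℤ
        expansion : ∑F (λ z → (+ φ *ᶻ g z -ᶻ total *ᶻ K z) *ᶻ (+ φ *ᶻ g z -ᶻ total *ᶻ K z)) ≡
          + φ *ᶻ (+ φ *ᶻ moment 0#) -ᶻ + φ *ᶻ (+ N *ᶻ (total *ᶻ total))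
        expansion = begin
          ∑F (λ z → (+ φ *ᶻ g z -ᶻ total *ᶻ K z) *ᶻ (+ φ *ᶻ g z -ᶻ total *ᶻ K z))
            ≡⟨ ∑-cong els (λ z → square (+ φ) total (g z) (K z)) ⟩
          ∑F (λ z → (+ φ *ᶻ + φ) *ᶻ (g z *ᶻ g z) -ᶻ ((+ 2 *ᶻ + φ *ᶻ total) *ᶻ (g z *ᶻ K z) -ᶻ (total *ᶻ total) *ᶻ (K z *ᶻ K z)))
            ≡⟨ trans (∑-minus els _ _) (cong₂ _-ᶻ_ (∑-*ˡ els (+ φ *ᶻ + φ) _) (trans (∑-minus els _ _)
                 (cong₂ _-ᶻ_ (trans (∑-*ˡ els (+ 2 *ᶻ + φ *ᶻ total) _) (cong (+ 2 *ᶻ + φ *ᶻ total *ᶻ_) N*total))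
                   (trans (∑-*ˡ els (total *ᶻ total) _) (cong (total *ᶻ total *ᶻ_) ∑K²))))) ⟩
          (+ φ *ᶻ + φ) *ᶻ moment 0# -ᶻ ((+ 2 *ᶻ + φ *ᶻ total) *ᶻ (+ N *ᶻ total) -ᶻ (total *ᶻ total) *ᶻ (+ N *ᶻ + φ))
            ≡⟨ collect (+ φ) total (moment 0#) (+ N) ⟩
          + φ *ᶻ (+ φ *ᶻ moment 0#) -ᶻ + φ *ᶻ (+ N *ᶻ (total *ᶻ total)) ∎

      module _ {V : Carrier → Set} (V? : Decidable V) (V0 : V 0#)
        (a-periodic : ∀ {b} → V b → ∀ x → a (x ⊕ b) ≡ a x)
        (a-idem : ∀ x → a x *ᶻ a x ≡ a x) (∑a : ∑F a ≡ ∑F (⟦_⟧ ∘ V?)) where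

        private
          size : ℤ
          size = ∑F (⟦_⟧ ∘ V?)

        size-positive : ℤ.Positive size
        size-positive = ℤ.positive (ℤ.<-≤-trans (ℤ.+<+ (s≤s z≤n)) (subst (_≤ᶻ size)
          (∑F-δ 0# (λ _ → 1ℤ)) (∑-mono els (λ x → le x))))
          where
          le : ∀ x → ⟦ 0# ≟ x ⟧ *ᶻ 1ℤ ≤ᶻ ⟦ V? x ⟧
          le x with 0# ≟ x
          ... | yes refl = ℤ.≤-reflexive (sym (⟦⟧-yes (V? 0#) V0))
          ... | no _     = 0≤⟦⟧ (V? x)

        size*moment≤ : size *ᶻ moment 0# ≤ᶻ size *ᶻ (energy *ᶻ + Q)
        size*moment≤ = begin
          size *ᶻ moment 0# ≡⟨ ∑-*ʳ els (moment 0#) _ ⟨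
          ∑F (λ b → ⟦ V? b ⟧ *ᶻ moment 0#) ≤⟨ ∑-mono els le ⟩
          ∑F moment ≡⟨ ∑-moment ⟩
          energy *ᶻ (+ Q *ᶻ ∑F (λ x → a x *ᶻ a x) -ᶻ ∑F a *ᶻ ∑F a)
            ≡⟨ cong₂ (λ u v → energy *ᶻ (+ Q *ᶻ u -ᶻ v *ᶻ v)) (trans (∑-cong els a-idem) ∑a) ∑a ⟩
          energy *ᶻ (+ Q *ᶻ size -ᶻ size *ᶻ size)
            -- The subtracted square is given up here; keeping it would lead to √(Q - |V|) instead
            -- of √Q.
            ≤⟨ ℤ.*-monoˡ-≤-nonNeg energy ⦃ energy-nonneg ⦄ (drop (+ Q *ᶻ size) (size *ᶻ size) (0≤i*i size)) ⟩
          energy *ᶻ (+ Q *ᶻ size) ≡⟨ rotate energy (+ Q) size ⟩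
          size *ᶻ (energy *ᶻ + Q) ∎
          where
          open ℤ.≤-Reasoning
          energy-nonneg : ℤ.NonNegative energy
          energy-nonneg = subst ℤ.NonNegative (ℤ.pos-* N φ) _
          drop : ∀ u v → 0ℤ ≤ᶻ v → u -ᶻ v ≤ᶻ u
          drop u v h = subst (u -ᶻ v ≤ᶻ_) (ℤ.+-identityʳ u) (ℤ.+-monoʳ-≤ u (ℤ.neg-mono-≤ h))
          rotate : ∀ e q m → e *ᶻ (q *ᶻ m) ≡ m *ᶻ (e *ᶻ q)
          rotate = solveℤ
          le : ∀ b → ⟦ V? b ⟧ *ᶻ moment 0# ≤ᶻ moment b
          le b with V? b
          ... | no _   = subst (_≤ᶻ moment b) (sym (ℤ.*-zeroˡ (moment 0#))) (∑-nonneg els (λ z → 0≤i*i (transform b z)))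
          ... | yes Vb = ℤ.≤-reflexive (trans (ℤ.*-identityˡ (moment 0#))
            (∑-cong els (λ z → cong (λ v → v *ᶻ v)
              (∑-cong els (λ x → cong (_*ᶻ K (x ⊗ z)) (trans (cong a (R.+-identityʳ x)) (sym (a-periodic Vb x))))))))

        total²≤φ²Q : total *ᶻ total ≤ᶻ + φ *ᶻ + φ *ᶻ + Q
        total²≤φ²Q = ℤ.*-cancelˡ-≤-pos _ _ (+ N) ⦃ ℤ.positive (ℤ.+<+ N>0) ⦄ (begin
          + N *ᶻ (total *ᶻ total) ≤⟨ total²≤moment ⟩
          + φ *ᶻ moment 0# ≤⟨ ℤ.*-monoˡ-≤-nonNeg (+ φ) (ℤ.*-cancelˡ-≤-pos _ _ size ⦃ size-positive ⦄ size*moment≤) ⟩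
          + φ *ᶻ (energy *ᶻ + Q) ≡⟨ rotate (+ φ) (+ N) (+ Q) ⟩
          + N *ᶻ (+ φ *ᶻ + φ *ᶻ + Q) ∎)
          where
          open ℤ.≤-Reasoning
          rotate : ∀ f n q → f *ᶻ (n *ᶻ f *ᶻ q) ≡ n *ᶻ (f *ᶻ f *ᶻ q)
          rotate = solveℤ

  -- Primitive elements

  ps : List ℕ
  ps = primeDivisors N

  ps-prime : All PrimeFactor ps
  ps-prime = All.tabulate ∈-primeDivisors⁻

  Full : List ℕ → Carrier → Set
  Full L x = All (λ p → x ↑ cofactor p ≢ 1#) L

  full? : ∀ L → Decidable (Full L)
  full? L x = All.all? (λ p → ¬? (x ↑ cofactor p ≟ 1#)) L

  -- If x^m = 1, then x^g = 1 for g = gcd m N, a proper divisor of N. A prime p dividing N / g makes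
  -- g a divisor of N/p, so x^(N/p) = 1, against fullness.
  full-order : ∀ {x m} → Full ps x → x ≢ 0# → 0 < m → m < N → x ↑ m ≢ 1#
  full-order {x} {m} full x≢0 0<m m<N e with gcd[m,n]∣n m N
  ... | divides k eq with ∃-prime-divisor 1<k
    where
    g = gcd m N
    g<N : g < N
    g<N = ℕ.≤-<-trans (∣⇒≤ ⦃ >-nonZero 0<m ⦄ (gcd[m,n]∣m m N)) m<N
    1<k : 1 < k
    1<k = ℕ.≰⇒> λ k≤1 → contradiction g<N (ℕ.≤⇒≯ (begin
      N ≡⟨ eq ⟩
      k * g ≤⟨ ℕ.*-monoˡ-≤ g k≤1 ⟩
      1 * g ≡⟨ ℕ.*-identityˡ g ⟩
      g ∎))
      where open ℕ.≤-Reasoning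
  ... | p , pr , divides l refl = All.lookup full (∈-primeDivisors⁺ N>0 pr p∣N)
    (↑-root {x} {gcd m N} (↑-gcd x m N e (lagrange x≢0)) (divides l
      (ℕ.*-cancelʳ-≡ (cofactor p) (l * gcd m N) p ⦃ >-nonZero (ℕ.<-trans (s≤s z≤n) (prime>1 pr)) ⦄
        (trans (cofactor-* {p} (pr , p∣N)) (trans eq (rearrange l p (gcd m N)))))))
    where
    p∣N : p ∣ N
    p∣N = subst (p ∣_) (sym eq) (∣.∣-trans (divides l refl) (∣.m∣m*n (gcd m N)))
    rearrange : ∀ l p g → l * p * g ≡ l * g * p
    rearrange l p g = trans (ℕ.*-assoc l p g) (trans (cong (l *_) (ℕ.*-comm p g)) (sym (ℕ.*-assoc l g p)))

  -- The exponents are 1 ... N, the range in which Euler's `φ` counts, so that the list can be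
  -- compared with it directly.
  powers : Carrier → List Carrier
  powers x = map (x ↑_) (range1 N)

  module _ {g} (full : Full ps g) (g≢0 : g ≢ 0#) where

    powers-≢ : ∀ {i j} → i < j → j ∸ i < N → g ↑ i ≢ g ↑ j
    powers-≢ {i} {j} i<j d<N e = full-order full g≢0 (ℕ.m<n⇒0<n∸m i<j) d<N
      (⊗-cancelˡ (↑-nonzero i g≢0) (trans (sym (↑-+ g i (j ∸ i)))
        (trans (cong (g ↑_) (ℕ.m+[n∸m]≡n (ℕ.<⇒≤ i<j))) (trans (sym e) (sym (R.*-identityʳ _))))))

    private
      ∸<N : ∀ {i j} → 0 < i × i ≤ N → 0 < j × j ≤ N → j ∸ i < N
      ∸<N {suc i} {suc j} _ (_ , j<N) = ℕ.≤-<-trans (ℕ.m∸n≤m j i) j<N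

    ↑-injective : ∀ {i j} → i ∈ range1 N → j ∈ range1 N → g ↑ i ≡ g ↑ j → i ≡ j
    ↑-injective {i} {j} i∈ j∈ e with ℕ.<-cmp i j
    ... | tri≈ _ i≡j _ = i≡j
    ... | tri< i<j _ _ = contradiction e (powers-≢ i<j (∸<N (∈-range1⁻ i∈) (∈-range1⁻ j∈)))
    ... | tri> _ _ j<i = contradiction (sym e) (powers-≢ j<i (∸<N (∈-range1⁻ j∈) (∈-range1⁻ i∈)))

    powers! : Unique (powers g)
    powers! = map-unique (range1! N) ↑-injective

    ∈-powers : ∀ {y} → y ≢ 0# → y ∈ powers g
    ∈-powers y≢0 = unique-full _≟_ powers!
      (λ m → let (j , _ , e) = ∈-map⁻ (g ↑_) m in ≢0⇒∈els* (λ z → ↑-nonzero j g≢0 (trans (sym e) z)))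
      (ℕ.≤-reflexive (sym (trans (length-map (g ↑_) (range1 N)) (length-range1 N))))
      (≢0⇒∈els* y≢0)

    log : ∀ {y} → y ≢ 0# → ∃ λ k → k ∈ range1 N × y ≡ g ↑ k
    log y≢0 = ∈-map⁻ (g ↑_) (∈-powers y≢0)

    full⇒primitive : IsPrimitive F g
    full⇒primitive = g≢0 , λ y y≢0 → let (k , _ , e) = log y≢0 in k , sym e

  -- If x^m = 1 for m = N/p, reducing exponents modulo m shows that x has at most m < N powers, too
  -- few to cover all nonzero elements.
  primitive⇒full : ∀ {x} → IsPrimitive F x → Full ps x
  primitive⇒full {x} (x≢0 , gen) = All.tabulate λ {p} p∈ e →
    let pf = ∈-primeDivisors⁻ {N} p∈
        m = cofactor p
        instance m≢0 = >-nonZero (cofactor>0 pf)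
    in contradiction (cofactor<N pf) (ℕ.≤⇒≯ (subst (N ≤_)
      (trans (length-map (x ↑_) (upTo m)) (length-upTo m))
      (unique-⊆-length els*! λ {y} y∈ → let (k , ek) = gen y (∈els*⇒≢0 y∈) in
        subst (_∈ map (x ↑_) (upTo m))
          (trans (sym (↑-+-root x (k % m) (k / m) m e)) (trans (cong (x ↑_) (sym (m≡m%n+[m/n]*n k m))) ek))
          (∈-map⁺ (x ↑_) (∈-upTo⁺ (m%n<n k m))))))

  primitive? : Decidable (IsPrimitive F)
  primitive? x = map′ (λ (x≢0 , full) → full⇒primitive full x≢0) (λ prim → proj₁ prim , primitive⇒full prim)
    (¬? (x ≟ 0#) ×-dec full? ps x)

  primitives : List Carrier
  primitives = filter primitive? els

  sieve : List ℕ → Carrier → ℤ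
  sieve []      x = 1ℤ
  sieve (p ∷ L) x = (+ (p ∸ 1) -ᶻ t p x) *ᶻ sieve L x

  sieve-full : ∀ {L} → All Prime L → ∀ x → sieve L x ≡ + product L *ᶻ ⟦ full? L x ⟧
  sieve-full [] x = refl
  sieve-full {p ∷ L} (pr ∷ prs) x = trans (cong₂ _*ᶻ_ factor (sieve-full prs x))
    (trans (*ᶻ.interchange (+ p) _ (+ product L) _) (cong₂ _*ᶻ_ (sym (ℤ.pos-* p (product L))) (sym (⟦⟧-× (¬? e?) (full? L x)))))
    where
    open ≡-Reasoning
    e? = x ↑ cofactor p ≟ 1#
    cancel : ∀ p e → (p *ᶻ 1ℤ -ᶻ 1ℤ) -ᶻ (p *ᶻ e -ᶻ 1ℤ) ≡ p *ᶻ (1ℤ -ᶻ e)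
    cancel = solveℤ
    factor : + (p ∸ 1) -ᶻ t p x ≡ + p *ᶻ ⟦ ¬? e? ⟧
    factor = begin
      + (p ∸ 1) -ᶻ t p x ≡⟨ cong (_-ᶻ t p x) (p·1-1 pr) ⟨
      (+ p *ᶻ 1ℤ -ᶻ 1ℤ) -ᶻ (+ p *ᶻ ⟦ e? ⟧ -ᶻ 1ℤ) ≡⟨ cancel (+ p) ⟦ e? ⟧ ⟩
      + p *ᶻ (1ℤ -ᶻ ⟦ e? ⟧) ≡⟨ cong (+ p *ᶻ_) (⟦⟧-¬ e?) ⟨
      + p *ᶻ ⟦ ¬? e? ⟧ ∎

  sieve-primitive : ∀ x → sieve ps x *ᶻ T [] x ≡ + product ps *ᶻ ⟦ primitive? x ⟧
  sieve-primitive x = trans (cong (_*ᶻ T [] x) (sieve-full (All.map proj₁ ps-prime) x))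
    (trans (ℤ.*-assoc (+ product ps) _ _) (cong (+ product ps *ᶻ_)
      (trans (ℤ.*-comm ⟦ full? ps x ⟧ _) (sym (⟦⟧-× (¬? (x ≟ 0#)) (full? ps x))))))

  split-ps : Split PrimeFactor ps []
  split-ps = split (primeDivisors! N) [] ps-prime [] (All.tabulate λ _ → [])

  -- A stage of expanding the sieve: L holds the primes whose factor is still unexpanded, D those
  -- where the term `t p` was chosen.
  weighted : (Carrier → ℤ) → List ℕ → List ℕ → ℤ
  weighted s L D = ∑F λ x → s x *ᶻ (sieve L x *ᶻ T D x)

  weighted-step : ∀ s p L D → weighted s (p ∷ L) D ≡ + (p ∸ 1) *ᶻ weighted s L D -ᶻ weighted s L (p ∷ D)
  weighted-step s p L D = trans (∑-cong els (λ x → distrib (s x) (+ (p ∸ 1)) (t p x) (sieve L x) (T D x)))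
    (trans (∑-minus els _ _) (cong (_-ᶻ weighted s L (p ∷ D)) (∑-*ˡ els (+ (p ∸ 1)) _)))
    where
    distrib : ∀ s a t j d → s *ᶻ (((a -ᶻ t) *ᶻ j) *ᶻ d) ≡ a *ᶻ (s *ᶻ (j *ᶻ d)) -ᶻ s *ᶻ (j *ᶻ (t *ᶻ d))
    distrib = solveℤ

  private
    one : Carrier → ℤ
    one _ = 1ℤ

    unit : ∀ d → 1ℤ *ᶻ (1ℤ *ᶻ d) ≡ d
    unit = solveℤ

  weighted-one-∷ : ∀ {L p D} → Split PrimeFactor L (p ∷ D) → weighted one L (p ∷ D) ≡ 0ℤ
  weighted-one-∷ {[]} {p} {D} sp = trans (∑-cong els (λ x → unit (T (p ∷ D) x))) (∑T≡0 (Split.right∀ sp) (Split.right! sp))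
  weighted-one-∷ {r ∷ L} {p} {D} sp = trans (weighted-step one r L (p ∷ D))
    (trans (cong₂ (λ u v → + (r ∸ 1) *ᶻ u -ᶻ v) (weighted-one-∷ (dropHead sp)) (weighted-one-∷ (moveHead sp)))
      (cong (_-ᶻ 0ℤ) (ℤ.*-zeroʳ (+ (r ∸ 1)))))

  weighted-one-[] : ∀ {L} → Split PrimeFactor L [] → weighted one L [] ≡ + Φ L *ᶻ + N
  weighted-one-[] {[]} sp = trans (∑-cong els (λ x → unit (T [] x)))
    (trans (∑-⟦⟧ (λ x → ¬? (x ≟ 0#)) els) (sym (ℤ.*-identityˡ (+ N))))
  weighted-one-[] {p ∷ L} sp = trans (weighted-step one p L [])
    (trans (cong₂ (λ u v → + (p ∸ 1) *ᶻ u -ᶻ v) (weighted-one-[] (dropHead sp)) (weighted-one-∷ (moveHead sp)))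
      (trans (assoc (+ (p ∸ 1)) (+ Φ L) (+ N)) (cong (_*ᶻ + N) (sym (ℤ.pos-* (p ∸ 1) (Φ L))))))
    where
    assoc : ∀ a b c → a *ᶻ (b *ᶻ c) -ᶻ 0ℤ ≡ (a *ᶻ b) *ᶻ c
    assoc = solveℤ

  -- The sieve with constant weight: every term with a nonempty D is a complete character sum and
  -- vanishes, so only the choice of p - 1 at each prime remains.
  count-primitives : product ps * length primitives ≡ Φ ps * N
  count-primitives = ℤ.+-injective (begin
    + (product ps * length primitives) ≡⟨ ℤ.pos-* (product ps) _ ⟩
    + product ps *ᶻ + length primitives ≡⟨ cong (+ product ps *ᶻ_) (∑-⟦⟧ primitive? els) ⟨
    + product ps *ᶻ ∑F (⟦_⟧ ∘ primitive?) ≡⟨ ∑-*ˡ els (+ product ps) _ ⟨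
    ∑F (λ x → + product ps *ᶻ ⟦ primitive? x ⟧)
      ≡⟨ ∑-cong els (λ x → trans (sym (sieve-primitive x)) (sym (ℤ.*-identityˡ _))) ⟩
    weighted one ps [] ≡⟨ weighted-one-[] split-ps ⟩
    + Φ ps *ᶻ + N ≡⟨ ℤ.pos-* (Φ ps) N ⟨
    + (Φ ps * N) ∎)
    where open ≡-Reasoning

  Φps>0 : 0 < Φ ps
  Φps>0 = Φ>0 (All.map proj₁ ps-prime)

  abstract
    -- Without primitive elements one side of `count-primitives` would be 0 while the other is
    -- positive.
    generator : ∃ (IsPrimitive F)
    generator = nonempty primitives (λ m → proj₂ (∈-filter⁻ primitive? {xs = els} m)) count-primitives
      where
      nonempty : (l : List Carrier) → (∀ {x} → x ∈ l → IsPrimitive F x) →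
        product ps * length l ≡ Φ ps * N → ∃ (IsPrimitive F)
      nonempty []      _   e = contradiction (subst (0 <_) (trans (sym e) (ℕ.*-zeroʳ (product ps)))
        (ℕ.*-mono-≤ Φps>0 N>0)) (ℕ.<-irrefl refl)
      nonempty (g ∷ _) all _ = g , all (here refl)

  γ : Carrier
  γ = proj₁ generator

  γ≢0 : γ ≢ 0#
  γ≢0 = proj₁ (proj₂ generator)

  γ-full : Full ps γ
  γ-full = primitive⇒full (proj₂ generator)

  -- If (γ^k)^(N/p) = 1, then γ^(N/p) is killed by both exponents k and N; being coprime, they force
  -- it to be 1, against the fullness of γ.
  coprime⇒primitive : ∀ k → gcd k N ≡ 1 → IsPrimitive F (γ ↑ k)
  coprime⇒primitive k c = full⇒primitive (All.tabulate λ {p} p∈ e →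
      All.lookup γ-full p∈ (coprime-orders {γ ↑ cofactor p} {k} {N} (gcd≡1⇒coprime c)
        (trans (sym (↑-* γ (cofactor p) k)) (trans (↑-*′ γ (cofactor p) k) e))
        (lagrange (↑-nonzero (cofactor p) γ≢0))))
    (↑-nonzero k γ≢0)

  -- A common divisor d ≥ 2 of k and N would give (γ^k)^(N/d) = 1 with 0 < N/d < N.
  primitive⇒coprime : ∀ k → IsPrimitive F (γ ↑ k) → gcd k N ≡ 1
  primitive⇒coprime k prim = common-divisor (gcd[m,n]∣m k N) (gcd[m,n]∣n k N)
    where
    common-divisor : ∀ {d} → d ∣ k → d ∣ N → d ≡ 1
    common-divisor {zero} _ (divides b N≡) = contradiction (trans N≡ (ℕ.*-zeroʳ b)) (ℕ.>⇒≢ N>0)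
    common-divisor {suc zero} _ _ = refl
    common-divisor {d@(suc (suc _))} (divides a k≡) (divides b N≡) =
      contradiction root (full-order (primitive⇒full prim) (proj₁ prim) b>0 b<N)
      where
      b>0 : 0 < b
      b>0 = ℕ.n≢0⇒n>0 λ b≡0 → ℕ.>⇒≢ N>0 (trans N≡ (cong (_* d) b≡0))
      b<N : b < N
      b<N = subst (b <_) (sym N≡) (ℕ.m<m*n b d ⦃ >-nonZero b>0 ⦄ (s≤s (s≤s z≤n)))
      root : (γ ↑ k) ↑ b ≡ 1#
      root = trans (sym (↑-* γ k b)) (↑-root {γ} {N} (lagrange γ≢0) (divides a (begin
        k * b ≡⟨ cong (_* b) k≡ ⟩
        a * d * b ≡⟨ ℕ.*-assoc a d b ⟩
        a * (d * b) ≡⟨ cong (a *_) (trans (ℕ.*-comm d b) (sym N≡)) ⟩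
        a * N ∎)))
        where open ≡-Reasoning

  -- Since γ generates, k ↦ γ^k matches the k in 1 ... N coprime to N with the primitive elements;
  -- the two inclusions of lists give the two inequalities.
  φN≡ : φ N ≡ length primitives
  φN≡ = trans (sym (length-map (γ ↑_) coprimes)) (ℕ.≤-antisym
    (unique-⊆-length image! λ m → let (k , k∈ , e) = ∈-map⁻ (γ ↑_) m in
      ∈-filter⁺ primitive? (complete _) (subst (IsPrimitive F) (sym e)
        (coprime⇒primitive k (ℕ.≡ᵇ⇒≡ (gcd k N) 1 (proj₂ (∈-filter⁻ coprime? {xs = range1 N} k∈))))))
    (unique-⊆-length (Unique.filter⁺ primitive? els!) λ {x} m →
      let prim = proj₂ (∈-filter⁻ primitive? {xs = els} m)
          (k , k∈ , e) = log γ-full γ≢0 (proj₁ prim)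
      in subst (_∈ map (γ ↑_) coprimes) (sym e) (∈-map⁺ (γ ↑_)
        (∈-filter⁺ coprime? k∈
          (ℕ.≡⇒≡ᵇ (gcd k N) 1 (primitive⇒coprime k (subst (IsPrimitive F) e prim)))))))
    where
    coprime? : Decidable (λ k → IsTrue (does (gcd k N ℕ.≟ 1)))
    coprime? k = T? (does (gcd k N ℕ.≟ 1))
    coprimes : List ℕ
    coprimes = filterᵇ (λ k → does (gcd k N ℕ.≟ 1)) (range1 N)
    image! : Unique (map (γ ↑_) coprimes)
    image! = map-unique (Unique.filter⁺ coprime? (range1! N)) λ i∈ j∈ → ↑-injective γ-full γ≢0
      (proj₁ (∈-filter⁻ coprime? {xs = range1 N} i∈))
      (proj₁ (∈-filter⁻ coprime? {xs = range1 N} j∈))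

-- Affine spaces

module AffineSpaces (F : Field) (els : List (Field.Carrier F)) (els! : Unique els)
  (complete : ∀ x → x ∈ els) (p k n : ℕ) (pr : Prime p) (1≤k : 1 ≤ k) (card : length els ≡ (p ^ k) ^ n) where
  open FiniteField F els els! complete public

  q : ℕ
  q = p ^ k

  q>1 : 1 < q
  q>1 = begin-strict
    1 <⟨ prime>1 pr ⟩
    p ≡⟨ ℕ.^-identityʳ p ⟨
    p ^ 1 ≤⟨ ℕ.^-monoʳ-≤ p ⦃ prime⇒nonZero pr ⦄ 1≤k ⟩
    p ^ k ∎
    where open ℕ.≤-Reasoning

  private
    char : p · 1# ≡ 0#
    char = characteristic {p} {k * n} (trans card (ℕ.^-*-assoc p k n))

    r : ℕ
    r = q ∸ 1

    suc-r : suc r ≡ q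
    suc-r = ℕ.m+[n∸m]≡n (ℕ.<⇒≤ q>1)

    r>0 : 0 < r
    r>0 = ℕ.∸-monoˡ-≤ 1 q>1

    M : ℕ
    M = proj₁ (geometric r n)

    M*r≡N : M * r ≡ N
    M*r≡N = ℕ.suc-injective (trans (proj₂ (geometric r n))
      (trans (cong (_^ n) suc-r) (trans (sym card) length≡1+N)))

    M>0 : 0 < M
    M>0 = ℕ.n≢0⇒n>0 λ M≡0 → ℕ.>⇒≢ N>0 (trans (sym M*r≡N) (cong (_* r) M≡0))

  -- As M = N / (q - 1), the element γ^M generates the subgroup of order q - 1, the nonzero elements
  -- of the subfield.
  Fq* : List Carrier
  Fq* = map (λ j → γ ↑ (M * j)) (range1 r)

  private
    exponent∈ : ∀ {j} → j ∈ range1 r → M * j ∈ range1 N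
    exponent∈ j∈ = let (0<j , j≤r) = ∈-range1⁻ j∈ in
      ∈-range1⁺ (ℕ.*-mono-≤ M>0 0<j) (subst (M * _ ≤_) M*r≡N (ℕ.*-monoʳ-≤ M j≤r))

  Fq*! : Unique Fq*
  Fq*! = map-unique (range1! r) λ {i} {j} i∈ j∈ e →
    ℕ.*-cancelˡ-≡ i j M ⦃ >-nonZero M>0 ⦄ (↑-injective γ-full γ≢0 {M * i} {M * j} (exponent∈ i∈) (exponent∈ j∈) e)

  length-Fq* : length Fq* ≡ r
  length-Fq* = trans (length-map _ (range1 r)) (length-range1 r)

  Fq*-root : ∀ {x} → x ∈ Fq* → x ↑ r ≡ 1#
  Fq*-root m with ∈-map⁻ _ m
  ... | j , _ , refl = trans (sym (↑-* γ (M * j) r)) (↑-root {γ} {N} (lagrange γ≢0) (divides j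
    (trans (rearrange M j r) (cong (j *_) M*r≡N))))
    where
    rearrange : ∀ M j r → M * j * r ≡ j * (M * r)
    rearrange = solveℕ

  -- The list already contains r distinct roots of x^r = 1, and there are at most r.
  root-Fq* : ∀ {x} → x ↑ r ≡ 1# → x ∈ Fq*
  root-Fq* {x} e = unique-full _≟_ Fq*! (λ m → ∈-filter⁺ root? (complete _) (Fq*-root m))
    (ℕ.≤-trans (roots-of-unity r>0 (Unique.filter⁺ root? els!) (All.tabulate λ m → proj₂ (∈-filter⁻ root? {xs = els} m)))
      (ℕ.≤-reflexive (sym length-Fq*)))
    (∈-filter⁺ root? (complete x) e)
    where root? = λ x → x ↑ r ≟ 1#

  Fq : List Carrier
  Fq = 0# ∷ Fq*

  length-Fq : length Fq ≡ q
  length-Fq = trans (cong suc length-Fq*) suc-r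

  Fq! : Unique Fq
  Fq! = All.tabulate (λ m e → 0≢1 (trans (sym (0↑ r r>0)) (trans (cong (_↑ r) e) (Fq*-root m)))) ∷ Fq*!

  ∈Fq⁻ : ∀ {x} → x ∈ Fq → InFq F q x
  ∈Fq⁻ (here refl) = 0↑ q (ℕ.<-trans (s≤s z≤n) q>1)
  ∈Fq⁻ {x} (there m) = trans (cong (x ↑_) (sym suc-r)) (trans (cong (x ⊗_) (Fq*-root m)) (R.*-identityʳ x))

  ∈Fq⁺ : ∀ {x} → InFq F q x → x ∈ Fq
  ∈Fq⁺ {x} e with x ≟ 0#
  ... | yes x≡0 = here x≡0
  ... | no x≢0  = there (root-Fq* (⊗-cancelˡ x≢0 (trans (cong (x ↑_) suc-r) (trans e (sym (R.*-identityʳ x))))))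

  InFq-⊕ : ∀ {x y} → InFq F q x → InFq F q y → InFq F q (x ⊕ y)
  InFq-⊕ {x} {y} ex ey = trans (frobenius-^ pr char k x y) (cong₂ _⊕_ ex ey)

  -- Additivity of the q-th power gives x^q + (-x)^q = 0, which avoids distinguishing odd from even
  -- q.
  InFq-⊖ : ∀ {x} → InFq F q x → InFq F q (⊖ x)
  InFq-⊖ {x} ex = RP.+-cancelˡ x _ _ (begin
    x ⊕ (⊖ x) ↑ q ≡⟨ cong (_⊕ (⊖ x) ↑ q) ex ⟨
    x ↑ q ⊕ (⊖ x) ↑ q ≡⟨ frobenius-^ pr char k x (⊖ x) ⟨
    (x ⊕ ⊖ x) ↑ q ≡⟨ cong (_↑ q) (R.-‿inverseʳ x) ⟩
    0# ↑ q ≡⟨ ∈Fq⁻ (here refl) ⟩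
    0# ≡⟨ R.-‿inverseʳ x ⟨
    x ⊕ ⊖ x ∎)
    where open ≡-Reasoning

  AllFq : ∀ {t} → Vec Carrier t → Set
  AllFq = VAll.All (InFq F q)

  _⊞_ : ∀ {t} → Vec Carrier t → Vec Carrier t → Vec Carrier t
  _⊞_ = Vec.zipWith _⊕_

  ⊟_ : ∀ {t} → Vec Carrier t → Vec Carrier t
  ⊟_ = Vec.map ⊖_

  AllFq-⊞ : ∀ {t} {cs ds : Vec Carrier t} → AllFq cs → AllFq ds → AllFq (cs ⊞ ds)
  AllFq-⊞ []       []       = []
  AllFq-⊞ (c ∷ cs) (d ∷ ds) = InFq-⊕ c d ∷ AllFq-⊞ cs ds

  AllFq-⊟ : ∀ {t} {cs : Vec Carrier t} → AllFq cs → AllFq (⊟ cs)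
  AllFq-⊟ []       = []
  AllFq-⊟ (c ∷ cs) = InFq-⊖ c ∷ AllFq-⊟ cs

  AllFq-0 : ∀ t → AllFq (Vec.replicate t 0#)
  AllFq-0 zero    = []
  AllFq-0 (suc t) = ∈Fq⁻ (here refl) ∷ AllFq-0 t

  linComb-⊞ : ∀ {t} (cs ds vs : Vec Carrier t) → linComb F (cs ⊞ ds) vs ≡ linComb F cs vs ⊕ linComb F ds vs
  linComb-⊞ []       []       []       = sym (R.+-identityʳ 0#)
  linComb-⊞ (c ∷ cs) (d ∷ ds) (v ∷ vs) = begin
    (c ⊕ d) ⊗ v ⊕ linComb F (cs ⊞ ds) vs ≡⟨ cong₂ _⊕_ (R.distribʳ v c d) (linComb-⊞ cs ds vs) ⟩
    (cv ⊕ dv) ⊕ (a ⊕ b) ≡⟨ R.+-assoc cv dv (a ⊕ b) ⟩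
    cv ⊕ (dv ⊕ (a ⊕ b)) ≡⟨ cong (cv ⊕_) (trans (sym (R.+-assoc dv a b)) (trans (cong (_⊕ b) (R.+-comm dv a)) (R.+-assoc a dv b))) ⟩
    cv ⊕ (a ⊕ (dv ⊕ b)) ≡⟨ R.+-assoc cv a (dv ⊕ b) ⟨
    (cv ⊕ a) ⊕ (dv ⊕ b) ∎
    where
    open ≡-Reasoning
    cv = c ⊗ v
    dv = d ⊗ v
    a = linComb F cs vs
    b = linComb F ds vs

  linComb-⊟ : ∀ {t} (cs vs : Vec Carrier t) → linComb F (⊟ cs) vs ≡ ⊖ linComb F cs vs
  linComb-⊟ []       []       = sym RP.-0#≈0#
  linComb-⊟ (c ∷ cs) (v ∷ vs) = trans (cong₂ _⊕_ (sym (RP.-‿distribˡ-* c v)) (linComb-⊟ cs vs)) (RP.-‿+-comm _ _)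

  linComb-0 : ∀ {t} (vs : Vec Carrier t) → linComb F (Vec.replicate t 0#) vs ≡ 0#
  linComb-0 []       = refl
  linComb-0 (v ∷ vs) = trans (cong₂ _⊕_ (R.zeroˡ v) (linComb-0 vs)) (R.+-identityʳ 0#)

  linComb-injective : ∀ {t} {vs : Vec Carrier t} → LinIndep F q vs → ∀ {cs ds} → AllFq cs → AllFq ds →
    linComb F cs vs ≡ linComb F ds vs → cs ≡ ds
  linComb-injective {vs = vs} indep {cs} {ds} hc hd e =
    equal cs ds (indep (cs ⊞ (⊟ ds)) (AllFq-⊞ hc (AllFq-⊟ hd)) (trans (linComb-⊞ cs (⊟ ds) vs)
      (trans (cong₂ _⊕_ e (linComb-⊟ ds vs)) (R.-‿inverseʳ (linComb F ds vs)))))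
    where
    equal : ∀ {t} (cs ds : Vec Carrier t) → VAll.All (_≡ 0#) (cs ⊞ (⊟ ds)) → cs ≡ ds
    equal []       []       []       = refl
    equal (c ∷ cs) (d ∷ ds) (z ∷ zs) = cong₂ _∷_ (RP.x∙y⁻¹≈ε⇒x≈y c d z) (equal cs ds zs)

  vecs : ∀ t → List (Vec Carrier t)
  vecs zero    = [] ∷ []
  vecs (suc t) = cartesianProductWith _∷_ Fq (vecs t)

  length-vecs : ∀ t → length (vecs t) ≡ q ^ t
  length-vecs zero    = refl
  length-vecs (suc t) = trans (length-cartesianProductWith _∷_ Fq (vecs t)) (cong₂ _*_ length-Fq (length-vecs t))

  vecs! : ∀ t → Unique (vecs t)
  vecs! zero    = [] ∷ []
  vecs! (suc t) = Unique.cartesianProductWith⁺ _∷_ ∷-injective Fq! (vecs! t)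

  ∈-vecs⁺ : ∀ {t} {cs : Vec Carrier t} → AllFq cs → cs ∈ vecs t
  ∈-vecs⁺ []       = here refl
  ∈-vecs⁺ (c ∷ cs) = ∈-cartesianProductWith⁺ _∷_ (∈Fq⁺ c) (∈-vecs⁺ cs)

  ∈-vecs⁻ : ∀ {t} {cs : Vec Carrier t} → cs ∈ vecs t → AllFq cs
  ∈-vecs⁻ {zero} {[]} _ = []
  ∈-vecs⁻ {suc t} m with ∈-cartesianProductWith⁻ _∷_ Fq (vecs t) m
  ... | c , cs , c∈ , cs∈ , refl = ∈Fq⁻ c∈ ∷ ∈-vecs⁻ cs∈

  module _ {t} {vs : Vec Carrier t} (indep : LinIndep F q vs) where

    span : List Carrier
    span = map (λ cs → linComb F cs vs) (vecs t)

    span? : Decidable (_∈ span)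
    span? x = Any.any? (x ≟_) span

    ∈-span⁺ : ∀ {cs} → AllFq cs → linComb F cs vs ∈ span
    ∈-span⁺ hc = ∈-map⁺ (λ cs → linComb F cs vs) (∈-vecs⁺ hc)

    ∈-span⁻ : ∀ {x} → x ∈ span → ∃ λ cs → AllFq cs × x ≡ linComb F cs vs
    ∈-span⁻ m = let (cs , cs∈ , e) = ∈-map⁻ (λ cs → linComb F cs vs) m in cs , ∈-vecs⁻ cs∈ , e

    span-0 : 0# ∈ span
    span-0 = subst (_∈ span) (linComb-0 vs) (∈-span⁺ (AllFq-0 t))

    span-⊕ : ∀ {x y} → x ∈ span → y ∈ span → x ⊕ y ∈ span
    span-⊕ x∈ y∈ with ∈-span⁻ x∈ | ∈-span⁻ y∈
    ... | cs , hc , refl | ds , hd , refl = subst (_∈ span) (linComb-⊞ cs ds vs) (∈-span⁺ (AllFq-⊞ hc hd))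

    span-⊖ : ∀ {x} → x ∈ span → ⊖ x ∈ span
    span-⊖ x∈ with ∈-span⁻ x∈
    ... | cs , hc , refl = subst (_∈ span) (linComb-⊟ cs vs) (∈-span⁺ (AllFq-⊟ hc))

    span-size : ∑F (⟦_⟧ ∘ span?) ≡ + (q ^ t)
    span-size = trans (count-⟦⟧ span? els! span! (λ m → complete _ , m) (λ _ m → m))
      (cong +_ (trans (length-map _ (vecs t)) (length-vecs t)))
      where
      span! : Unique span
      span! = map-unique (vecs! t) λ c∈ d∈ → linComb-injective indep (∈-vecs⁻ c∈) (∈-vecs⁻ d∈)

  module _ {t} {S : Carrier → Set} (affine : IsAffineSpace F q t S) where

    private
      u = proj₁ affine
      indep = proj₁ (proj₂ (proj₂ affine))

      V? : Decidable (_∈ span indep)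
      V? = span? indep

    affine⇒span : ∀ {x} → S x → x ⊕ ⊖ u ∈ span indep
    affine⇒span {x} Sx with proj₁ (proj₂ (proj₂ (proj₂ affine)) x) Sx
    ... | cs , hc , refl = subst (_∈ span indep) (sym (trans (cong (_⊕ ⊖ u) (R.+-comm u _)) (⊕-⊖-cancel _ u)))
      (∈-span⁺ indep hc)

    span⇒affine : ∀ {x} → x ⊕ ⊖ u ∈ span indep → S x
    span⇒affine {x} m = let (cs , hc , e) = ∈-span⁻ indep m in
      proj₂ (proj₂ (proj₂ (proj₂ affine)) x)
        (cs , hc , trans (sym (⊖-⊕-cancel x u)) (trans (R.+-comm _ u) (cong (u ⊕_) e)))

    affine? : Decidable S
    affine? x = map′ span⇒affine affine⇒span (V? (x ⊕ ⊖ u))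

    module _ (S? : Decidable S) where

      affine-∑ : ∑F (⟦_⟧ ∘ S?) ≡ ∑F (⟦_⟧ ∘ V?)
      affine-∑ = trans (∑-cong els (λ x → ⟦⟧-⇔ (S? x) (V? (x ⊕ ⊖ u)) affine⇒span span⇒affine))
        (∑F-shift (⊖ u) (⟦_⟧ ∘ V?))

      affine-size : ∑F (⟦_⟧ ∘ S?) ≡ + (q ^ t)
      affine-size = trans affine-∑ (span-size indep)

      affine-periodic : ∀ {b} → b ∈ span indep → ∀ x → ⟦ S? (x ⊕ b) ⟧ ≡ ⟦ S? x ⟧
      affine-periodic {b} b∈ x = ⟦⟧-⇔ (S? (x ⊕ b)) (S? x)
        (λ s → span⇒affine (subst (_∈ span indep) (trans (cong (_⊕ ⊖ b) (shift b)) (⊕-⊖-cancel (x ⊕ ⊖ u) b))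
          (span-⊕ indep (affine⇒span s) (span-⊖ indep b∈))))
        (λ s → span⇒affine (subst (_∈ span indep) (sym (shift b)) (span-⊕ indep (affine⇒span s) b∈)))
        where
        shift : ∀ b → (x ⊕ b) ⊕ ⊖ u ≡ (x ⊕ ⊖ u) ⊕ b
        shift b = trans (R.+-assoc x b (⊖ u)) (trans (cong (x ⊕_) (R.+-comm b (⊖ u))) (sym (R.+-assoc x (⊖ u) b)))

      module _ {D} (pfs : All PrimeFactor D) where

        affine-trivial-bound : ∣ ∑F (λ x → ⟦ S? x ⟧ *ᶻ T D x) ∣ ≤ Φ D * q ^ t
        affine-trivial-bound = ℤ.drop‿+≤+ (subst (+ ∣ ∑F (λ x → ⟦ S? x ⟧ *ᶻ T D x) ∣ ≤ᶻ_)
          (trans (cong (_*ᶻ + Φ D) affine-size)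
            (trans (sym (ℤ.pos-* (q ^ t) (Φ D))) (cong +_ (ℕ.*-comm (q ^ t) (Φ D)))))
          (∣∑∣≤ S? els (∣T∣≤ pfs)))

      -- The list of primes is nonempty because the kernel must have sum 0 over F; the sum of `T []`
      -- is N.
      affine-sqrt-bound : ∀ {r D} → All PrimeFactor (r ∷ D) → Unique (r ∷ D) →
        let s = ∑F (λ x → ⟦ S? x ⟧ *ᶻ T (r ∷ D) x) in
        ∣ s ∣ * ∣ s ∣ ≤ Φ (r ∷ D) * Φ (r ∷ D) * Q
      affine-sqrt-bound {r} {D} pfs D! = ℤ.drop‿+≤+ (subst₂ _≤ᶻ_ (abs-square s)
        (sym (trans (ℤ.pos-* (Φ (r ∷ D) * Φ (r ∷ D)) Q) (cong (_*ᶻ + Q) (ℤ.pos-* (Φ (r ∷ D)) (Φ (r ∷ D))))))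
        (total²≤φ²Q (T (r ∷ D)) (Φ (r ∷ D)) (Φ>0 (All.map proj₁ pfs)) (T-0 (r ∷ D)) (∑T≡0 pfs D!)
          (T-convolution pfs D!) (∑T² pfs D!) (⟦_⟧ ∘ S?) V? (span-0 indep) affine-periodic
          (⟦⟧-idem ∘ S?) affine-∑))
        where
        s = ∑F (λ x → ⟦ S? x ⟧ *ᶻ T (r ∷ D) x)
        abs-square : ∀ i → i *ᶻ i ≡ + (∣ i ∣ * ∣ i ∣)
        abs-square (+ m)         = sym (ℤ.pos-* m m)
        abs-square (ℤ.-[1+ m ]) = refl

-- Numerical estimates

-- For the list of prime divisors of n these are squarefree divisors of n. Their distinctness gives
-- the lower bound 2^ω for W(n).
subproducts : List ℕ → List ℕ
subproducts []      = 1 ∷ []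
subproducts (p ∷ L) = subproducts L ++ map (p *_) (subproducts L)

length-subproducts : ∀ L → length (subproducts L) ≡ 2 ^ length L
length-subproducts []      = refl
length-subproducts (p ∷ L) = begin
  length (subproducts L ++ map (p *_) (subproducts L)) ≡⟨ length-++ (subproducts L) ⟩
  length (subproducts L) + length (map (p *_) (subproducts L))
    ≡⟨ cong₂ _+_ (length-subproducts L) (trans (length-map (p *_) (subproducts L)) (length-subproducts L)) ⟩
  2 ^ length L + 2 ^ length L ≡⟨ cong (λ k → 2 ^ length L + k) (ℕ.+-identityʳ _) ⟨
  2 ^ length (p ∷ L) ∎
  where open ≡-Reasoning

subproduct-prime-∣ : ∀ {L} → All Prime L → ∀ {d r} → d ∈ subproducts L → Prime r → r ∣ d → r ∈ L
subproduct-prime-∣ {[]} _ (here refl) pr r∣1 = contradiction (∣⇒≤ r∣1) (ℕ.<⇒≱ (prime>1 pr))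
subproduct-prime-∣ {p ∷ L} (pp ∷ pps) {d} {r} d∈ pr r∣d with ∈-++⁻ (subproducts L) d∈
... | inj₁ d∈L = there (subproduct-prime-∣ pps d∈L pr r∣d)
... | inj₂ m with ∈-map⁻ (p *_) m
...   | d′ , d′∈ , refl with euclidsLemma p d′ pr r∣d
...     | inj₁ r∣p  = here (primes-∣⇒≡ pr pp r∣p)
...     | inj₂ r∣d′ = there (subproduct-prime-∣ pps d′∈ pr r∣d′)

-- Let d = p d′. If r = p, then p would divide d′, whose prime factors lie in L, where p does not
-- occur. If r ≠ p, coprimality moves r² from p d′ into d′.
subproduct-squarefree : ∀ {L} → All Prime L → Unique L → ∀ {d r} → d ∈ subproducts L → Prime r → ¬ r * r ∣ d
subproduct-squarefree {[]} _ _ {_} {r} (here refl) pr h =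
  contradiction (∣⇒≤ (∣.∣-trans (∣.m∣m*n r) h)) (ℕ.<⇒≱ (prime>1 pr))
subproduct-squarefree {p ∷ L} (pp ∷ pps) (p∉ ∷ L!) {d} {r} d∈ pr h with ∈-++⁻ (subproducts L) d∈
... | inj₁ d∈L = subproduct-squarefree pps L! d∈L pr h
... | inj₂ m with ∈-map⁻ (p *_) m
...   | d′ , d′∈ , refl with r ℕ.≟ p
...     | yes refl = contradiction refl (All.lookup p∉ (subproduct-prime-∣ pps d′∈ pp
  (∣.*-cancelˡ-∣ p ⦃ prime⇒nonZero pp ⦄ h)))
-- The factor r is extracted twice: first d′ = c r, then r ∣ p c forces r ∣ c.
...     | no r≢p with coprime-divisor {r} {p} {d′} r⊥p (∣.∣-trans (∣.m∣m*n r) h)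
  where
  r⊥p : Coprime r p
  r⊥p = prime∤⇒coprime pr (r≢p ∘ primes-∣⇒≡ pr pp)
...       | divides c refl = subproduct-squarefree pps L! d′∈ pr (∣.*-monoˡ-∣ r (coprime-divisor {r} {p} {c}
  (prime∤⇒coprime pr (r≢p ∘ primes-∣⇒≡ pr pp))
  (∣.*-cancelʳ-∣ r ⦃ prime⇒nonZero pr ⦄ (subst (r * r ∣_) (sym (ℕ.*-assoc p c r)) h))))

subproducts! : ∀ {L} → All Prime L → Unique L → Unique (subproducts L)
subproducts! {[]} _ _ = [] ∷ []
subproducts! {p ∷ L} (pp ∷ pps) (p∉ ∷ L!) = Unique.++⁺ (subproducts! pps L!)
  (Unique.map⁺ (λ {x} {y} → ℕ.*-cancelˡ-≡ x y p ⦃ prime⇒nonZero pp ⦄) (subproducts! pps L!))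
  λ (d∈ , m) → let (d′ , _ , e) = ∈-map⁻ (p *_) m in
    contradiction refl (All.lookup p∉ (subproduct-prime-∣ pps d∈ pp (divides d′ (trans e (ℕ.*-comm p d′)))))

-- Write n = c d′. The prime p divides n but not d′, so it divides c, and p d′ divides n.
subproduct-∣ : ∀ {n L} → All (λ p → Prime p × p ∣ n) L → Unique L → ∀ {d} → d ∈ subproducts L → d ∣ n
subproduct-∣ {L = []} _ _ (here refl) = ∣.1∣ _
subproduct-∣ {n} {p ∷ L} ((pp , p∣n) ∷ pfs) (p∉ ∷ L!) d∈ with ∈-++⁻ (subproducts L) d∈
... | inj₁ d∈L = subproduct-∣ pfs L! d∈L
... | inj₂ m with ∈-map⁻ (p *_) m
...   | d′ , d′∈ , refl with subproduct-∣ pfs L! d′∈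
...     | divides c refl = subst (p * d′ ∣_) (refl {x = c * d′}) (∣.*-monoˡ-∣ d′
  (coprime-divisor {p} {d′} {c} (prime∤⇒coprime pp (λ p∣d′ →
    All.lookup p∉ (subproduct-prime-∣ (All.map proj₁ pfs) d′∈ pp p∣d′) refl))
    (subst (p ∣_) (ℕ.*-comm c d′) p∣n)))

subproduct-squarefreeᵇ : ∀ {L} → All Prime L → Unique L → ∀ {d} → d ∈ subproducts L → IsTrue (squarefreeᵇ d)
subproduct-squarefreeᵇ pps L! {d} d∈ =
  All.all⁻ (λ e → not (does ((e * e) ∣? d))) {xs = map (λ i → 2 + i) (upTo d)} (All.tabulate λ m →
    not-square (proj₂ (proj₂ (∈-map⁻ (λ i → 2 + i) m))))
  where
  not-square : ∀ {e j} → e ≡ 2 + j → IsTrue (not (does ((e * e) ∣? d)))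
  not-square {e} refl = Equivalence.from T-≡ (cong not (dec-false (e * e ∣? d) λ h →
    let (r , pr , r∣e) = ∃-prime-divisor {e} (s≤s (s≤s z≤n)) in
    subproduct-squarefree pps L! d∈ pr (∣.∣-trans (∣.*-pres-∣ r∣e r∣e) h)))

2^≤W : ∀ {n} → 0 < n → 2 ^ length (primeDivisors n) ≤ W n
2^≤W {n} n>0 = subst (_≤ W n) (length-subproducts L) (unique-⊆-length (subproducts! pps L!)
  λ {d} d∈ → ∈-filter⁺ (λ d → T? (does (d ∣? n) ∧ squarefreeᵇ d))
    (∈-range1⁺ (d>0 (d∣n d∈)) (∣⇒≤ ⦃ >-nonZero n>0 ⦄ (d∣n d∈)))
    (Equivalence.from T-∧ (Equivalence.from T-≡ (dec-true (d ∣? n) (d∣n d∈)) , subproduct-squarefreeᵇ pps L! d∈)))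
  where
  L = primeDivisors n
  L! = primeDivisors! n
  pfs : All (λ p → Prime p × p ∣ n) L
  pfs = All.tabulate (∈-primeDivisors⁻ {n})
  pps = All.map proj₁ pfs
  d∣n : ∀ {d} → d ∈ subproducts L → d ∣ n
  d∣n = subproduct-∣ pfs L!
  d>0 : ∀ {d} → d ∣ n → 0 < d
  d>0 {zero}  (divides c e) = contradiction (trans e (ℕ.*-zeroʳ c)) (ℕ.>⇒≢ n>0)
  d>0 {suc d} _             = s≤s z≤n

-- Finite sums of naturals and the constant δ(q, n)

Σ< : ℕ → (ℕ → ℕ) → ℕ
Σ< zero    f = 0
Σ< (suc n) f = f 0 + Σ< n (f ∘ suc)

sumBelow≡Σ< : ∀ n f → sumBelow n f ≡ Σ< n f
sumBelow≡Σ< n f = go n id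
  where
  -- `upTo n` is `applyUpTo id n`, and passing to the tail composes the enumeration with `suc`;
  -- hence the induction over all h.
  go : ∀ n h → foldr (λ i acc → f i + acc) 0 (applyUpTo h n) ≡ Σ< n (f ∘ h)
  go zero    h = refl
  go (suc n) h = cong (λ k → f (h 0) + k) (go n (h ∘ suc))

Σ<-cong : ∀ n {f g : ℕ → ℕ} → (∀ i → i < n → f i ≡ g i) → Σ< n f ≡ Σ< n g
Σ<-cong zero    e = refl
Σ<-cong (suc n) e = cong₂ _+_ (e 0 (s≤s z≤n)) (Σ<-cong n (λ i i<n → e (suc i) (s≤s i<n)))

Σ<-+ : ∀ n f g → Σ< n (λ i → f i + g i) ≡ Σ< n f + Σ< n g
Σ<-+ zero    f g = refl
Σ<-+ (suc n) f g = trans (cong (λ k → f 0 + g 0 + k) (Σ<-+ n (f ∘ suc) (g ∘ suc)))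
  (+ℕ.interchange (f 0) (g 0) (Σ< n (f ∘ suc)) (Σ< n (g ∘ suc)))

Σ<-last : ∀ n f → Σ< (suc n) f ≡ Σ< n f + f n
Σ<-last zero    f = ℕ.+-comm (f 0) 0
Σ<-last (suc n) f = trans (cong (λ k → f 0 + k) (Σ<-last n (f ∘ suc))) (sym (ℕ.+-assoc (f 0) _ _))

-- The bound produced by inclusion–exclusion over m hyperplanes when an
-- intersection of dimension i contributes at most H i.
pascal : (ℕ → ℕ) → ℕ → ℕ → ℕ
pascal H zero    s = H s
pascal H (suc m) s = pascal H m (suc s) + pascal H m s

-- Pascal's rule merges the two sums termwise once the second one is padded by its vanishing term i
-- = m + 1.
pascal≡Σ< : ∀ H m s → pascal H m s ≡ Σ< (suc m) (λ i → (m C i) * H (s + i))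
pascal≡Σ< H zero    s = sym (trans (ℕ.+-identityʳ _) (trans (ℕ.*-identityˡ _) (cong H (ℕ.+-identityʳ s))))
pascal≡Σ< H (suc m) s = begin
  pascal H m (suc s) + pascal H m s
    ≡⟨ cong₂ _+_ (trans (pascal≡Σ< H m (suc s)) (Σ<-cong (suc m) (λ i _ → cong (λ j → (m C i) * H j) (sym (ℕ.+-suc s i)))))
         (trans (pascal≡Σ< H m s) (sym top)) ⟩
  Σ< (suc m) low + (h + Σ< (suc m) high) ≡⟨ +ℕ.x∙yz≈y∙xz (Σ< (suc m) low) h (Σ< (suc m) high) ⟩
  h + (Σ< (suc m) low + Σ< (suc m) high) ≡⟨ cong (λ k → h + k) (Σ<-+ (suc m) low high) ⟨
  h + Σ< (suc m) (λ i → low i + high i) ≡⟨ cong (λ k → h + k) (Σ<-cong (suc m) (λ i _ →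
    trans (sym (ℕ.*-distribʳ-+ (H (s + suc i)) (m C i) (m C suc i)))
      (cong (_* H (s + suc i)) (nCk+nC[k+1]≡[n+1]C[k+1] m i)))) ⟩
  h + Σ< (suc m) (λ i → (suc m C suc i) * H (s + suc i)) ∎
  where
  open ≡-Reasoning
  h = 1 * H (s + 0)
  low high : ℕ → ℕ
  low  i = (m C i) * H (s + suc i)
  high i = (m C suc i) * H (s + suc i)
  top : h + Σ< (suc m) high ≡ Σ< (suc m) (λ i → (m C i) * H (s + i))
  top = trans (Σ<-last (suc m) (λ i → (m C i) * H (s + i)))
    (trans (cong (λ c → Σ< (suc m) (λ i → (m C i) * H (s + i)) + c * H (s + suc m)) (k>n⇒nCk≡0 {m} {suc m} (ℕ.n<1+n m)))
      (ℕ.+-identityʳ _))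

-- The summand i = n belongs to the empty intersection, the whole field, where a nontrivial
-- character sum is 0. That is why δ stops at n - 1 and H n = 0 is assumed.
pascal≡sumBelow : ∀ H n → H n ≡ 0 → pascal H n 0 ≡ sumBelow n (λ i → (n C i) * H i)
pascal≡sumBelow H n Hn = begin
  pascal H n 0 ≡⟨ pascal≡Σ< H n 0 ⟩
  Σ< (suc n) f ≡⟨ Σ<-last n f ⟩
  Σ< n f + (n C n) * H n ≡⟨ cong (λ h → Σ< n f + (n C n) * h) Hn ⟩
  Σ< n f + (n C n) * 0 ≡⟨ cong (λ k → Σ< n f + k) (ℕ.*-zeroʳ (n C n)) ⟩
  Σ< n f + 0 ≡⟨ ℕ.+-identityʳ (Σ< n f) ⟩
  Σ< n f ≡⟨ sumBelow≡Σ< n f ⟨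
  sumBelow n f ∎
  where
  open ≡-Reasoning
  f : ℕ → ℕ
  f i = (n C i) * H i

module _ (q n : ℕ) where

  -- The two parts of q^min{i, n/2} for i < n: the trivial bound q^i if 2i ≤ n, and otherwise the
  -- coefficient 1 of √Q. Both are 0 from i = n on.
  rational irrational : ℕ → ℕ
  rational   i = if does (i <? n) then (if does (2 * i ≤? n) then q ^ i else 0) else 0
  irrational i = if does (i <? n) then (if does (2 * i ≤? n) then 0 else 1) else 0

  private
    at-n : (f : ℕ → ℕ) → (if does (n <? n) then f n else 0) ≡ 0
    at-n f = cong (λ b → if b then f n else 0) (dec-false (n <? n) (ℕ.<-irrefl refl))

    below : ∀ i → i < n → ∀ c → (if does (i <? n) then c else 0) ≡ c
    below i i<n c = cong (λ b → if b then c else 0) (dec-true (i <? n) i<n)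

  pascal-rational : pascal rational n 0 ≡ δRat q n
  pascal-rational = trans
    (pascal≡sumBelow rational n (at-n (λ i → if does (2 * i ≤? n) then q ^ i else 0))) (trans (sumBelow≡Σ< n _)
    (trans (Σ<-cong n λ i i<n → trans (cong ((n C i) *_) (below i i<n _)) (push (does (2 * i ≤? n)) (n C i) (q ^ i)))
      (sym (sumBelow≡Σ< n _))))
    where
    push : ∀ b c x → c * (if b then x else 0) ≡ (if b then c * x else 0)
    push true  c x = refl
    push false c x = ℕ.*-zeroʳ c

  pascal-irrational : pascal irrational n 0 ≡ δIrr n
  pascal-irrational = trans
    (pascal≡sumBelow irrational n (at-n (λ i → if does (2 * i ≤? n) then 0 else 1))) (trans (sumBelow≡Σ< n _)
    (trans (Σ<-cong n λ i i<n → trans (cong ((n C i) *_) (below i i<n _)) (push (does (2 * i ≤? n)) (n C i)))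
      (sym (sumBelow≡Σ< n _))))
    where
    push : ∀ b c → c * (if b then 0 else 1) ≡ (if b then 0 else c)
    push true  c = ℕ.*-zeroʳ c
    push false c = ℕ.*-identityʳ c

-- The terms i = 0 and i = 1 suffice; n ≥ 2 is what places i = 1 among the terms with 2i ≤ n.
2≤δRat : ∀ {q n} → 0 < q → 2 ≤ n → 2 ≤ δRat q n
2≤δRat {q} {n@(suc (suc m))} q>0 2≤n@(s≤s (s≤s _)) = begin
  2 ≤⟨ s≤s (ℕ.*-mono-≤ {1} {n} (s≤s z≤n) (ℕ.*-mono-≤ {1} {q} {1} q>0 ℕ.≤-refl)) ⟩
  1 + n * q ^ 1 ≡⟨ cong suc term₁ ⟨
  f 0 + f 1 ≤⟨ ℕ.+-monoʳ-≤ (f 0) (ℕ.m≤m+n (f 1) _) ⟩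
  Σ< n f ≡⟨ sumBelow≡Σ< n f ⟨
  δRat q n ∎
  where
  open ℕ.≤-Reasoning
  f : ℕ → ℕ
  f i = if does (2 * i ≤? n) then (n C i) * q ^ i else 0
  term₁ : f 1 ≡ n * q ^ 1
  term₁ = trans (cong (λ b → if b then (n C 1) * q ^ 1 else 0) (dec-true (2 ≤? n) 2≤n))
    (cong (_* q ^ 1) (nC1≡n n))

-- Arithmetic of bounds a + c √Q

m²≤n²⇒m≤n : ∀ {m n} → m * m ≤ n * n → m ≤ n
m²≤n²⇒m≤n {m} {n} h with m ≤? n
... | yes m≤n = m≤n
... | no m≰n  = contradiction h (ℕ.<⇒≱ (ℕ.*-mono-< (ℕ.≰⇒> m≰n) (ℕ.≰⇒> m≰n)))

module Estimates (Q : ℕ) where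

  infix 4 ∣_∣≤_+_√Q
  -- |v| ≤ a + c √Q, with y standing for the part bounded by c √Q.
  record ∣_∣≤_+_√Q (v : ℤ) (a c : ℕ) : Set where
    constructor estimate
    field
      y     : ℕ
      ∣v∣≤  : ∣ v ∣ ≤ a + y
      y²≤   : y * y ≤ c * c * Q

  estimate-cong : ∀ {v w a b c d} → v ≡ w → a ≡ b → c ≡ d → ∣ v ∣≤ a + c √Q → ∣ w ∣≤ b + d √Q
  estimate-cong refl refl refl e = e

  estimate-0 : ∀ {a c} → ∣ 0ℤ ∣≤ a + c √Q
  estimate-0 = estimate 0 z≤n z≤n

  -- The parts below c √Q and d √Q are added. Only the cross term of the square needs an argument: y
  -- z ≤ c d Q follows by comparing squares, so no root is taken.
  estimate-minus : ∀ {v w a b c d} → ∣ v ∣≤ a + c √Q → ∣ w ∣≤ b + d √Q → ∣ v -ᶻ w ∣≤ (a + b) + (c + d) √Q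
  estimate-minus {v} {w} {a} {b} {c} {d} (estimate y hv hy) (estimate z hw hz) = estimate (y + z)
    (begin
      ∣ v -ᶻ w ∣ ≤⟨ ℤ.∣i-j∣≤∣i∣+∣j∣ v w ⟩
      ∣ v ∣ + ∣ w ∣ ≤⟨ ℕ.+-mono-≤ hv hw ⟩
      (a + y) + (b + z) ≡⟨ +ℕ.interchange a y b z ⟩
      (a + b) + (y + z) ∎)
    (begin
      (y + z) * (y + z) ≡⟨ square y z ⟩
      (y * y + z * z) + 2 * (y * z) ≤⟨ ℕ.+-mono-≤ (ℕ.+-mono-≤ hy hz) (ℕ.*-monoʳ-≤ 2 (m²≤n²⇒m≤n {y * z} {c * d * Q} cross)) ⟩
      (c * c * Q + d * d * Q) + 2 * (c * d * Q) ≡⟨ square′ c d Q ⟩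
      (c + d) * (c + d) * Q ∎)
    where
    open ℕ.≤-Reasoning
    square : ∀ y z → (y + z) * (y + z) ≡ (y * y + z * z) + 2 * (y * z)
    square = solveℕ
    square′ : ∀ c d q → (c * c * q + d * d * q) + 2 * (c * d * q) ≡ (c + d) * (c + d) * q
    square′ = solveℕ
    regroup : ∀ y z → (y * z) * (y * z) ≡ (y * y) * (z * z)
    regroup = solveℕ
    regroup′ : ∀ c d q → (c * c * q) * (d * d * q) ≡ (c * d * q) * (c * d * q)
    regroup′ = solveℕ
    cross : (y * z) * (y * z) ≤ (c * d * Q) * (c * d * Q)
    cross = begin
      (y * z) * (y * z) ≡⟨ regroup y z ⟩
      (y * y) * (z * z) ≤⟨ ℕ.*-mono-≤ hy hz ⟩
      (c * c * Q) * (d * d * Q) ≡⟨ regroup′ c d Q ⟩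
      (c * d * Q) * (c * d * Q) ∎

  estimate-* : ∀ k {v a c} → ∣ v ∣≤ a + c √Q → ∣ + k *ᶻ v ∣≤ (k * a) + (k * c) √Q
  estimate-* k {v} {a} {c} (estimate y hv hy) = estimate (k * y)
    (begin
      ∣ + k *ᶻ v ∣ ≡⟨ ℤ.abs-* (+ k) v ⟩
      k * ∣ v ∣ ≤⟨ ℕ.*-monoʳ-≤ k hv ⟩
      k * (a + y) ≡⟨ ℕ.*-distribˡ-+ k a y ⟩
      k * a + k * y ∎)
    (begin
      (k * y) * (k * y) ≡⟨ regroup k y ⟩
      (k * k) * (y * y) ≤⟨ ℕ.*-monoʳ-≤ (k * k) hy ⟩
      (k * k) * (c * c * Q) ≡⟨ regroup′ k c Q ⟩
      (k * c) * (k * c) * Q ∎)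
    where
    open ℕ.≤-Reasoning
    regroup : ∀ k y → (k * y) * (k * y) ≡ (k * k) * (y * y)
    regroup = solveℕ
    regroup′ : ∀ k c q → (k * k) * (c * c * q) ≡ (k * c) * (k * c) * q
    regroup′ = solveℕ

-- With f π = θ N the estimate for π P turns into one for N P; the slack term θ
-- is absorbed because the error is counted e < w times and δ ≥ 2.
final-estimate : ∀ {f π θ N G P δ i w e y Q} → f * π ≡ θ * N → 0 < θ → 0 < N → 0 < π → 2 ≤ δ → e < w →
  θ * G ≤ π * P + (θ * e * δ + y) + θ → y * y ≤ (θ * e * i) * (θ * e * i) * Q →
  LtSqrt (+ (f * G) -ᶻ + (f * δ * w + N * P)) (f * i * w) Q
final-estimate {f} {π} {θ} {N} {G} {P} {δ} {i} {w} {e} {y} {Q} fπ θ>0 N>0 π>0 2≤δ e<w hG hy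
  with f * G <? f * δ * w + N * P
... | yes lt = inj₁ (subst (ℤ._< 0ℤ) (sym (ℤ.m-n≡m⊖n (f * G) B))
  (subst (f * G ℤ.⊖ B ℤ.<_) (ℤ.n⊖n≡0 B) (ℤ.⊖-monoˡ-< B lt)))
  where B = f * δ * w + N * P
... | no ≮ = inj₂ (subst (λ m → m * m < (f * i * w) * (f * i * w) * Q) (sym abs-x) square-bound)
  where
  B = f * δ * w + N * P
  X = f * G ∸ B
  X+B : X + B ≡ f * G
  X+B = ℕ.m∸n+n≡m (ℕ.≮⇒≥ ≮)
  abs-x : ∣ + (f * G) -ᶻ + B ∣ ≡ X
  abs-x = cong ∣_∣ (trans (ℤ.m-n≡m⊖n (f * G) B) (ℤ.⊖-≥ (ℕ.≮⇒≥ ≮)))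
  open ℕ.≤-Reasoning
  E = N * (π * P) + N * (θ * e * δ)
  expand : ∀ π X f δ w N P → π * X + (π * f * δ * w + N * (π * P)) ≡ π * (X + (f * δ * w + N * P))
  expand = solveℕ
  πfG : π * (f * G) ≡ N * (θ * G)
  πfG = trans (swap π f G) (trans (cong (_* G) fπ) (swap′ θ N G))
    where
    swap : ∀ π f G → π * (f * G) ≡ f * π * G
    swap = solveℕ
    swap′ : ∀ θ N G → θ * N * G ≡ N * (θ * G)
    swap′ = solveℕ
  distribute : ∀ N a b y t → N * (a + (b + y) + t) ≡ (N * a + N * b) + (N * y + N * t)
  distribute = solveℕ
  -- From e + 1 ≤ w and δ ≥ 2 the spare error term is worth two units N θ: one cancels the slack θ
  -- in `hG`, the other makes the final inequality strict.
  lower : E + (N * θ + N * θ) ≤ π * f * δ * w + N * (π * P)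
  lower = begin
    N * (π * P) + N * (θ * e * δ) + (N * θ + N * θ) ≡⟨ collect N (π * P) θ e δ ⟩
    N * (π * P) + θ * N * (e * δ + 2) ≤⟨ ℕ.+-monoʳ-≤ (N * (π * P)) (ℕ.*-monoʳ-≤ (θ * N) (begin
      e * δ + 2 ≤⟨ ℕ.+-monoʳ-≤ (e * δ) 2≤δ ⟩
      e * δ + δ ≡⟨ ℕ.+-comm (e * δ) δ ⟩
      suc e * δ ≤⟨ ℕ.*-monoˡ-≤ δ e<w ⟩
      w * δ ∎)) ⟩
    N * (π * P) + θ * N * (w * δ) ≡⟨ cong (λ z → N * (π * P) + z * (w * δ)) (sym fπ) ⟩
    N * (π * P) + f * π * (w * δ) ≡⟨ reorder (N * (π * P)) f π w δ ⟩
    π * f * δ * w + N * (π * P) ∎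
    where
    collect : ∀ N a θ e δ → N * a + N * (θ * e * δ) + (N * θ + N * θ) ≡ N * a + θ * N * (e * δ + 2)
    collect = solveℕ
    reorder : ∀ a f π w δ → a + f * π * (w * δ) ≡ π * f * δ * w + a
    reorder = solveℕ
  πX+Nθ≤Ny : π * X + N * θ ≤ N * y
  πX+Nθ≤Ny = ℕ.+-cancelʳ-≤ (E + N * θ) _ _ (begin
    π * X + N * θ + (E + N * θ) ≡⟨ shuffle (π * X) (N * θ) E ⟩
    π * X + (E + (N * θ + N * θ)) ≤⟨ ℕ.+-monoʳ-≤ (π * X) lower ⟩
    π * X + (π * f * δ * w + N * (π * P)) ≡⟨ expand π X f δ w N P ⟩
    π * (X + B) ≡⟨ cong (π *_) X+B ⟩
    π * (f * G) ≡⟨ πfG ⟩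
    N * (θ * G) ≤⟨ ℕ.*-monoʳ-≤ N hG ⟩
    N * (π * P + (θ * e * δ + y) + θ) ≡⟨ distribute N (π * P) (θ * e * δ) y θ ⟩
    E + (N * y + N * θ) ≡⟨ +ℕ.x∙yz≈y∙xz E (N * y) (N * θ) ⟩
    N * y + (E + N * θ) ∎)
    where
    shuffle : ∀ a b c → a + b + (c + b) ≡ a + (c + (b + b))
    shuffle = solveℕ
  πX<Ny : π * X < N * y
  πX<Ny = ℕ.<-≤-trans (ℕ.m<m+n (π * X) (ℕ.*-mono-≤ N>0 θ>0)) πX+Nθ≤Ny
  square-bound : X * X < (f * i * w) * (f * i * w) * Q
  square-bound = ℕ.*-cancelˡ-< (π * π) (X * X) _ (begin-strict
    π * π * (X * X) ≡⟨ regroup π X ⟩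
    (π * X) * (π * X) <⟨ ℕ.*-mono-< πX<Ny πX<Ny ⟩
    (N * y) * (N * y) ≡⟨ regroup N y ⟨
    N * N * (y * y) ≤⟨ ℕ.*-monoʳ-≤ (N * N) hy ⟩
    N * N * ((θ * e * i) * (θ * e * i) * Q)
      ≤⟨ ℕ.*-monoʳ-≤ (N * N) (ℕ.*-monoˡ-≤ Q (ℕ.*-mono-≤ θei≤θwi θei≤θwi)) ⟩
    N * N * ((θ * w * i) * (θ * w * i) * Q) ≡⟨ pull N θ w i Q ⟩
    (θ * N) * (θ * N) * ((w * i) * (w * i) * Q) ≡⟨ cong (λ z → z * z * ((w * i) * (w * i) * Q)) fπ ⟨
    (f * π) * (f * π) * ((w * i) * (w * i) * Q) ≡⟨ pull′ f π w i Q ⟩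
    π * π * ((f * i * w) * (f * i * w) * Q) ∎)
    where
    θei≤θwi : θ * e * i ≤ θ * w * i
    θei≤θwi = ℕ.*-monoˡ-≤ i (ℕ.*-monoʳ-≤ θ (ℕ.<⇒≤ e<w))
    regroup : ∀ a b → a * a * (b * b) ≡ (a * b) * (a * b)
    regroup = solveℕ
    pull : ∀ N θ w i Q → N * N * ((θ * w * i) * (θ * w * i) * Q) ≡ (θ * N) * (θ * N) * ((w * i) * (w * i) * Q)
    pull = solveℕ
    pull′ : ∀ f π w i Q → (f * π) * (f * π) * ((w * i) * (w * i) * Q) ≡ π * π * ((f * i * w) * (f * i * w) * Q)
    pull′ = solveℕ

-- Hyperplane arrangements

lookup-injective : {A : Set} {xs : List A} → Unique xs → ∀ {i j} → lookup xs i ≡ lookup xs j → i ≡ j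
lookup-injective (x∉ ∷ u) {zero}  {zero}  e = refl
lookup-injective {xs = x ∷ xs} (x∉ ∷ u) {zero}  {suc j} e = contradiction e (All.lookup x∉ (∈-lookup {xs = xs} j))
lookup-injective {xs = x ∷ xs} (x∉ ∷ u) {suc i} {zero}  e = contradiction (sym e) (All.lookup x∉ (∈-lookup {xs = xs} i))
lookup-injective (x∉ ∷ u) {suc i} {suc j} e = cong suc (lookup-injective u e)

module Arrangement (F : Field) (els : List (Field.Carrier F)) (els! : Unique els)
  (complete : ∀ x → x ∈ els) (p k n : ℕ) (pr : Prime p) (1≤k : 1 ≤ k) (card : length els ≡ (p ^ k) ^ n)
  (A : Fin n → Field.Carrier F → Set)
  (hyperplane : ∀ i → IsAffineHyperplane F (p ^ k) n (A i))
  (general : GeneralPosition F (p ^ k) n A) where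
  open AffineSpaces F els els! complete p k n pr 1≤k card
  open Estimates Q

  A? : ∀ i → Decidable (A i)
  A? i = affine? (hyperplane i)

  Inside Outside : List (Fin n) → Carrier → Set
  Inside  l x = All (λ i → A i x) l
  Outside L x = All (λ i → ¬ A i x) L

  inside? : ∀ l → Decidable (Inside l)
  inside? l x = All.all? (λ i → A? i x) l

  outside? : ∀ L → Decidable (Outside L)
  outside? L x = All.all? (λ i → ¬? (A? i x)) L

  -- General position speaks of injective index maps; `lookup l` is such a map because l has no
  -- duplicates.
  inside-affine : ∀ {l} → Unique l → 0 < length l → IsAffineSpace F q (n ∸ length l) (Inside l)
  inside-affine {l} l! l>0 with general (length l) l>0
    (ℕ.≤-trans (unique-⊆-length l! (λ {i} _ → ∈-allFin i)) (ℕ.≤-reflexive (length-tabulate {n = n} id)))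
    (lookup l) (lookup-injective l!)
  ... | u , vs , indep , S⇔ = u , vs , indep , λ x →
    (λ inside → proj₁ (S⇔ x) (λ i → All.lookup inside (∈-lookup {xs = l} i))) ,
    (λ h → All.tabulate λ {i} i∈ → subst (λ j → A j x) (sym (Any.lookup-index i∈)) (proj₂ (S⇔ x) h (Any.index i∈)))

  -- A stage of inclusion-exclusion: the hyperplanes in L are still to be avoided, those in l have
  -- been intersected.
  restricted : (Carrier → ℤ) → List (Fin n) → List (Fin n) → ℤ
  restricted f L l = ∑F λ x → ⟦ outside? L x ⟧ *ᶻ (⟦ inside? l x ⟧ *ᶻ f x)

  restricted-[] : ∀ f l → restricted f [] l ≡ ∑F (λ x → ⟦ inside? l x ⟧ *ᶻ f x)
  restricted-[] f l = ∑-cong els (λ x → ℤ.*-identityˡ _)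

  restricted-step : ∀ f i L l → restricted f (i ∷ L) l ≡ restricted f L l -ᶻ restricted f L (i ∷ l)
  restricted-step f i L l = trans (∑-cong els pointwise) (∑-minus els _ _)
    where
    pointwise : ∀ x → ⟦ outside? (i ∷ L) x ⟧ *ᶻ (⟦ inside? l x ⟧ *ᶻ f x) ≡
      ⟦ outside? L x ⟧ *ᶻ (⟦ inside? l x ⟧ *ᶻ f x) -ᶻ ⟦ outside? L x ⟧ *ᶻ (⟦ inside? (i ∷ l) x ⟧ *ᶻ f x)
    pointwise x = begin
      ⟦ outside? (i ∷ L) x ⟧ *ᶻ (⟦ inside? l x ⟧ *ᶻ f x)
        ≡⟨ cong (_*ᶻ (⟦ inside? l x ⟧ *ᶻ f x))
             (trans (⟦⟧-× (¬? (A? i x)) (outside? L x)) (cong (_*ᶻ ⟦ outside? L x ⟧) (⟦⟧-¬ (A? i x)))) ⟩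
      ((1ℤ -ᶻ ⟦ A? i x ⟧) *ᶻ ⟦ outside? L x ⟧) *ᶻ (⟦ inside? l x ⟧ *ᶻ f x)
        ≡⟨ expand ⟦ A? i x ⟧ ⟦ outside? L x ⟧ ⟦ inside? l x ⟧ (f x) ⟩
      ⟦ outside? L x ⟧ *ᶻ (⟦ inside? l x ⟧ *ᶻ f x) -ᶻ ⟦ outside? L x ⟧ *ᶻ ((⟦ A? i x ⟧ *ᶻ ⟦ inside? l x ⟧) *ᶻ f x)
        ≡⟨ cong (λ z → ⟦ outside? L x ⟧ *ᶻ (⟦ inside? l x ⟧ *ᶻ f x) -ᶻ ⟦ outside? L x ⟧ *ᶻ (z *ᶻ f x))
             (⟦⟧-× (A? i x) (inside? l x)) ⟨
      ⟦ outside? L x ⟧ *ᶻ (⟦ inside? l x ⟧ *ᶻ f x) -ᶻ ⟦ outside? L x ⟧ *ᶻ (⟦ inside? (i ∷ l) x ⟧ *ᶻ f x) ∎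
      where
      open ≡-Reasoning
      expand : ∀ a o c f → ((1ℤ -ᶻ a) *ᶻ o) *ᶻ (c *ᶻ f) ≡ o *ᶻ (c *ᶻ f) -ᶻ o *ᶻ ((a *ᶻ c) *ᶻ f)
      expand = solveℤ

  Picked : List (Fin n) → List (Fin n) → Set
  Picked = Split (λ _ → ⊤)

  picked : Picked (allFin n) []
  picked = split (Unique.allFin⁺ n) [] (All.tabulate _) [] (All.tabulate λ _ → [])

  -- The invariant makes s the dimension left when all of L and l are intersected. One step of
  -- inclusion-exclusion turns the factor q^(s+1) - q^s into (q - 1) q^s, so the count is exact.
  restricted-1 : ∀ L l {s} → Picked L l → s + length L + length l ≡ n →
    restricted (λ _ → 1ℤ) L l ≡ + ((q ∸ 1) ^ length L * q ^ s)
  restricted-1 [] l {s} pk e = trans (restricted-[] _ l) (trans (∑-cong els (λ x → ℤ.*-identityʳ _))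
    (trans (base l (Split.right! pk) e) (cong +_ (sym (ℕ.*-identityˡ (q ^ s))))))
    where
    base : ∀ l → Unique l → s + 0 + length l ≡ n → ∑F (λ x → ⟦ inside? l x ⟧) ≡ + (q ^ s)
    -- The empty intersection is F itself; general position covers only k ≥ 1, so its size comes
    -- from the cardinality.
    base [] _ e = trans (∑-const els 1ℤ) (trans (ℤ.*-identityʳ (+ Q)) (cong +_ (trans card
      (cong (q ^_) (trans (sym e) (trans (ℕ.+-identityʳ (s + 0)) (ℕ.+-identityʳ s)))))))
    base l@(i ∷ _) l! e = trans (affine-size (inside-affine l! (s≤s z≤n)) (inside? l))
      (cong (λ j → + (q ^ j)) (trans (cong (_∸ length l) (sym e))
        (trans (ℕ.m+n∸n≡m (s + 0) (length l)) (ℕ.+-identityʳ s))))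
  restricted-1 (i ∷ L) l {s} pk e = begin
    restricted _ (i ∷ L) l ≡⟨ restricted-step _ i L l ⟩
    restricted _ L l -ᶻ restricted _ L (i ∷ l)
      ≡⟨ cong₂ _-ᶻ_ (restricted-1 L l (dropHead pk) (trans (cong (_+ length l) (sym (ℕ.+-suc s (length L)))) e))
           (restricted-1 L (i ∷ l) (moveHead pk) (trans (shift s (length L) (length l)) e)) ⟩
    + (c * q ^ suc s) -ᶻ + (c * q ^ s)
      ≡⟨ cong (λ z → + z -ᶻ + (c * q ^ s))
           (trans (cong (λ z → c * (z * q ^ s)) (sym suc-q)) (distrib c (q ∸ 1) (q ^ s))) ⟩
    + (c * q ^ s + (q ∸ 1) * c * q ^ s) -ᶻ + (c * q ^ s) ≡⟨ cong (_-ᶻ + (c * q ^ s)) (ℤ.pos-+ (c * q ^ s) _) ⟩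
    (+ (c * q ^ s) +ᶻ + ((q ∸ 1) * c * q ^ s)) -ᶻ + (c * q ^ s) ≡⟨ cancel (+ (c * q ^ s)) _ ⟩
    + ((q ∸ 1) ^ length (i ∷ L) * q ^ s) ∎
    where
    open ≡-Reasoning
    c = (q ∸ 1) ^ length L
    suc-q : suc (q ∸ 1) ≡ q
    suc-q = ℕ.m+[n∸m]≡n (ℕ.<⇒≤ q>1)
    shift : ∀ s a b → s + a + suc b ≡ s + suc a + b
    shift = solveℕ
    distrib : ∀ c r z → c * (suc r * z) ≡ c * z + r * c * z
    distrib = solveℕ
    cancel : ∀ a b → (a +ᶻ b) -ᶻ a ≡ b
    cancel = solveℤ

  module _ {r D} (pfs : All PrimeFactor (r ∷ D)) (D! : Unique (r ∷ D)) where

    private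
      f = Φ (r ∷ D)

    -- The recursion of `pascal` is that of inclusion-exclusion with the bounds added. At its leaves
    -- stand a complete sum of T, which is 0, or an intersection of dimension s, bounded trivially
    -- or by √Q according to 2s ≤ n.
    restricted-T : ∀ L l {s} → Picked L l → s + length L + length l ≡ n →
      ∣ restricted (T (r ∷ D)) L l ∣≤ f * pascal (rational q n) (length L) s + f * pascal (irrational q n) (length L) s √Q
    restricted-T [] [] pk e = estimate-cong
      (sym (trans (restricted-[] _ []) (trans (∑-cong els (λ x → ℤ.*-identityˡ _)) (∑T≡0 pfs D!)))) refl refl estimate-0
    restricted-T [] l@(_ ∷ l′) {s} pk e = estimate-cong (sym (restricted-[] _ l)) refl refl base
      where
      v = ∑F (λ x → ⟦ inside? l x ⟧ *ᶻ T (r ∷ D) x)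
      n≡ : n ≡ s + length l
      n≡ = trans (sym e) (cong (_+ length l) (ℕ.+-identityʳ s))
      s<n : s < n
      s<n = subst (s <_) (sym n≡) (ℕ.m<m+n s (s≤s z≤n))
      dim : n ∸ length l ≡ s
      dim = trans (cong (_∸ length l) n≡) (ℕ.m+n∸n≡m s (length l))
      affine = inside-affine (Split.right! pk) (s≤s z≤n)
      base : ∣ v ∣≤ f * rational q n s + f * irrational q n s √Q
      base rewrite dec-true (s <? n) s<n with 2 * s ≤? n
      ... | yes h rewrite dec-true (2 * s ≤? n) h = estimate 0 (begin
        ∣ v ∣ ≤⟨ affine-trivial-bound affine (inside? l) pfs ⟩
        f * q ^ (n ∸ length l) ≡⟨ cong (λ j → f * q ^ j) dim ⟩
        f * q ^ s ≡⟨ ℕ.+-identityʳ _ ⟨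
        f * q ^ s + 0 ∎) z≤n
        where open ℕ.≤-Reasoning
      ... | no h rewrite dec-false (2 * s ≤? n) h = estimate ∣ v ∣ (ℕ.m≤n+m ∣ v ∣ (f * 0))
        (subst (λ c → ∣ v ∣ * ∣ v ∣ ≤ c * c * Q) (sym (ℕ.*-identityʳ f)) (affine-sqrt-bound affine (inside? l) pfs D!))
    restricted-T (i ∷ L) l {s} pk e = estimate-cong (sym (restricted-step _ i L l))
      (sym (ℕ.*-distribˡ-+ f (pascal (rational q n) (length L) (suc s)) _))
      (sym (ℕ.*-distribˡ-+ f (pascal (irrational q n) (length L) (suc s)) _))
      (estimate-minus (restricted-T L l (dropHead pk) (trans (cong (_+ length l) (sym (ℕ.+-suc s (length L)))) e))
        (restricted-T L (i ∷ l) (moveHead pk) (trans (shift s (length L) (length l)) e)))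
      where
      shift : ∀ s a b → s + a + suc b ≡ s + suc a + b
      shift = solveℕ

  private
    length-allFin : length (allFin n) ≡ n
    length-allFin = length-tabulate {n = n} id

    total-length : 0 + length (allFin n) + 0 ≡ n
    total-length = trans (ℕ.+-identityʳ _) length-allFin

  -- The sieve over the complement of the hyperplanes

  β : Carrier → ℤ
  β x = ⟦ outside? (allFin n) x ⟧

  ∑β : ∑F β ≡ + ((q ∸ 1) ^ n)
  ∑β = trans (∑-cong els (λ x → sym (ℤ.*-identityʳ (β x)))) (trans (restricted-1 (allFin n) [] picked total-length)
    (cong +_ (trans (ℕ.*-identityʳ _) (cong ((q ∸ 1) ^_) length-allFin))))

  ∑βT : ∀ {r D} → All PrimeFactor (r ∷ D) → Unique (r ∷ D) →
    ∣ ∑F (λ x → β x *ᶻ T (r ∷ D) x) ∣≤ Φ (r ∷ D) * δRat q n + Φ (r ∷ D) * δIrr n √Q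
  ∑βT {r} {D} pfs D! = estimate-cong
    (∑-cong els (λ x → cong (β x *ᶻ_) (ℤ.*-identityˡ (T (r ∷ D) x))))
    (cong (Φ (r ∷ D) *_) (trans (cong (λ m → pascal (rational q n) m 0) length-allFin) (pascal-rational q n)))
    (cong (Φ (r ∷ D) *_) (trans (cong (λ m → pascal (irrational q n) m 0) length-allFin) (pascal-irrational q n)))
    (restricted-T pfs D! (allFin n) [] picked total-length)

  -- At each prime p of L both choices cost the same factor p - 1: the constant term is p - 1, and
  -- moving p into D multiplies `Φ D` by p - 1. So all 2^|L| expanded terms carry the same weight.
  weighted-∷ : ∀ L {r D} → Split PrimeFactor L (r ∷ D) → let c = Φ L * 2 ^ length L * Φ (r ∷ D) in
    ∣ weighted β L (r ∷ D) ∣≤ c * δRat q n + c * δIrr n √Q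
  weighted-∷ [] {r} {D} sp = estimate-cong
    (∑-cong els (λ x → cong (β x *ᶻ_) (sym (ℤ.*-identityˡ (T (r ∷ D) x)))))
    (cong (_* δRat q n) (sym (ℕ.*-identityˡ (Φ (r ∷ D))))) (cong (_* δIrr n) (sym (ℕ.*-identityˡ (Φ (r ∷ D)))))
    (∑βT (Split.right∀ sp) (Split.right! sp))
  weighted-∷ (s ∷ L) {r} {D} sp = estimate-cong (sym (weighted-step β s L (r ∷ D)))
    (collect (s ∸ 1) (Φ L) (2 ^ length L) (Φ (r ∷ D)) (δRat q n))
    (collect (s ∸ 1) (Φ L) (2 ^ length L) (Φ (r ∷ D)) (δIrr n))
    (estimate-minus (estimate-* (s ∸ 1) (weighted-∷ L (dropHead sp))) (weighted-∷ L (moveHead sp)))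
    where
    collect : ∀ t a b c d → t * (a * b * c * d) + a * b * (t * c) * d ≡ t * a * (2 * b) * c * d
    collect = solveℕ

  -- The number 2^|L| - 1 of nonempty sets of primes, grouped as in the recursion: once a prime is
  -- chosen, the remaining ones are free.
  errors : List ℕ → ℕ
  errors []      = 0
  errors (_ ∷ L) = 2 ^ length L + errors L

  suc-errors : ∀ L → suc (errors L) ≡ 2 ^ length L
  suc-errors []      = refl
  suc-errors (_ ∷ L) = trans (sym (ℕ.+-suc (2 ^ length L) (errors L)))
    (trans (cong (λ z → 2 ^ length L + z) (suc-errors L)) (cong (λ z → 2 ^ length L + z) (sym (ℕ.+-identityʳ _))))

  -- The number of nonzero elements of S*, since the empty sieve is 1 and `T []` tests for being
  -- nonzero.
  main-term : ℤ
  main-term = weighted β [] []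

  -- Taking p - 1 at every prime yields `Φ L` times the main term; every other expansion reaches a
  -- nonempty D and is estimated by `weighted-∷`.
  weighted-[] : ∀ L → Split PrimeFactor L [] → let c = Φ L * errors L in
    ∣ weighted β L [] -ᶻ + Φ L *ᶻ main-term ∣≤ c * δRat q n + c * δIrr n √Q
  weighted-[] [] sp = estimate-cong (sym (trans (cong (λ z → main-term -ᶻ z) (ℤ.*-identityˡ main-term)) (ℤ.+-inverseʳ main-term)))
    refl refl estimate-0
  weighted-[] (s ∷ L) sp = estimate-cong
    (sym (trans (cong₂ (λ a b → a -ᶻ b *ᶻ main-term) (weighted-step β s L []) (ℤ.pos-* (s ∸ 1) (Φ L)))
      (regroup (+ (s ∸ 1)) (weighted β L []) (weighted β L (s ∷ [])) (+ Φ L) main-term)))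
    (collect (s ∸ 1) (Φ L) (2 ^ length L) (errors L) (δRat q n))
    (collect (s ∸ 1) (Φ L) (2 ^ length L) (errors L) (δIrr n))
    (estimate-minus (estimate-* (s ∸ 1) (weighted-[] L (dropHead sp))) (weighted-∷ L (moveHead sp)))
    where
    regroup : ∀ t a b c m → (t *ᶻ a -ᶻ b) -ᶻ (t *ᶻ c) *ᶻ m ≡ t *ᶻ (a -ᶻ c *ᶻ m) -ᶻ b
    regroup = solveℤ
    collect : ∀ t a b e d → t * (a * e * d) + a * b * (t * 1) * d ≡ t * a * (b + e) * d
    collect = solveℕ

  -- At most the single element 0 is lost from the exact count (q - 1)^n; whether it lies in S* is
  -- left open.
  main-term-lower : + ((q ∸ 1) ^ n) ≤ᶻ main-term +ᶻ 1ℤ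
  main-term-lower = subst₂ _≤ᶻ_ ∑β (cong (λ z → main-term +ᶻ z) (∑F-δ 0# (λ _ → 1ℤ)))
    (subst (∑F β ≤ᶻ_) (∑-+ els _ _) (∑-mono els le))
    where
    le : ∀ x → β x ≤ᶻ β x *ᶻ (1ℤ *ᶻ T [] x) +ᶻ ⟦ 0# ≟ x ⟧ *ᶻ 1ℤ
    -- `T []` tests `x ≟ 0#` and the delta term `0# ≟ x`, so both are matched; a mixed answer is
    -- either contradictory or leaves the inequality true.
    le x with outside? (allFin n) x | x ≟ 0# | 0# ≟ x
    ... | yes _ | yes _   | yes _   = ℤ.≤-refl
    ... | yes _ | yes x≡0 | no 0≢x  = contradiction (sym x≡0) 0≢x
    ... | yes _ | no _    | yes _   = ℤ.+≤+ (s≤s z≤n)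
    ... | yes _ | no _    | no _    = ℤ.≤-refl
    ... | no _  | _       | yes _   = ℤ.+≤+ z≤n
    ... | no _  | _       | no _    = ℤ.≤-refl

  module _ (2≤n : 2 ≤ n) {P} (count : CountIs F (λ x → IsPrimitive F x × InSStar F A x) P) where

    weighted-count : weighted β ps [] ≡ + (product ps * P)
    weighted-count = begin
      ∑F (λ x → β x *ᶻ (sieve ps x *ᶻ T [] x))
        ≡⟨ ∑-cong els (λ x → trans (cong (β x *ᶻ_) (sieve-primitive x)) (*ᶻ.x∙yz≈y∙xz (β x) (+ product ps) _)) ⟩
      ∑F (λ x → + product ps *ᶻ (β x *ᶻ ⟦ primitive? x ⟧)) ≡⟨ ∑-*ˡ els (+ product ps) _ ⟩
      + product ps *ᶻ ∑F (λ x → β x *ᶻ ⟦ primitive? x ⟧)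
        ≡⟨ cong (+ product ps *ᶻ_) (∑-cong els (λ x →
             trans (ℤ.*-comm (β x) _) (sym (⟦⟧-× (primitive? x) (inSStar? x))))) ⟩
      + product ps *ᶻ ∑F (⟦_⟧ ∘ counted?)
        ≡⟨ cong (+ product ps *ᶻ_) (count-⟦⟧ counted? els! ys! (λ {x} m → complete x , proj₁ (ys⇔ x) m) (λ {x} _ → proj₂ (ys⇔ x))) ⟩
      + product ps *ᶻ + length ys ≡⟨ cong (λ m → + product ps *ᶻ + m) len ⟩
      + product ps *ᶻ + P ≡⟨ ℤ.pos-* (product ps) P ⟨
      + (product ps * P) ∎
      where
      open ≡-Reasoning
      ys = proj₁ count
      ys! = proj₁ (proj₂ count)
      ys⇔ = proj₁ (proj₂ (proj₂ count))
      len = proj₂ (proj₂ (proj₂ count))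
      inSStar? : Decidable (InSStar F A)
      inSStar? x = map′ (λ out i → All.lookup out (∈-allFin i)) (λ h → All.tabulate λ {i} _ → h i) (outside? (allFin n) x)
      counted? : Decidable (λ x → IsPrimitive F x × InSStar F A x)
      counted? x = primitive? x ×-dec inSStar? x

    bound-N : LtSqrt (+ (φ N * (q ∸ 1) ^ n) -ᶻ + (φ N * δRat q n * W N + N * P)) (φ N * δIrr n * W N) Q
    bound-N with weighted-[] ps split-ps
    ... | estimate y hv hy = final-estimate
      {φ N} {product ps} {Φ ps} {N} {(q ∸ 1) ^ n} {P} {δRat q n} {δIrr n} {W N} {errors ps} {y} {Q}
      (trans (cong (_* product ps) φN≡) (trans (ℕ.*-comm (length primitives) (product ps)) count-primitives))
      Φps>0 N>0 (productOfPrimes≥1 (All.map proj₁ ps-prime)) (2≤δRat (ℕ.<-trans (s≤s z≤n) q>1) 2≤n)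
      -- The hypothesis e < w reads 2^ω ≤ W(N), as `errors ps` is one less than 2^ω.
      (ℕ.≤-trans (ℕ.≤-reflexive (suc-errors ps)) (2^≤W N>0)) main hy
      where
      open ℤ.≤-Reasoning
      d = weighted β ps [] -ᶻ + Φ ps *ᶻ main-term
      main : Φ ps * (q ∸ 1) ^ n ≤ product ps * P + (Φ ps * errors ps * δRat q n + y) + Φ ps
      main = ℤ.drop‿+≤+ (begin
        + (Φ ps * (q ∸ 1) ^ n) ≡⟨ ℤ.pos-* (Φ ps) _ ⟩
        + Φ ps *ᶻ + ((q ∸ 1) ^ n) ≤⟨ ℤ.*-monoˡ-≤-nonNeg (+ Φ ps) main-term-lower ⟩
        + Φ ps *ᶻ (main-term +ᶻ 1ℤ) ≡⟨ regroup (+ Φ ps) main-term (weighted β ps []) ⟩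
        weighted β ps [] -ᶻ d +ᶻ + Φ ps
          ≤⟨ ℤ.+-monoˡ-≤ (+ Φ ps) (ℤ.+-mono-≤ (ℤ.≤-reflexive weighted-count)
               (ℤ.≤-trans (i≤∣i∣ (ℤ.- d)) (ℤ.+≤+ (subst (_≤ Φ ps * errors ps * δRat q n + y) (sym (ℤ.∣-i∣≡∣i∣ d)) hv)))) ⟩
        + (product ps * P + (Φ ps * errors ps * δRat q n + y) + Φ ps) ∎)
        where
        regroup : ∀ f m w → f *ᶻ (m +ᶻ 1ℤ) ≡ w -ᶻ (w -ᶻ f *ᶻ m) +ᶻ f
        regroup = solveℤ
        i≤∣i∣ : ∀ i → i ≤ᶻ + ∣ i ∣
        i≤∣i∣ (+ m)        = ℤ.≤-refl
        i≤∣i∣ ℤ.-[1+ m ] = ℤ.-≤+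

    bound : Bound q n P
    bound = subst₂ (λ Q N → LtSqrt (+ (φ N * (q ∸ 1) ^ n) -ᶻ + (φ N * δRat q n * W N + N * P)) (φ N * δIrr n * W N) Q)
      card (sym (trans (cong (_∸ 1) (sym card)) (cong (_∸ 1) length≡1+N))) bound-N

theorem3p2 : (q n : ℕ) → IsPrimePower q → 2 ≤ n →
    (F : Field) → HasCardinality F (q ^ n) →
    (A : Fin n → Field.Carrier F → Set) →
    (∀ i → IsAffineHyperplane F q n (A i)) →
    PairwiseDistinct F A →
    GeneralPosition F q n A →
    (P : ℕ) → CountIs F (λ x → IsPrimitive F x × InSStar F A x) P →
    Bound q n P
theorem3p2 q n (p , k , pr , 1≤k , refl) 2≤n F (els , els! , complete , card) A hyperplane _ general P count =
  Arrangement.bound F els els! complete p k n pr 1≤k card A hyperplane general 2≤n count
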